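{- Let $r$ be an odd positive integer not divisible by any of $3$, $5$, $17$, $257$, $641$, $65537$, $6700417$. Then there exist infinitely many primes $p$ such that $2^{\alpha}p$ is a Schemmel nontotient number of order $r$ for every nonnegative integer $\alpha$.
   Context: For a positive integer $r$, the Schemmel totient function $S_r$ is the multiplicative arithmetic function determined by $S_r(p^{\alpha}) = 0$ if $p \le r$ and $S_r(p^{\alpha}) = p^{\alpha-1}(p-r)$ if $p > r$, for all primes $p$ and positive integers $\alpha$ (and $S_r(1)=1$). A Schemmel nontotient number of order $r$ is a positive integer not in the range of $S_r$. -}

module Defs where

open import Data.Nat using (ℕ; zero; suc; _+_; _*_; _∸_; _^_; _≤_; _<_; _≤?_)
open import Data.Nat.Divisibility using (_∣_; _∣?_; divides)
open import Data.Nat.Primality using (Prime; prime?)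
open import Data.List using (List; map; filter; upTo)
open import Data.Nat.ListAction using (product)
open import Data.Product using (∃; _×_; _,_)
open import Relation.Nullary using (¬_; Dec; yes; no; _×-dec_)
open import Relation.Binary.PropositionalEquality using (_≡_)

-- p-adic valuation of m (for p ≥ 2, m ≥ 1), computed with fuel;
-- fuel m is enough since p^k ∣ m ≥ 1 forces k < m.
val-fuel : ℕ → ℕ → ℕ → ℕ
val-fuel zero    p m = 0
val-fuel (suc k) p m with p ∣? m
... | yes (divides q _) = suc (val-fuel k p q)
... | no _              = 0

val : ℕ → ℕ → ℕ
val p m = val-fuel m p m

S-local : ℕ → ℕ → ℕ → ℕ
S-local r p α with p ≤? r
... | yes _ = 0
... | no _  = p ^ (α ∸ 1) * (p ∸ r)

primeDivisors : ℕ → List ℕ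
primeDivisors m = filter (λ p → prime? p ×-dec (p ∣? m)) (upTo (suc m))

-- Schemmel totient S_r, extended multiplicatively: S_r(1) = 1 (empty product);
-- S_r(m) = ∏_{p ∣ m prime} S_r(p^{v_p(m)}).  (Only used for m ≥ 1.)
S : ℕ → ℕ → ℕ
S r m = product (map (λ p → S-local r p (val p m)) (primeDivisors m))

SchemmelNontotient : ℕ → ℕ → Set
SchemmelNontotient r n = (1 ≤ n) × (¬ ∃ λ m → (1 ≤ m) × (S r m ≡ n))

{-# OPTIONS --safe #-}
module Submission where

-- Since 2^64 - 1 = 3·5·17·257·641·65537·6700417, a prime p ≡ r modulo the first six of these primes and p ≡ -r modulo
-- 6700417 makes 2^β p + r divisible by one of the seven for every β.  If S_r(m) = 2^α p, then p divides some q - r with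
-- q = 2^β p + r prime, which is impossible, or p ∣ m and 3 ∣ p - r ∣ 2^α p, which is impossible too.
--
-- That such p exist is Dirichlet's theorem, proved here over ℚ without limits, logarithms or complex characters.  The
-- harmonic sum h replaces the logarithm.  Write P(x) for the element ∑_{n ≤ x} Λ(n)/n [n] of the group algebra of the
-- units modulo q and L for ∑ 1/m [m], both taken modulo the trivial character.  Then L P(y) = O(1) and
-- h(x) + P(x) = L Q(x) + O(1), so for x much smaller than y the product (h(x) + P(x)) P(y) is negligible.  If the class
-- of a contained no primes, this quadratic relation would force the normalised deviations from equidistribution to be
-- ±1 everywhere and to form a real character ψ with ∑ Λ(n) ψ(n)/n ≈ -h(x), whence L(1, ψ) ≈ 0.  But L(1, ψ) is bounded
-- below, because ∑_{d ∣ n} ψ(d) is nonnegative, and at least 1 when n is a square.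

open import Data.Nat.Primality using (Prime; prime?; prime⇒irreducible; prime⇒nonTrivial; prime⇒nonZero; euclidsLemma; rough∧square>⇒prime;
    _Rough_; prime[2])
open import Data.Nat.Coprimality as Coprimality using (Coprime; coprime?; coprime-divisor)
open import Data.Nat.ListAction using (product)
open import Data.Nat.ListAction.Properties using (∈⇒∣product)
open import Data.List using (List; []; _∷_; map; upTo)
open import Data.List.Membership.Propositional using (_∈_)
open import Data.List.Membership.Propositional.Properties using (∈-map⁺; ∈-filter⁻)
open import Data.List.Relation.Unary.All as All using (All; []; _∷_)
open import Data.List.Relation.Unary.Any using (here; there)
open import Data.Product using (∃; _×_; _,_; proj₁; proj₂)
open import Data.Sum using (_⊎_; inj₁; inj₂; [_,_]′)
open import Data.Empty using (⊥; ⊥-elim)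
open import Function using (_∘_)
open import Relation.Nullary using (¬_; Dec; yes; no; contradiction; _×-dec_; ¬?)
open import Relation.Nullary.Decidable using (from-yes; from-no; dec⇒maybe)
open import Relation.Binary.PropositionalEquality using (_≡_; _≢_; refl; sym; trans; cong; cong₂; subst; subst₂; module ≡-Reasoning)

-- In terms of characters the quadratic relation says that t = P(χ)/log x satisfies t(1 + t) ≈ 0.
-- The normalised deviation is therefore close to the sum of the nontrivial χ with L(1, χ) = 0, and
-- up to a factor φ it reproduces itself under convolution. Masses are non-negative, so no deviation
-- exceeds 1, and a class without primes attains 1 in the limit; this extremality takes the place of
-- a choice of character. The relation is not symmetric: convolving with the deviation at x
-- preserves the one at y only if x is far below y. Bounding a deviation from below takes such a
-- convolution, and both factors of the decisive one need that bound, hence three scales. The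
-- stand-in for log is additive only up to 1/T, so T lies beyond every scale. Nothing is circular,
-- because its growth is bounded below by harmonic numbers that do not involve T. The covering works
-- because the Fermat number 2^32 + 1 = 641·6700417 is composite: 2 has order 64 modulo both
-- factors, so one takes the exponents 32 modulo 64 and the other is free for the exponents 0 modulo
-- 64, where p ≡ -r is needed.

module PrimesInProgressions where

  open import Data.Nat as ℕ using (ℕ; zero; suc; z≤n; s≤s; z<s; NonZero)
  import Data.Nat.Properties as ℕ
  import Data.Nat.Induction as ℕInd
  import Data.Nat.GCD as GCD
  open import Data.Nat.Divisibility as Div using (_∣_; _∣?_; divides)
  open import Data.Nat.DivMod as DM using (_%_)
  open import Data.Nat.Primality.Factorisation using (PrimeFactorisation; factorise; factorisationUnique; factorisationHasAllPrimeFactors)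
  open import Data.Integer using (+≤+)
  open import Data.Rational as ℚ using (ℚ; 0ℚ; 1ℚ; _+_; _*_; -_; _-_; _≤_; _<_; ∣_∣; ½; _≤?_)
  import Data.Rational.Properties as ℚ
  open import Data.Rational.Properties using (≤-refl; ≤-reflexive; ≤-trans; +-mono-≤; +-*-commutativeRing; 0≤∣p∣; ∣p+q∣≤∣p∣+∣q∣;
      ∣p*q∣≡∣p∣*∣q∣)
  open import Data.List.Membership.DecPropositional ℕ._≟_ using (_∈?_)
  open import Data.List.Relation.Binary.Permutation.Propositional as Perm using (_↭_)
  open import Data.List.Relation.Binary.Permutation.Propositional.Properties using (∈-resp-↭)
  open import Tactic.RingSolver using (solve-∀)
  open import Tactic.RingSolver.Core.AlmostCommutativeRing using (AlmostCommutativeRing; fromCommutativeRing)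

  -- Finite sums of rationals

  ℚring : AlmostCommutativeRing _ _
  ℚring = fromCommutativeRing +-*-commutativeRing (λ x → dec⇒maybe (0ℚ ℚ.≟ x))

  ≤-by : ∀ {a b} d → 0ℚ ≤ d → b ≡ a + d → a ≤ b
  ≤-by {a} {b} d 0≤d eq = subst (a ≤_) (sym eq) (subst (_≤ a + d) (ℚ.+-identityʳ a) (ℚ.+-monoʳ-≤ a 0≤d))

  0≤-diff : ∀ {a b} → a ≤ b → 0ℚ ≤ b - a
  0≤-diff {a} {b} a≤b = subst (_≤ b - a) (ℚ.+-inverseʳ a) (ℚ.+-monoˡ-≤ (- a) a≤b)

  0≤1 : 0ℚ ≤ 1ℚ
  0≤1 = ℚ.*≤* (+≤+ z≤n)

  0≤+ : ∀ {a b} → 0ℚ ≤ a → 0ℚ ≤ b → 0ℚ ≤ a + b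
  0≤+ = +-mono-≤

  *-monoʳ : ∀ {r p q} → 0ℚ ≤ r → p ≤ q → r * p ≤ r * q
  *-monoʳ {r} 0≤r = ℚ.*-monoˡ-≤-nonNeg r {{ℚ.nonNegative 0≤r}}

  *-monoˡ : ∀ {r p q} → 0ℚ ≤ r → p ≤ q → p * r ≤ q * r
  *-monoˡ {r} 0≤r = ℚ.*-monoʳ-≤-nonNeg r {{ℚ.nonNegative 0≤r}}

  0≤* : ∀ {a b} → 0ℚ ≤ a → 0ℚ ≤ b → 0ℚ ≤ a * b
  0≤* {a} {b} 0≤a 0≤b = subst (_≤ a * b) (ℚ.*-zeroʳ a) (*-monoʳ 0≤a 0≤b)

  *-mono : ∀ {a b c d} → 0ℚ ≤ b → 0ℚ ≤ c → a ≤ b → c ≤ d → a * c ≤ b * d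
  *-mono 0≤b 0≤c a≤b c≤d = ≤-trans (*-monoˡ 0≤c a≤b) (*-monoʳ 0≤b c≤d)

  *-cancelˡ : ∀ {r p q} → 0ℚ < r → r * p ≤ r * q → p ≤ q
  *-cancelˡ {r} 0<r = ℚ.*-cancelˡ-≤-pos r {{ℚ.positive 0<r}}

  <⇒≤ : ∀ {a b} → a < b → a ≤ b
  <⇒≤ = ℚ.<⇒≤

  ∣∣-≤ : ∀ {x c} → x ≤ c → - c ≤ x → ∣ x ∣ ≤ c
  ∣∣-≤ {x} {c} x≤c -c≤x with ℚ.∣p∣≡p∨∣p∣≡-p x
  ... | inj₁ e = subst (_≤ c) (sym e) x≤c
  ... | inj₂ e = subst (_≤ c) (sym e) (subst (- x ≤_) (lem c) (ℚ.neg-antimono-≤ -c≤x))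
    where lem : ∀ c → - (- c) ≡ c
          lem = solve-∀ ℚring

  x≤∣x∣ : ∀ x → x ≤ ∣ x ∣
  x≤∣x∣ x with ℚ.∣p∣≡p∨∣p∣≡-p x | ℚ.≤-total 0ℚ x
  ... | _ | inj₁ p = ≤-reflexive (sym (ℚ.0≤p⇒∣p∣≡p p))
  ... | _ | inj₂ p = ≤-trans p (0≤∣p∣ x)

  -∣x∣≤x : ∀ x → - ∣ x ∣ ≤ x
  -∣x∣≤x x = subst (- ∣ x ∣ ≤_) (lem x) (ℚ.neg-antimono-≤ (subst (- x ≤_) (ℚ.∣-p∣≡∣p∣ x) (x≤∣x∣ (- x))))
    where lem : ∀ c → - (- c) ≡ c
          lem = solve-∀ ℚring

  ∣∣-upper : ∀ {x c} → ∣ x ∣ ≤ c → x ≤ c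
  ∣∣-upper {x} p = ≤-trans (x≤∣x∣ x) p

  ∣∣-lower : ∀ {x c} → ∣ x ∣ ≤ c → - c ≤ x
  ∣∣-lower {x} p = ≤-trans (ℚ.neg-antimono-≤ p) (-∣x∣≤x x)

  ∣∣-tri : ∀ {x y a b} → ∣ x ∣ ≤ a → ∣ y ∣ ≤ b → ∣ x + y ∣ ≤ a + b
  ∣∣-tri {x} {y} p q = ≤-trans (∣p+q∣≤∣p∣+∣q∣ x y) (+-mono-≤ p q)

  ∣∣-neg : ∀ {x a} → ∣ x ∣ ≤ a → ∣ - x ∣ ≤ a
  ∣∣-neg {x} p = subst (_≤ _) (sym (ℚ.∣-p∣≡∣p∣ x)) p

  ∣∣-tri- : ∀ {x y a b} → ∣ x ∣ ≤ a → ∣ y ∣ ≤ b → ∣ x - y ∣ ≤ a + b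
  ∣∣-tri- p q = ∣∣-tri p (∣∣-neg q)

  ∣∣-* : ∀ {x y a b} → ∣ x ∣ ≤ a → ∣ y ∣ ≤ b → ∣ x * y ∣ ≤ a * b
  ∣∣-* {x} {y} {a} {b} p q =
    subst (_≤ a * b) (sym (∣p*q∣≡∣p∣*∣q∣ x y)) (*-mono (≤-trans (0≤∣p∣ x) p) (0≤∣p∣ y) p q)

  ∣∣-nonneg : ∀ {x} → 0ℚ ≤ x → ∣ x ∣ ≤ x
  ∣∣-nonneg p = ≤-reflexive (ℚ.0≤p⇒∣p∣≡p p)

  -- Sums run over 1 ≤ i ≤ n.
  Σ : ℕ → (ℕ → ℚ) → ℚ
  Σ zero    f = 0ℚ
  Σ (suc n) f = Σ n f + f (suc n)

  Σ-cong : ∀ n {f g : ℕ → ℚ} → (∀ i → 1 ℕ.≤ i → i ℕ.≤ n → f i ≡ g i) → Σ n f ≡ Σ n g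
  Σ-cong zero    e = refl
  Σ-cong (suc n) e = cong₂ _+_ (Σ-cong n λ i a b → e i a (ℕ.m≤n⇒m≤1+n b)) (e (suc n) z<s ℕ.≤-refl)

  Σ-ext : ∀ n {f g : ℕ → ℚ} → (∀ i → f i ≡ g i) → Σ n f ≡ Σ n g
  Σ-ext n e = Σ-cong n λ i _ _ → e i

  Σ-mono : ∀ n {f g : ℕ → ℚ} → (∀ i → 1 ℕ.≤ i → i ℕ.≤ n → f i ≤ g i) → Σ n f ≤ Σ n g
  Σ-mono zero    e = ≤-refl
  Σ-mono (suc n) e = +-mono-≤ (Σ-mono n λ i a b → e i a (ℕ.m≤n⇒m≤1+n b)) (e (suc n) z<s ℕ.≤-refl)

  Σ-zero : ∀ n {f : ℕ → ℚ} → (∀ i → 1 ℕ.≤ i → i ℕ.≤ n → f i ≡ 0ℚ) → Σ n f ≡ 0ℚ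
  Σ-zero zero    e = refl
  Σ-zero (suc n) e = cong₂ _+_ (Σ-zero n λ i a b → e i a (ℕ.m≤n⇒m≤1+n b)) (e (suc n) z<s ℕ.≤-refl)

  Σ-≥0 : ∀ n {f : ℕ → ℚ} → (∀ i → 1 ℕ.≤ i → i ℕ.≤ n → 0ℚ ≤ f i) → 0ℚ ≤ Σ n f
  Σ-≥0 n {f} e = subst (_≤ Σ n f) (Σ-zero n {λ _ → 0ℚ} λ _ _ _ → refl) (Σ-mono n e)

  Σ-+ : ∀ n (f g : ℕ → ℚ) → Σ n (λ i → f i + g i) ≡ Σ n f + Σ n g
  Σ-+ zero    f g = refl
  Σ-+ (suc n) f g = trans (cong (_+ (f (suc n) + g (suc n))) (Σ-+ n f g)) (lem (Σ n f) (Σ n g) (f (suc n)) (g (suc n)))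
    where lem : ∀ a b c d → (a + b) + (c + d) ≡ (a + c) + (b + d)
          lem = solve-∀ ℚring

  Σ-*ˡ : ∀ n c (f : ℕ → ℚ) → Σ n (λ i → c * f i) ≡ c * Σ n f
  Σ-*ˡ zero    c f = sym (ℚ.*-zeroʳ c)
  Σ-*ˡ (suc n) c f = trans (cong (_+ c * f (suc n)) (Σ-*ˡ n c f)) (sym (ℚ.*-distribˡ-+ c _ _))

  Σ-*ʳ : ∀ n c (f : ℕ → ℚ) → Σ n (λ i → f i * c) ≡ Σ n f * c
  Σ-*ʳ n c f = trans (Σ-ext n λ i → ℚ.*-comm (f i) c) (trans (Σ-*ˡ n c f) (ℚ.*-comm c _))

  Σ-neg : ∀ n (f : ℕ → ℚ) → Σ n (λ i → - f i) ≡ - Σ n f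
  Σ-neg zero    f = refl
  Σ-neg (suc n) f = trans (cong (_+ - f (suc n)) (Σ-neg n f)) (sym (ℚ.neg-distrib-+ (Σ n f) (f (suc n))))

  Σ-diff : ∀ n (f g : ℕ → ℚ) → Σ n (λ i → f i - g i) ≡ Σ n f - Σ n g
  Σ-diff n f g = trans (Σ-+ n f (λ i → - g i)) (cong (Σ n f +_) (Σ-neg n g))

  Σ-abs : ∀ n {f g : ℕ → ℚ} → (∀ i → 1 ℕ.≤ i → i ℕ.≤ n → ∣ f i ∣ ≤ g i) → ∣ Σ n f ∣ ≤ Σ n g
  Σ-abs zero    e = ≤-refl
  Σ-abs (suc n) e = ∣∣-tri (Σ-abs n λ i a b → e i a (ℕ.m≤n⇒m≤1+n b)) (e (suc n) z<s ℕ.≤-refl)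

  Σ-swap : ∀ n m (F : ℕ → ℕ → ℚ) → Σ n (λ i → Σ m (F i)) ≡ Σ m (λ j → Σ n (λ i → F i j))
  Σ-swap zero    m F = sym (Σ-zero m λ _ _ _ → refl)
  Σ-swap (suc n) m F = trans (cong (_+ Σ m (F (suc n))) (Σ-swap n m F)) (sym (Σ-+ m _ _))

  Σ-append : ∀ m n (f : ℕ → ℚ) → Σ (m ℕ.+ n) f ≡ Σ m f + Σ n (λ i → f (m ℕ.+ i))
  Σ-append m zero    f = trans (cong (λ k → Σ k f) (ℕ.+-identityʳ m)) (sym (ℚ.+-identityʳ _))
  Σ-append m (suc n) f = trans (cong (λ k → Σ k f) (ℕ.+-suc m n))
    (trans (cong₂ _+_ (Σ-append m n f) (cong f (sym (ℕ.+-suc m n)))) (ℚ.+-assoc (Σ m f) (Σ n (λ i → f (m ℕ.+ i))) (f (m ℕ.+ suc n))))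

  Σ-tail : ∀ {m n} (f : ℕ → ℚ) → m ℕ.≤ n → Σ n f ≡ Σ m f + Σ (n ℕ.∸ m) (λ i → f (m ℕ.+ i))
  Σ-tail {m} {n} f m≤n = trans (cong (λ k → Σ k f) (sym (ℕ.m+[n∸m]≡n m≤n))) (Σ-append m (n ℕ.∸ m) f)

  tail-range : ∀ {m n i} → m ℕ.≤ n → i ℕ.≤ n ℕ.∸ m → m ℕ.+ i ℕ.≤ n
  tail-range {m} m≤n i≤ = ℕ.≤-trans (ℕ.+-monoʳ-≤ m i≤) (ℕ.≤-reflexive (ℕ.m+[n∸m]≡n m≤n))

  Σ-extend : ∀ {m n} {f : ℕ → ℚ} → m ℕ.≤ n → (∀ i → m ℕ.< i → i ℕ.≤ n → f i ≡ 0ℚ) → Σ n f ≡ Σ m f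
  Σ-extend {m} {n} {f} m≤n z = trans (Σ-tail f m≤n) (trans (cong (Σ m f +_)
    (Σ-zero (n ℕ.∸ m) λ i 1≤i i≤ → z (m ℕ.+ i) (ℕ.m<m+n m 1≤i) (tail-range m≤n i≤))) (ℚ.+-identityʳ _))

  Σ-mono-range : ∀ {m n} {f : ℕ → ℚ} → m ℕ.≤ n → (∀ i → m ℕ.< i → i ℕ.≤ n → 0ℚ ≤ f i) → Σ m f ≤ Σ n f
  Σ-mono-range {m} {n} {f} m≤n z = ≤-by _
    (Σ-≥0 (n ℕ.∸ m) λ i 1≤i i≤ → z (m ℕ.+ i) (ℕ.m<m+n m 1≤i) (tail-range m≤n i≤)) (Σ-tail f m≤n)

  Σ-single : ∀ n k {f : ℕ → ℚ} → 1 ℕ.≤ k → k ℕ.≤ n → (∀ i → 1 ℕ.≤ i → i ℕ.≤ n → i ≢ k → f i ≡ 0ℚ) → Σ n f ≡ f k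
  Σ-single n (suc k) {f} 1≤k k≤n z = trans (Σ-extend k≤n λ i k<i i≤n → z i (ℕ.≤-trans 1≤k (ℕ.<⇒≤ k<i)) i≤n (ℕ.>⇒≢ k<i))
    (trans (cong (_+ f (suc k)) (Σ-zero k λ i 1≤i i≤k → z i 1≤i (ℕ.≤-trans i≤k (ℕ.<⇒≤ k≤n)) (ℕ.<⇒≢ (s≤s i≤k)))) (ℚ.+-identityˡ _))

  Σ-term : ∀ n k {f : ℕ → ℚ} → 1 ℕ.≤ k → k ℕ.≤ n → (∀ i → 1 ℕ.≤ i → i ℕ.≤ n → 0ℚ ≤ f i) → f k ≤ Σ n f
  Σ-term n (suc k) {f} 1≤k k≤n z = ≤-trans
    (≤-by (Σ k f) (Σ-≥0 k λ i 1≤i i≤k → z i 1≤i (ℕ.≤-trans i≤k (ℕ.<⇒≤ k≤n))) (ℚ.+-comm (Σ k f) (f (suc k))))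
    (Σ-mono-range k≤n λ i k<i i≤n → z i (ℕ.≤-trans 1≤k (ℕ.<⇒≤ k<i)) i≤n)

  𝟙 : {A : Set} → Dec A → ℚ
  𝟙 (yes _) = 1ℚ
  𝟙 (no _)  = 0ℚ

  𝟙-yes : {A : Set} (d : Dec A) → A → 𝟙 d ≡ 1ℚ
  𝟙-yes (yes _) a = refl
  𝟙-yes (no ¬a) a = contradiction a ¬a

  𝟙-no : {A : Set} (d : Dec A) → ¬ A → 𝟙 d ≡ 0ℚ
  𝟙-no (yes a) ¬a = contradiction a ¬a
  𝟙-no (no _)  ¬a = refl

  𝟙-cong : {A B : Set} (d : Dec A) (e : Dec B) → (A → B) → (B → A) → 𝟙 d ≡ 𝟙 e
  𝟙-cong (yes a) e f g = sym (𝟙-yes e (f a))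
  𝟙-cong (no ¬a) e f g = sym (𝟙-no e (¬a ∘ g))

  𝟙-≥0 : {A : Set} (d : Dec A) → 0ℚ ≤ 𝟙 d
  𝟙-≥0 (yes _) = 0≤1
  𝟙-≥0 (no _)  = ≤-refl

  𝟙-≤1 : {A : Set} (d : Dec A) → 𝟙 d ≤ 1ℚ
  𝟙-≤1 (yes _) = ≤-refl
  𝟙-≤1 (no _)  = 0≤1

  𝟙-¬ : {A : Set} (d : Dec A) → 𝟙 d + 𝟙 (¬? d) ≡ 1ℚ
  𝟙-¬ (yes _) = refl
  𝟙-¬ (no _)  = refl

  -- Unary recursion makes `ι (suc n)` unfold to `ι n + 1ℚ`, and numerals such as `ι 18` to closed
  -- constants in ring identities.
  ι : ℕ → ℚ
  ι zero    = 0ℚ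
  ι (suc n) = ι n + 1ℚ

  ι-+ : ∀ m n → ι (m ℕ.+ n) ≡ ι m + ι n
  ι-+ zero    n = sym (ℚ.+-identityˡ _)
  ι-+ (suc m) n = trans (cong (_+ 1ℚ) (ι-+ m n)) (lem (ι m) (ι n))
    where lem : ∀ a b → (a + b) + 1ℚ ≡ (a + 1ℚ) + b
          lem = solve-∀ ℚring

  ι-* : ∀ m n → ι (m ℕ.* n) ≡ ι m * ι n
  ι-* zero    n = sym (ℚ.*-zeroˡ (ι n))
  ι-* (suc m) n = trans (ι-+ n (m ℕ.* n)) (trans (cong (ι n +_) (ι-* m n)) (lem (ι m) (ι n)))
    where lem : ∀ a b → b + a * b ≡ (a + 1ℚ) * b
          lem = solve-∀ ℚring

  ι-≥0 : ∀ n → 0ℚ ≤ ι n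
  ι-≥0 zero    = ≤-refl
  ι-≥0 (suc n) = 0≤+ (ι-≥0 n) 0≤1

  ι-mono : ∀ {m n} → m ℕ.≤ n → ι m ≤ ι n
  ι-mono {n = n} z≤n = ι-≥0 n
  ι-mono (s≤s p) = ℚ.+-monoˡ-≤ 1ℚ (ι-mono p)

  0<1 : 0ℚ < 1ℚ
  0<1 = ℚ.positive⁻¹ 1ℚ

  0<ι : ∀ {n} → 1 ℕ.≤ n → 0ℚ < ι n
  0<ι {suc n} _ = ℚ.<-≤-trans 0<1 (≤-by (ι n) (ι-≥0 n) (ℚ.+-comm (ι n) 1ℚ))

  -- The value 0 at 0 keeps `inv` total and `inv-*` free of hypotheses.
  inv : ℕ → ℚ
  inv zero    = 0ℚ
  inv (suc n) = ℚ.1/_ (ι (suc n)) {{ℚ.pos⇒nonZero (ι (suc n)) {{ℚ.positive (0<ι {suc n} z<s)}}}}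

  ι*inv : ∀ {n} → 1 ℕ.≤ n → ι n * inv n ≡ 1ℚ
  ι*inv {suc n} _ = ℚ.*-inverseʳ (ι (suc n)) {{ℚ.pos⇒nonZero (ι (suc n)) {{ℚ.positive (0<ι {suc n} z<s)}}}}

  inv-≥0 : ∀ n → 0ℚ ≤ inv n
  inv-≥0 zero    = ≤-refl
  inv-≥0 (suc n) = *-cancelˡ (0<ι {suc n} z<s) (subst₂ _≤_ (sym (ℚ.*-zeroʳ (ι (suc n)))) (sym (ι*inv {suc n} z<s)) 0≤1)

  inv-unique : ∀ {n x} → 1 ℕ.≤ n → ι n * x ≡ 1ℚ → x ≡ inv n
  inv-unique {n} {x} 1≤n e = trans (lem₁ x) (trans (cong (_* x) (sym (ι*inv 1≤n))) (trans (lem (ι n) (inv n) x)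
    (trans (cong (inv n *_) e) (ℚ.*-identityʳ _))))
    where lem : ∀ a b x → (a * b) * x ≡ b * (a * x)
          lem = solve-∀ ℚring
          lem₁ : ∀ x → x ≡ 1ℚ * x
          lem₁ = solve-∀ ℚring

  inv-* : ∀ m n → inv (m ℕ.* n) ≡ inv m * inv n
  inv-* zero    n       = sym (ℚ.*-zeroˡ (inv n))
  inv-* (suc m) zero    = trans (cong inv (ℕ.*-zeroʳ m)) (sym (ℚ.*-zeroʳ (inv (suc m))))
  inv-* (suc m) (suc n) = sym (inv-unique {suc m ℕ.* suc n} z<s
    (trans (cong (_* (inv (suc m) * inv (suc n))) (ι-* (suc m) (suc n)))
    (trans (lem (ι (suc m)) (ι (suc n)) (inv (suc m)) (inv (suc n))) (cong₂ _*_ (ι*inv {suc m} z<s) (ι*inv {suc n} z<s)))))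
    where lem : ∀ a b c d → (a * b) * (c * d) ≡ (a * c) * (b * d)
          lem = solve-∀ ℚring

  inv-anti : ∀ {m n} → 1 ℕ.≤ m → m ℕ.≤ n → inv n ≤ inv m
  inv-anti {m} {n} 1≤m m≤n = subst₂ _≤_ e₁ e₂ (*-monoˡ (0≤* (inv-≥0 m) (inv-≥0 n)) (ι-mono m≤n))
    where 1≤n = ℕ.≤-trans 1≤m m≤n
          lem : ∀ a b c → a * (b * c) ≡ (a * b) * c
          lem = solve-∀ ℚring
          lem₂ : ∀ a b c → a * (b * c) ≡ (a * c) * b
          lem₂ = solve-∀ ℚring
          e₁ : ι m * (inv m * inv n) ≡ inv n
          e₁ = trans (lem (ι m) (inv m) (inv n)) (trans (cong (_* inv n) (ι*inv 1≤m)) (ℚ.*-identityˡ _))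
          e₂ : ι n * (inv m * inv n) ≡ inv m
          e₂ = trans (lem₂ (ι n) (inv m) (inv n)) (trans (cong (_* inv m) (ι*inv 1≤n)) (ℚ.*-identityˡ _))

  inv≤1 : ∀ n → inv n ≤ 1ℚ
  inv≤1 zero    = 0≤1
  inv≤1 (suc n) = inv-anti {1} {suc n} z<s z<s

  Σ-const : ∀ n c → Σ n (λ _ → c) ≡ ι n * c
  Σ-const zero    c = sym (ℚ.*-zeroˡ c)
  Σ-const (suc n) c = trans (cong (_+ c) (Σ-const n c)) (lem (ι n) c)
    where lem : ∀ a c → a * c + c ≡ (a + 1ℚ) * c
          lem = solve-∀ ℚring

  -- Divisor sums

  -- Junk value: x // 0 = 0.
  _//_ : ℕ → ℕ → ℕ
  x // zero  = 0
  x // suc d = x ℕ./ suc d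

  //-split : ∀ x {d} → 1 ℕ.≤ d → ∃ λ t → t ℕ.< d × x ≡ (x // d) ℕ.* d ℕ.+ t
  //-split x {suc d} _ = x % suc d , DM.m%n<n x (suc d) , trans (DM.m≡m%n+[m/n]*n x (suc d)) (ℕ.+-comm (x % suc d) _)

  //-*≤ : ∀ x d → (x // d) ℕ.* d ℕ.≤ x
  //-*≤ x zero    = z≤n
  //-*≤ x (suc d) = DM.m/n*n≤m x (suc d)

  //-< : ∀ x {d} → 1 ℕ.≤ d → x ℕ.< suc (x // d) ℕ.* d
  //-< x {d} 1≤d with //-split x 1≤d
  ... | t , t<d , e = ℕ.≤-trans (s≤s (ℕ.≤-reflexive e)) (ℕ.≤-trans (ℕ.≤-reflexive (sym (ℕ.+-suc _ t)))
    (ℕ.≤-trans (ℕ.+-monoʳ-≤ ((x // d) ℕ.* d) t<d) (ℕ.≤-reflexive (ℕ.+-comm ((x // d) ℕ.* d) d))))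

  //-≤ : ∀ x d → x // d ℕ.≤ x
  //-≤ x zero    = z≤n
  //-≤ x (suc d) = DM.m/n≤m x (suc d)

  ∣-pos : ∀ {d n} → d ∣ n → 1 ℕ.≤ n → 1 ℕ.≤ d
  ∣-pos {zero}  d∣n 1≤n = contradiction (Div.0∣⇒≡0 d∣n) (ℕ.>⇒≢ 1≤n)
  ∣-pos {suc d} d∣n 1≤n = z<s

  ∣-le : ∀ {d n} → d ∣ n → 1 ℕ.≤ n → d ℕ.≤ n
  ∣-le {d} {suc n} d∣n _ = Div.∣⇒≤ d∣n

  between-multiples : ∀ q {d i} → q ℕ.* d ℕ.< i → i ℕ.< suc q ℕ.* d → ¬ d ∣ i
  between-multiples q {d} lo hi (divides k refl) = ℕ.<-irrefl refl
    (ℕ.≤-trans (ℕ.*-cancelʳ-< d k (suc q) hi) (ℕ.*-cancelʳ-< d q k lo))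

  𝟙*-no : {A : Set} (d : Dec A) → ¬ A → ∀ x → 𝟙 d * x ≡ 0ℚ
  𝟙*-no d ¬a x = trans (cong (_* x) (𝟙-no d ¬a)) (ℚ.*-zeroˡ x)

  𝟙*-yes : {A : Set} (d : Dec A) → A → ∀ x → 𝟙 d * x ≡ x
  𝟙*-yes d a x = trans (cong (_* x) (𝟙-yes d a)) (ℚ.*-identityˡ x)

  Σ-multiples₀ : ∀ q {d} → 1 ℕ.≤ d → (G : ℕ → ℚ) → Σ (q ℕ.* d) (λ n → 𝟙 (d ∣? n) * G n) ≡ Σ q (λ m → G (d ℕ.* m))
  Σ-multiples₀ zero    1≤d G = refl
  Σ-multiples₀ (suc q) {suc d} 1≤d G = cong₂ _+_
    (trans (Σ-extend (ℕ.m≤n+m _ d) λ i lo hi → 𝟙*-no (suc d ∣? i) (between-multiples q lo (s≤s hi)) (G i)) (Σ-multiples₀ q 1≤d G))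
    (trans (𝟙*-yes (suc d ∣? (suc q ℕ.* suc d)) (Div.n∣m*n (suc q)) _) (cong G (ℕ.*-comm (suc q) (suc d))))

  Σ-multiples : ∀ x {d} → 1 ℕ.≤ d → (G : ℕ → ℚ) → Σ x (λ n → 𝟙 (d ∣? n) * G n) ≡ Σ (x // d) (λ m → G (d ℕ.* m))
  Σ-multiples x {d} 1≤d G = trans
    (Σ-extend (//-*≤ x d) λ i lo hi → 𝟙*-no (d ∣? i) (between-multiples (x // d) lo (ℕ.≤-<-trans hi (//-< x 1≤d))) (G i))
    (Σ-multiples₀ (x // d) 1≤d G)

  D : ℕ → (ℕ → ℚ) → ℚ
  D n F = Σ n (λ d → 𝟙 (d ∣? n) * F d)

  D-cong : ∀ n {F G : ℕ → ℚ} → (∀ d → 1 ℕ.≤ d → d ∣ n → F d ≡ G d) → D n F ≡ D n G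
  D-cong n {F} {G} e = Σ-cong n λ d 1≤d _ → lem d 1≤d (d ∣? n)
    where lem : ∀ d → 1 ℕ.≤ d → (dn : Dec (d ∣ n)) → 𝟙 dn * F d ≡ 𝟙 dn * G d
          lem d 1≤d (yes d∣n) = cong (1ℚ *_) (e d 1≤d d∣n)
          lem d 1≤d (no ¬d∣n) = trans (ℚ.*-zeroˡ (F d)) (sym (ℚ.*-zeroˡ (G d)))

  D-+ : ∀ n (F G : ℕ → ℚ) → D n (λ d → F d + G d) ≡ D n F + D n G
  D-+ n F G = trans (Σ-ext n λ d → ℚ.*-distribˡ-+ (𝟙 (d ∣? n)) (F d) (G d)) (Σ-+ n (λ d → 𝟙 (d ∣? n) * F d) (λ d → 𝟙 (d ∣? n) * G d))

  D-*ˡ : ∀ n c (F : ℕ → ℚ) → D n (λ d → c * F d) ≡ c * D n F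
  D-*ˡ n c F = trans (Σ-ext n λ d → lem (𝟙 (d ∣? n)) c (F d)) (Σ-*ˡ n c (λ d → 𝟙 (d ∣? n) * F d))
    where lem : ∀ a b c → a * (b * c) ≡ b * (a * c)
          lem = solve-∀ ℚring

  D-zero : ∀ n {F : ℕ → ℚ} → (∀ d → 1 ℕ.≤ d → d ∣ n → F d ≡ 0ℚ) → D n F ≡ 0ℚ
  D-zero n e = trans (D-cong n {G = λ _ → 0ℚ} e) (Σ-zero n λ d _ _ → ℚ.*-zeroʳ (𝟙 (d ∣? n)))

  -- `F` takes both d and n, so that weights depending on the product survive the exchange of
  -- summations.
  hyperbola : ∀ x (F : ℕ → ℕ → ℚ) → Σ x (λ n → D n (λ d → F d n)) ≡ Σ x (λ d → Σ (x // d) (λ m → F d (d ℕ.* m)))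
  hyperbola x F = trans (Σ-cong x λ n 1≤n n≤x → sym (Σ-extend n≤x λ d n<d _ → 𝟙*-no (d ∣? n) (λ d∣n → ℕ.<⇒≱ n<d (∣-le d∣n 1≤n)) (F d n)))
    (trans (Σ-swap x x (λ n d → 𝟙 (d ∣? n) * F d n))
    (Σ-cong x λ d 1≤d _ → Σ-multiples x 1≤d (F d)))

  prime-coprime : ∀ {p d} → Prime p → ¬ p ∣ d → Coprime d p
  prime-coprime {p} {d} pp ¬p∣d {k} (k∣d , k∣p) with prime⇒irreducible pp k∣p
  ... | inj₁ k≡1 = k≡1
  ... | inj₂ k≡p = contradiction (subst (_∣ d) k≡p k∣d) ¬p∣d

  prime-≥2 : ∀ {p} → Prime p → 2 ℕ.≤ p
  prime-≥2 {p} pp = ℕ.nonTrivial⇒n>1 p {{prime⇒nonTrivial pp}}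

  prime-≥1 : ∀ {p} → Prime p → 1 ℕ.≤ p
  prime-≥1 pp = ℕ.<⇒≤ (prime-≥2 pp)

  p∣p*m : ∀ p m → p ∣ p ℕ.* m
  p∣p*m p m = Div.m∣m*n m

  *-≥1 : ∀ {m n} → 1 ℕ.≤ m → 1 ℕ.≤ n → 1 ℕ.≤ m ℕ.* n
  *-≥1 a b = ℕ.*-mono-≤ a b

  -- The divisors of p n prime to p are those of n, and the others are the p e with e a divisor of
  -- n. This holds whether or not p divides n, so identities for `μ`, `Λ` and `ψ` can be proved by
  -- splitting off one prime at a time.
  D-split : ∀ {p} → Prime p → ∀ n → 1 ℕ.≤ n → (F : ℕ → ℚ) →
    D (p ℕ.* n) F ≡ D n (λ d → 𝟙 (¬? (p ∣? d)) * F d) + D n (λ e → F (p ℕ.* e))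
  D-split {p} pp n 1≤n F = begin
    Σ (p ℕ.* n) (λ d → 𝟙 (d ∣? p ℕ.* n) * F d)
      ≡⟨ Σ-ext (p ℕ.* n) (λ d → lem (𝟙 (d ∣? p ℕ.* n)) (F d) (𝟙 (p ∣? d)) (𝟙 (¬? (p ∣? d))) (𝟙-¬ (p ∣? d))) ⟩
    Σ (p ℕ.* n) (λ d → A d + 𝟙 (p ∣? d) * B d) ≡⟨ Σ-+ (p ℕ.* n) A (λ d → 𝟙 (p ∣? d) * B d) ⟩
    Σ (p ℕ.* n) A + Σ (p ℕ.* n) (λ d → 𝟙 (p ∣? d) * B d) ≡⟨ cong₂ _+_ first second ⟩
    D n (λ d → 𝟙 (¬? (p ∣? d)) * F d) + D n (λ e → F (p ℕ.* e)) ∎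
    where
    open ≡-Reasoning
    1≤p = prime-≥1 pp
    A B : ℕ → ℚ
    A d = 𝟙 (d ∣? p ℕ.* n) * (𝟙 (¬? (p ∣? d)) * F d)
    B d = 𝟙 (d ∣? p ℕ.* n) * F d
    lem : ∀ a f x y → x + y ≡ 1ℚ → a * f ≡ a * (y * f) + x * (a * f)
    lem a f x y e = trans (l₁ a f) (trans (cong (_* (a * f)) (sym e)) (l₂ a f x y))
      where l₁ : ∀ a f → a * f ≡ 1ℚ * (a * f)
            l₁ = solve-∀ ℚring
            l₂ : ∀ a f x y → (x + y) * (a * f) ≡ a * (y * f) + x * (a * f)
            l₂ = solve-∀ ℚring
    cancel : ∀ d → ¬ p ∣ d → d ∣ p ℕ.* n → d ∣ n
    cancel d ¬p∣d = Coprimality.coprime-divisor (prime-coprime pp ¬p∣d)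
    first : Σ (p ℕ.* n) A ≡ D n (λ d → 𝟙 (¬? (p ∣? d)) * F d)
    first = trans (Σ-extend {n} {p ℕ.* n} (ℕ.m≤n*m n p {{prime⇒nonZero pp}}) (λ d n<d _ → out d n<d (p ∣? d)))
      (Σ-ext n λ d → inn d (p ∣? d))
      where
      out : ∀ d → n ℕ.< d → (pd : Dec (p ∣ d)) → 𝟙 (d ∣? p ℕ.* n) * (𝟙 (¬? pd) * F d) ≡ 0ℚ
      out d n<d (yes _)   = trans (cong (𝟙 (d ∣? p ℕ.* n) *_) (ℚ.*-zeroˡ (F d))) (ℚ.*-zeroʳ (𝟙 (d ∣? p ℕ.* n)))
      out d n<d (no ¬p∣d) = 𝟙*-no (d ∣? p ℕ.* n) (λ d∣ → ℕ.<⇒≱ n<d (∣-le (cancel d ¬p∣d d∣) 1≤n)) (1ℚ * F d)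
      inn : ∀ d → (pd : Dec (p ∣ d)) → 𝟙 (d ∣? p ℕ.* n) * (𝟙 (¬? pd) * F d) ≡ 𝟙 (d ∣? n) * (𝟙 (¬? pd) * F d)
      inn d (yes _)   = trans (cong (𝟙 (d ∣? p ℕ.* n) *_) (ℚ.*-zeroˡ (F d))) (trans (ℚ.*-zeroʳ (𝟙 (d ∣? p ℕ.* n)))
        (sym (trans (cong (𝟙 (d ∣? n) *_) (ℚ.*-zeroˡ (F d))) (ℚ.*-zeroʳ (𝟙 (d ∣? n))))))
      inn d (no ¬p∣d) = cong (_* (1ℚ * F d)) (𝟙-cong (d ∣? p ℕ.* n) (d ∣? n) (cancel d ¬p∣d) (Div.∣n⇒∣m*n p))
    second : Σ (p ℕ.* n) (λ d → 𝟙 (p ∣? d) * B d) ≡ D n (λ e → F (p ℕ.* e))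
    second = trans (cong (λ k → Σ k (λ d → 𝟙 (p ∣? d) * B d)) (ℕ.*-comm p n))
      (trans (Σ-multiples₀ n 1≤p B)
      (Σ-ext n λ e → cong (_* F (p ℕ.* e)) (𝟙-cong (p ℕ.* e ∣? p ℕ.* n) (e ∣? n)
         (Div.*-cancelˡ-∣ p {{prime⇒nonZero pp}}) (Div.*-monoʳ-∣ p))))

  prime-induction : (P : ℕ → Set) → P 1 → (∀ p m → Prime p → 1 ℕ.≤ m → P m → P (p ℕ.* m)) → ∀ n → 1 ℕ.≤ n → P n
  prime-induction P P1 Ps (suc n) _ = go _ _ (PrimeFactorisation.isFactorisation f) (PrimeFactorisation.factorsPrime f) .proj₂
    where
    f = factorise (suc n)
    go : ∀ k ps → k ≡ product ps → All Prime ps → (1 ℕ.≤ k) × P k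
    go k []       refl All.[]         = z<s , P1
    go k (p ∷ ps) refl (pp All.∷ pps) with go (product ps) ps refl pps
    ... | 1≤m , Pm = *-≥1 (prime-≥1 pp) 1≤m , Ps p (product ps) pp 1≤m Pm

  split-by : ∀ {p} → Prime p → (P : ℕ → Set) → (∀ m → 1 ℕ.≤ m → ¬ p ∣ m → P m) →
    (∀ m → 1 ℕ.≤ m → P m → P (p ℕ.* m)) → ∀ n → 1 ℕ.≤ n → P n
  split-by {p} pp P base step = ℕInd.<-rec _ go
    where
    go : ∀ n → (∀ {m} → m ℕ.< n → 1 ℕ.≤ m → P m) → 1 ℕ.≤ n → P n
    go n rec 1≤n with p ∣? n
    ... | no ¬p∣n = base n 1≤n ¬p∣n
    ... | yes (divides m refl) = subst P (ℕ.*-comm p m) (step m 1≤m (rec m<n 1≤m))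
      where 1≤m = ∣-pos (Div.m∣m*n p) 1≤n
            m<n = ℕ.m<m*n m p {{ℕ.>-nonZero 1≤m}} (prime-≥2 pp)

  -- The harmonic logarithm

  Hs : ℕ → ℚ
  Hs k = Σ k inv

  inv-suc : ∀ {n} → 1 ℕ.≤ n → inv n - inv (suc n) ≡ inv n * inv (suc n)
  inv-suc {n} 1≤n = begin
    inv n - inv (suc n) ≡⟨ cong₂ _-_ (e₁ (inv n)) (e₁ (inv (suc n))) ⟩
    inv n * 1ℚ - inv (suc n) * 1ℚ ≡⟨ cong₂ (λ a b → inv n * a - inv (suc n) * b) (sym (ι*inv {suc n} z<s)) (sym (ι*inv 1≤n)) ⟩
    inv n * (ι (suc n) * inv (suc n)) - inv (suc n) * (ι n * inv n) ≡⟨ lem (inv n) (inv (suc n)) (ι n) ⟩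
    inv n * inv (suc n) ∎
    where open ≡-Reasoning
          e₁ : ∀ a → a ≡ a * 1ℚ
          e₁ = solve-∀ ℚring
          lem : ∀ a b i → a * ((i + 1ℚ) * b) - b * (i * a) ≡ a * b
          lem = solve-∀ ℚring

  ι*inv* : ∀ m {n} → 1 ℕ.≤ m → ι m * inv (n ℕ.* m) ≡ inv n
  ι*inv* m {n} 1≤m = trans (cong (ι m *_) (inv-* n m)) (trans (lem (ι m) (inv n) (inv m))
    (trans (cong (_* inv n) (ι*inv 1≤m)) (ℚ.*-identityˡ (inv n))))
    where lem : ∀ a b c → a * (b * c) ≡ (a * c) * b
          lem = solve-∀ ℚring

  Hs-block-≤ : ∀ {a} b → 1 ℕ.≤ a → Hs (a ℕ.+ b) - Hs a ≤ ι b * inv a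
  Hs-block-≤ {a} b 1≤a = subst₂ _≤_ (trans (lem (Hs a) _) (cong (_- Hs a) (sym (Σ-append a b inv)))) (Σ-const b (inv a))
    (Σ-mono b λ i _ _ → inv-anti 1≤a (ℕ.m≤m+n a i))
    where lem : ∀ a b → b ≡ (a + b) - a
          lem = solve-∀ ℚring

  Hs-block-≥ : ∀ {a} b → 1 ℕ.≤ a → ι b * inv (a ℕ.+ b) ≤ Hs (a ℕ.+ b) - Hs a
  Hs-block-≥ {a} b 1≤a = subst₂ _≤_ (Σ-const b (inv (a ℕ.+ b))) (trans (lem (Hs a) _) (cong (_- Hs a) (sym (Σ-append a b inv))))
    (Σ-mono b λ i _ i≤b → inv-anti (ℕ.≤-trans 1≤a (ℕ.m≤m+n a i)) (ℕ.+-monoʳ-≤ a i≤b))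
    where lem : ∀ a b → b ≡ (a + b) - a
          lem = solve-∀ ℚring

  -- The m terms after k m, up to (k + 1) m, sum to a value between 1/(k + 1) and 1/k; the
  -- differences of these bounds telescope from T on.
  Hs-dilate : ∀ {m T} → 1 ℕ.≤ m → 1 ℕ.≤ T → ∀ j →
    (Hs (T ℕ.+ j) - Hs T ≤ Hs ((T ℕ.+ j) ℕ.* m) - Hs (T ℕ.* m)) ×
    (Hs ((T ℕ.+ j) ℕ.* m) - Hs (T ℕ.* m) ≤ (Hs (T ℕ.+ j) - Hs T) + (inv T - inv (T ℕ.+ j)))
  Hs-dilate {m} {T} 1≤m 1≤T zero rewrite ℕ.+-identityʳ T =
    ≤-reflexive (lem (Hs T) (Hs (T ℕ.* m))) , ≤-reflexive (lem₂ (Hs T) (Hs (T ℕ.* m)) (inv T))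
    where lem : ∀ a b → a - a ≡ b - b
          lem = solve-∀ ℚring
          lem₂ : ∀ a b c → b - b ≡ (a - a) + (c - c)
          lem₂ = solve-∀ ℚring
  Hs-dilate {m} {T} 1≤m 1≤T (suc j) rewrite ℕ.+-suc T j with Hs-dilate {m} {T} 1≤m 1≤T j
  ... | lo , up = subst₂ _≤_ (l₁ (Hs k) (Hs T) (inv (suc k))) (l₂ (Hs (k ℕ.* m)) (Hs (T ℕ.* m)) (Hs (suc k ℕ.* m))) (+-mono-≤ lo slo)
    , subst₂ _≤_ (l₂ (Hs (k ℕ.* m)) (Hs (T ℕ.* m)) (Hs (suc k ℕ.* m))) (l₃ (Hs k) (Hs T) (inv T) (inv k) (inv (suc k))) (+-mono-≤ up sup)
    where
    k = T ℕ.+ j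
    1≤k : 1 ℕ.≤ k
    1≤k = ℕ.≤-trans 1≤T (ℕ.m≤m+n T j)
    eq : k ℕ.* m ℕ.+ m ≡ suc k ℕ.* m
    eq = ℕ.+-comm (k ℕ.* m) m
    slo : inv (suc k) ≤ Hs (suc k ℕ.* m) - Hs (k ℕ.* m)
    slo = subst₂ _≤_ (trans (cong (λ z → ι m * inv z) eq) (ι*inv* m {suc k} 1≤m)) (cong (λ z → Hs z - Hs (k ℕ.* m)) eq)
      (Hs-block-≥ m (*-≥1 1≤k 1≤m))
    sup : Hs (suc k ℕ.* m) - Hs (k ℕ.* m) ≤ inv k
    sup = subst₂ _≤_ (cong (λ z → Hs z - Hs (k ℕ.* m)) eq) (ι*inv* m {k} 1≤m) (Hs-block-≤ m (*-≥1 1≤k 1≤m))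
    l₁ : ∀ a t c → (a - t) + c ≡ (a + c) - t
    l₁ = solve-∀ ℚring
    l₂ : ∀ a b c → (a - b) + (c - a) ≡ c - b
    l₂ = solve-∀ ℚring
    l₃ : ∀ a t it ik ik' → ((a - t) + (it - ik)) + ik ≡ ((a + ik') - t) + (it - ik')
    l₃ = solve-∀ ℚring

  -- A rational stand-in for log n, additive up to an error 1/T.
  h : ℕ → ℕ → ℚ
  h T n = Hs (n ℕ.* T) - Hs T

  module _ (T : ℕ) (1≤T : 1 ℕ.≤ T) where

    h-one : h T 1 ≡ 0ℚ
    h-one = trans (cong (λ z → Hs z - Hs T) (ℕ.*-identityˡ T)) (ℚ.+-inverseʳ (Hs T))

    h-step-≤ : ∀ {n} → 1 ℕ.≤ n → h T (suc n) - h T n ≤ inv n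
    h-step-≤ {n} 1≤n = subst₂ _≤_
      (trans (cong (λ z → Hs z - Hs (n ℕ.* T)) (ℕ.+-comm (n ℕ.* T) T)) (lem (Hs (suc n ℕ.* T)) (Hs (n ℕ.* T)) (Hs T)))
      (ι*inv* T {n} 1≤T) (Hs-block-≤ T (*-≥1 1≤n 1≤T))
      where lem : ∀ a b t → a - b ≡ (a - t) - (b - t)
            lem = solve-∀ ℚring

    h-step-≥ : ∀ {n} → 1 ℕ.≤ n → inv (suc n) ≤ h T (suc n) - h T n
    h-step-≥ {n} 1≤n = subst₂ _≤_
      (trans (cong (λ z → ι T * inv z) (ℕ.+-comm (n ℕ.* T) T)) (ι*inv* T {suc n} 1≤T))
      (trans (cong (λ z → Hs z - Hs (n ℕ.* T)) (ℕ.+-comm (n ℕ.* T) T)) (lem (Hs (suc n ℕ.* T)) (Hs (n ℕ.* T)) (Hs T)))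
      (Hs-block-≥ T (*-≥1 1≤n 1≤T))
      where lem : ∀ a b t → a - b ≡ (a - t) - (b - t)
            lem = solve-∀ ℚring

    h-grow : ∀ {a} b → 1 ℕ.≤ a → 0ℚ ≤ h T (a ℕ.+ b) - h T a × h T (a ℕ.+ b) - h T a ≤ ι b * inv a
    h-grow {a} zero 1≤a rewrite ℕ.+-identityʳ a =
      ≤-reflexive (sym (ℚ.+-inverseʳ (h T a))) , ≤-reflexive (trans (ℚ.+-inverseʳ (h T a)) (sym (ℚ.*-zeroˡ (inv a))))
    h-grow {a} (suc b) 1≤a rewrite ℕ.+-suc a b with h-grow {a} b 1≤a
    ... | lo , up = subst (0ℚ ≤_) (l₂ (h T (a ℕ.+ b)) (h T a) (h T (suc (a ℕ.+ b)))) (0≤+ lo (≤-trans (inv-≥0 (suc (a ℕ.+ b)))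
        (h-step-≥ 1≤ab)))
      , subst₂ _≤_ (l₂ (h T (a ℕ.+ b)) (h T a) (h T (suc (a ℕ.+ b)))) (l₃ (ι b) (inv a))
          (+-mono-≤ up (≤-trans (h-step-≤ 1≤ab) (inv-anti 1≤a (ℕ.m≤m+n a b))))
      where
      1≤ab : 1 ℕ.≤ a ℕ.+ b
      1≤ab = ℕ.≤-trans 1≤a (ℕ.m≤m+n a b)
      l₂ : ∀ a b c → (a - b) + (c - a) ≡ c - b
      l₂ = solve-∀ ℚring
      l₃ : ∀ b i → b * i + i ≡ (b + 1ℚ) * i
      l₃ = solve-∀ ℚring

    h-mono : ∀ {m n} → 1 ℕ.≤ m → m ℕ.≤ n → h T m ≤ h T n
    h-mono {m} {n} 1≤m m≤n = ≤-by _ (h-grow (n ℕ.∸ m) 1≤m .proj₁)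
      (trans (cong (h T) (sym (ℕ.m+[n∸m]≡n m≤n))) (lem (h T m) (h T (m ℕ.+ (n ℕ.∸ m)))))
      where lem : ∀ a b → b ≡ a + (b - a)
            lem = solve-∀ ℚring

    h-≥0 : ∀ {n} → 1 ℕ.≤ n → 0ℚ ≤ h T n
    h-≥0 {n} 1≤n = subst (_≤ h T n) h-one (h-mono {1} {n} ℕ.≤-refl 1≤n)

    h-double : ∀ {y} → 1 ℕ.≤ y → h T (2 ℕ.* y) - h T y ≤ 1ℚ
    h-double {y} 1≤y = subst₂ _≤_ (cong (λ z → h T z - h T y) (cong (y ℕ.+_) (sym (ℕ.+-identityʳ y)))) (ι*inv 1≤y) (h-grow y 1≤y .proj₂)

    -- Subtracting h(m) from h(m n) leaves the harmonic block from T to n T dilated by m, which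
    -- `Hs-dilate` compares with h(n).
    h-mult : ∀ {m n} → 1 ℕ.≤ m → 1 ℕ.≤ n → (h T m + h T n ≤ h T (m ℕ.* n)) × (h T (m ℕ.* n) ≤ h T m + h T n + inv T)
    h-mult {m} {suc n} 1≤m 1≤n with Hs-dilate {m} {T} 1≤m 1≤T (n ℕ.* T)
    ... | lo , up = subst (h T m + h T (suc n) ≤_) e₂ (ℚ.+-monoʳ-≤ (h T m) lo)
      , ≤-trans (subst (_≤ h T m + ((Hs (suc n ℕ.* T) - Hs T) + (inv T - inv (suc n ℕ.* T)))) e₂ (ℚ.+-monoʳ-≤ (h T m) up))
          (≤-by (inv (suc n ℕ.* T)) (inv-≥0 (suc n ℕ.* T)) (l₄ (h T m) (h T (suc n)) (inv T) (inv (suc n ℕ.* T))))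
      where
      l₃ : ∀ a b c → (b - c) + (a - b) ≡ a - c
      l₃ = solve-∀ ℚring
      l₄ : ∀ a b i j → (a + b) + i ≡ (a + (b + (i - j))) + j
      l₄ = solve-∀ ℚring
      e₁ : suc n ℕ.* T ℕ.* m ≡ m ℕ.* suc n ℕ.* T
      e₁ = trans (ℕ.*-comm (suc n ℕ.* T) m) (sym (ℕ.*-assoc m (suc n) T))
      e₂ : h T m + (Hs (suc n ℕ.* T ℕ.* m) - Hs (T ℕ.* m)) ≡ h T (m ℕ.* suc n)
      e₂ = trans (cong₂ (λ a b → h T m + (Hs a - Hs b)) e₁ (ℕ.*-comm T m)) (l₃ (Hs (m ℕ.* suc n ℕ.* T)) (Hs (m ℕ.* T)) (Hs T))

    -- Uniform in T, so scales at which `h` is large can be chosen before T.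
    Hs-≤-h : ∀ n → Hs (suc n) ≤ h T (suc n) + 1ℚ
    Hs-≤-h zero = ≤-reflexive (cong (_+ 1ℚ) (sym h-one))
    Hs-≤-h (suc n) = ≤-trans (+-mono-≤ (Hs-≤-h n) (h-step-≥ {suc n} z<s)) (≤-reflexive (l₁ (h T (suc n)) (h T (suc (suc n)))))
      where
      l₁ : ∀ a b → (a + 1ℚ) + (b - a) ≡ b + 1ℚ
      l₁ = solve-∀ ℚring

    h-≤-Hs : ∀ n → h T (suc n) ≤ Hs n
    h-≤-Hs zero = ≤-reflexive h-one
    h-≤-Hs (suc n) = ≤-trans (≤-reflexive (l₂ (h T (suc n)) (h T (suc (suc n))))) (+-mono-≤ (h-≤-Hs n) (h-step-≤ {suc n} z<s))
      where
      l₂ : ∀ a b → b ≡ a + (b - a)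
      l₂ = solve-∀ ℚring

    -- The counterpart of n! ≥ (n/e)^n: passing from x to x + 1 raises each of x terms by at most
    -- 1/x.
    Σ-h-gap : ∀ x → Σ x (λ n → h T x - h T n) ≤ ι x
    Σ-h-gap zero = ≤-refl
    Σ-h-gap (suc zero) = ≤-trans (≤-reflexive (lem (h T 1))) 0≤1
      where lem : ∀ a → 0ℚ + (a - a) ≡ 0ℚ
            lem = solve-∀ ℚring
    Σ-h-gap (suc (suc x)) = subst (_≤ ι (suc (suc x))) (sym eq)
      (+-mono-≤ (Σ-h-gap (suc x)) (subst (ι (suc x) * (h T (suc (suc x)) - h T (suc x)) ≤_) (ι*inv {suc x} z<s)
        (*-monoʳ (ι-≥0 (suc x)) (h-step-≤ {suc x} z<s))))
      where
      y = suc x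
      l₁ : ∀ a b c → a - c ≡ (b - c) + (a - b)
      l₁ = solve-∀ ℚring
      l₂ : ∀ s i a → (s + i) + (a - a) ≡ s + i
      l₂ = solve-∀ ℚring
      eq : Σ (suc y) (λ n → h T (suc y) - h T n) ≡ Σ y (λ n → h T y - h T n) + ι y * (h T (suc y) - h T y)
      eq = trans (cong (_+ (h T (suc y) - h T (suc y))) (trans (Σ-ext y λ n → l₁ (h T (suc y)) (h T y) (h T n))
        (trans (Σ-+ y (λ n → h T y - h T n) (λ _ → h T (suc y) - h T y))
          (cong (Σ y (λ n → h T y - h T n) +_) (Σ-const y (h T (suc y) - h T y))))))
        (l₂ (Σ y (λ n → h T y - h T n)) (ι y * (h T (suc y) - h T y)) (h T (suc y)))

    Σ-h-inv² : ∀ x → Σ x (λ n → h T n * (inv n * inv (suc n))) ≤ 1ℚ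
    Σ-h-inv² zero = 0≤1
    Σ-h-inv² (suc x) = ≤-trans (go x) (≤-by (inv (suc x) + h T (suc x) * inv (suc (suc x)))
       (0≤+ (inv-≥0 (suc x)) (0≤* (h-≥0 {suc x} z<s) (inv-≥0 (suc (suc x))))) (lem (inv (suc x)) (h T (suc x) * inv (suc (suc x)))))
      where
      lem : ∀ a b → 1ℚ ≡ (1ℚ - a - b) + (a + b)
      lem = solve-∀ ℚring
      -- Summation by parts with N = `suc x`: the boundary term is -h(N)/(N + 1), and the increments
      -- (h(n) - h(n - 1))/n ≤ 1/((n - 1)n) telescope to 1 - 1/N.
      go : ∀ x → Σ (suc x) (λ n → h T n * (inv n * inv (suc n))) ≤ 1ℚ - inv (suc x) - h T (suc x) * inv (suc (suc x))
      go zero rewrite h-one = ≤-reflexive (l₁ (inv 1 * inv 2) (inv 2))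
        where l₁ : ∀ a b → 0ℚ + 0ℚ * a ≡ 1ℚ - 1ℚ - 0ℚ * b
              l₁ = solve-∀ ℚring
      go (suc x) = ≤-trans (ℚ.+-monoˡ-≤ (h T b * (inv b * inv c)) (go x))
        (≤-by (inv a * inv b - (h T b - h T a) * inv b)
          (0≤-diff (*-monoˡ (inv-≥0 b) (h-step-≤ {a} z<s)))
          (trans (l₁ (inv b) (h T b) (inv c) (h T a) (inv a)) (cong₂ (λ u v → (1ℚ - inv a - h T a * inv b + h T b * v) + (u -
              (h T b - h T a) * inv b))
            (inv-suc {a} z<s) (inv-suc {b} z<s))))
        where
        a = suc x
        b = suc a
        c = suc b
        l₁ : ∀ ib hb ic ha ia → 1ℚ - ib - hb * ic ≡ (1ℚ - ia - ha * ib + hb * (ib - ic)) + ((ia - ib) - (hb - ha) * ib)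
        l₁ = solve-∀ ℚring

    Σ-inv-inv : ∀ x → Σ x (λ n → inv n * inv (suc n)) ≤ 1ℚ
    Σ-inv-inv x = ≤-trans (≤-reflexive (go x)) (≤-by (inv (suc x)) (inv-≥0 (suc x)) (lem (inv (suc x))))
      where
      lem : ∀ a → 1ℚ ≡ (1ℚ - a) + a
      lem = solve-∀ ℚring
      go : ∀ x → Σ x (λ n → inv n * inv (suc n)) ≡ 1ℚ - inv (suc x)
      go zero    = refl
      go (suc x) = trans (cong₂ _+_ (go x) (sym (inv-suc {suc x} z<s))) (l (inv (suc x)) (inv (suc (suc x))))
        where l : ∀ a b → (1ℚ - a) + (a - b) ≡ 1ℚ - b
              l = solve-∀ ℚring

    -- h(n)/n is not monotone, so partial summation against it in `Lser-Λ` uses its total variation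
    -- instead.
    h-inv-variation : ∀ x → Σ x (λ n → ∣ h T n * inv n - h T (suc n) * inv (suc n) ∣) ≤ 1ℚ + 1ℚ
    h-inv-variation x = ≤-trans (Σ-mono x λ n 1≤n _ → step n 1≤n)
      (≤-trans (≤-reflexive (Σ-+ x (λ n → h T n * (inv n * inv (suc n))) (λ n → inv n * inv (suc n)))) (+-mono-≤ (Σ-h-inv² x)
          (Σ-inv-inv x)))
      where
      step : ∀ n → 1 ℕ.≤ n → ∣ h T n * inv n - h T (suc n) * inv (suc n) ∣ ≤ h T n * (inv n * inv (suc n)) + inv n * inv (suc n)
      step n 1≤n = subst (λ z → ∣ z ∣ ≤ h T n * (inv n * inv (suc n)) + inv n * inv (suc n))
        (trans (cong (λ z → h T n * z - (h T (suc n) - h T n) * inv (suc n)) (sym (inv-suc 1≤n))) (l (h T n) (inv n) (inv (suc n)) (h T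
            (suc n))))
        (∣∣-tri- {h T n * (inv n * inv (suc n))} {(h T (suc n) - h T n) * inv (suc n)}
          (∣∣-nonneg (0≤* (h-≥0 1≤n) (0≤* (inv-≥0 n) (inv-≥0 (suc n)))))
          (≤-trans (∣∣-nonneg (0≤* (≤-trans (inv-≥0 (suc n)) (h-step-≥ 1≤n)) (inv-≥0 (suc n)))) (*-monoˡ (inv-≥0 (suc n)) (h-step-≤ 1≤n))))
        where l : ∀ a i j b → a * (i - j) - (b - a) * j ≡ a * i - b * j
              l = solve-∀ ℚring

  Hs-unbounded : ∀ K → ∃ λ x → 1 ℕ.≤ x × ι K ≤ Hs x
  Hs-unbounded zero = 1 , z<s , 0≤1
  Hs-unbounded (suc K) with Hs-unbounded K
  ... | x , 1≤x , K≤ = 2 ℕ.* (2 ℕ.* x) , *-≥1 {2} z<s (*-≥1 {2} z<s 1≤x) ,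
    ≤-trans (ℚ.+-monoˡ-≤ 1ℚ K≤) (≤-by _ (0≤+ (0≤-diff (half x 1≤x)) (0≤-diff (half (2 ℕ.* x) (*-≥1 {2} z<s 1≤x))))
      (lem (Hs x) (Hs (2 ℕ.* x)) (Hs (2 ℕ.* (2 ℕ.* x)))))
    where
    half : ∀ y → 1 ℕ.≤ y → ½ ≤ Hs (2 ℕ.* y) - Hs y
    half y 1≤y = subst₂ _≤_ (trans (cong (ι y *_) (trans (cong (λ z → inv (y ℕ.+ z)) (sym (ℕ.+-identityʳ y))) (inv-* 2 y)))
      (trans (l (ι y) (inv 2) (inv y)) (trans (cong (_* inv 2) (ι*inv 1≤y)) refl)))
      (cong (λ z → Hs (y ℕ.+ z) - Hs y) (sym (ℕ.+-identityʳ y))) (Hs-block-≥ y 1≤y)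
      where l : ∀ a b c → a * (b * c) ≡ (a * c) * b
            l = solve-∀ ℚring
    lem : ∀ a b c → c ≡ (a + 1ℚ) + (((b - a) - ½) + ((c - b) - ½))
    lem = solve-∀ ℚring

  -- The functions μ and Λ

  fac : ℕ → List ℕ
  fac zero    = []
  fac (suc n) = PrimeFactorisation.factors (factorise (suc n))

  fac-unique : ∀ {n} → 1 ℕ.≤ n → (f : PrimeFactorisation n) → fac n ↭ PrimeFactorisation.factors f
  fac-unique {suc n} _ f = factorisationUnique (factorise (suc n)) f

  fac-product : ∀ {n} → 1 ℕ.≤ n → n ≡ product (fac n)
  fac-product {suc n} _ = PrimeFactorisation.isFactorisation (factorise (suc n))

  fac-primes : ∀ n → All Prime (fac n)
  fac-primes zero    = All.[]
  fac-primes (suc n) = PrimeFactorisation.factorsPrime (factorise (suc n))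

  fac-* : ∀ {p m} → Prime p → 1 ℕ.≤ m → fac (p ℕ.* m) ↭ p ∷ fac m
  fac-* {p} {m} pp 1≤m = fac-unique (*-≥1 (prime-≥1 pp) 1≤m) record
    { factors = p ∷ fac m ; isFactorisation = cong (p ℕ.*_) (fac-product 1≤m) ; factorsPrime = pp All.∷ fac-primes m }

  ∈fac⇒∣ : ∀ {p m} → 1 ℕ.≤ m → p ∈ fac m → p ∣ m
  ∈fac⇒∣ {p} 1≤m p∈ = subst (p ∣_) (sym (fac-product 1≤m)) (∈⇒∣product p∈)

  ∣⇒∈fac : ∀ {p m} → Prime p → 1 ℕ.≤ m → p ∣ m → p ∈ fac m
  ∣⇒∈fac {p} {m} pp 1≤m p∣m = factorisationHasAllPrimeFactors pp (subst (p ∣_) (fac-product 1≤m) p∣m) (fac-primes m)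

  module _ (g : ℕ → ℚ) where

    sumL : List ℕ → ℚ
    sumL []       = 0ℚ
    sumL (p ∷ ps) = g p + sumL ps

    sumL-↭ : ∀ {xs ys} → xs ↭ ys → sumL xs ≡ sumL ys
    sumL-↭ Perm.refl = refl
    sumL-↭ (Perm.prep x r) = cong (g x +_) (sumL-↭ r)
    sumL-↭ (Perm.swap {xs} {ys} x y r) = trans (lem (g x) (g y) (sumL xs)) (cong (λ z → g y + (g x + z)) (sumL-↭ r))
      where lem : ∀ a b c → a + (b + c) ≡ b + (a + c)
            lem = solve-∀ ℚring
    sumL-↭ (Perm.trans r s) = trans (sumL-↭ r) (sumL-↭ s)

  -- The Möbius function on a list of prime factors: a prime that recurs makes an indicator vanish.
  -- Invariance under permutation is needed because the chosen factorisation of p m need not start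
  -- with p.
  μL : List ℕ → ℚ
  μL []       = 1ℚ
  μL (p ∷ ps) = - (𝟙 (¬? (p ∈? ps)) * μL ps)

  μL-↭ : ∀ {xs ys} → xs ↭ ys → μL xs ≡ μL ys
  μL-↭ Perm.refl = refl
  μL-↭ (Perm.prep {xs} {ys} x r) = cong₂ (λ a b → - (a * b))
    (𝟙-cong (¬? (x ∈? xs)) (¬? (x ∈? ys)) (λ n i → n (∈-resp-↭ (Perm.↭-sym r) i)) (λ n i → n (∈-resp-↭ r i))) (μL-↭ r)
  μL-↭ (Perm.swap {xs} {ys} x y r) = go (x ℕ.≟ y)
    where
    lem : ∀ a b m → - (a * - (b * m)) ≡ - (b * - (a * m))
    lem = solve-∀ ℚring
    move : ∀ z → 𝟙 (¬? (z ∈? xs)) ≡ 𝟙 (¬? (z ∈? ys))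
    move z = 𝟙-cong (¬? (z ∈? xs)) (¬? (z ∈? ys)) (λ n i → n (∈-resp-↭ (Perm.↭-sym r) i)) (λ n i → n (∈-resp-↭ r i))
    drop : ∀ {z w} zs → z ≢ w → 𝟙 (¬? (z ∈? (w ∷ zs))) ≡ 𝟙 (¬? (z ∈? zs))
    drop {z} {w} zs z≢w = 𝟙-cong (¬? (z ∈? (w ∷ zs))) (¬? (z ∈? zs)) (λ n i → n (there i))
      (λ { n (here e) → z≢w e ; n (there i) → n i })
    go : Dec (x ≡ y) → μL (x ∷ y ∷ xs) ≡ μL (y ∷ x ∷ ys)
    go (yes refl) = cong₂ (λ a b → - (a * - b)) (𝟙-cong (¬? (x ∈? (x ∷ xs))) (¬? (x ∈? (x ∷ ys)))
      (λ n → contradiction (here refl) n) (λ n → contradiction (here refl) n)) (cong₂ _*_ (move x) (μL-↭ r))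
    go (no x≢y) = trans (cong₂ (λ a b → - (a * - (b * μL xs))) (trans (drop xs x≢y) (move x))
        (trans (move y) (sym (drop ys (λ e → x≢y (sym e))))))
      (trans (lem (𝟙 (¬? (x ∈? ys))) (𝟙 (¬? (y ∈? (x ∷ ys)))) (μL xs))
        (cong (λ z → - (𝟙 (¬? (y ∈? (x ∷ ys))) * - (𝟙 (¬? (x ∈? ys)) * z))) (μL-↭ r)))
  μL-↭ (Perm.trans r s) = trans (μL-↭ r) (μL-↭ s)

  μL-abs : ∀ xs → ∣ μL xs ∣ ≤ 1ℚ
  μL-abs []       = ≤-refl
  μL-abs (p ∷ ps) = ∣∣-neg (∣∣-* {𝟙 (¬? (p ∈? ps))} {μL ps} {1ℚ} {1ℚ} (≤-trans (∣∣-nonneg (𝟙-≥0 (¬? (p ∈? ps)))) (𝟙-≤1 (¬? (p ∈? ps))))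
      (μL-abs ps))

  μ : ℕ → ℚ
  μ n = μL (fac n)

  μ-abs : ∀ n → ∣ μ n ∣ ≤ 1ℚ
  μ-abs n = μL-abs (fac n)

  μ-* : ∀ {p m} → Prime p → 1 ℕ.≤ m → μ (p ℕ.* m) ≡ - (𝟙 (¬? (p ∣? m)) * μ m)
  μ-* {p} {m} pp 1≤m = trans (μL-↭ (fac-* pp 1≤m))
    (cong (λ a → - (a * μ m)) (𝟙-cong (¬? (p ∈? fac m)) (¬? (p ∣? m)) (λ n d → n (∣⇒∈fac pp 1≤m d)) (λ n i → n (∈fac⇒∣ 1≤m i))))

  p*m≢1 : ∀ {p m} → Prime p → p ℕ.* m ≢ 1
  p*m≢1 {p} {m} pp e = ℕ.>⇒≢ (prime-≥2 pp) (ℕ.m*n≡1⇒m≡1 p m e)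

  D-one : ∀ F → D 1 F ≡ F 1
  D-one F = trans (ℚ.+-identityˡ (1ℚ * F 1)) (ℚ.*-identityˡ (F 1))

  -- After splitting off a prime factor p, the term of each d prime to p cancels against that of p
  -- d, and μ(p d) = 0 for the other d.
  D-μ : ∀ {n} → 1 ℕ.≤ n → D n μ ≡ 𝟙 (n ℕ.≟ 1)
  D-μ {n} = prime-induction (λ n → D n μ ≡ 𝟙 (n ℕ.≟ 1)) refl step n
    where
    step : ∀ p m → Prime p → 1 ℕ.≤ m → D m μ ≡ 𝟙 (m ℕ.≟ 1) → D (p ℕ.* m) μ ≡ 𝟙 (p ℕ.* m ℕ.≟ 1)
    step p m pp 1≤m _ = begin
      D (p ℕ.* m) μ ≡⟨ D-split pp m 1≤m μ ⟩
      D m A + D m (λ e → μ (p ℕ.* e)) ≡⟨ sym (D-+ m A (λ e → μ (p ℕ.* e))) ⟩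
      D m (λ e → A e + μ (p ℕ.* e)) ≡⟨ D-zero m (λ d 1≤d _ → trans (cong (A d +_) (μ-* pp 1≤d)) (ℚ.+-inverseʳ (A d))) ⟩
      0ℚ ≡⟨ sym (𝟙-no (p ℕ.* m ℕ.≟ 1) (p*m≢1 pp)) ⟩
      𝟙 (p ℕ.* m ℕ.≟ 1) ∎
      where
      open ≡-Reasoning
      A : ℕ → ℚ
      A d = 𝟙 (¬? (p ∣? d)) * μ d

  D-coprime-* : ∀ {p m} → Prime p → 1 ℕ.≤ m → (F : ℕ → ℚ) →
    D (p ℕ.* m) (λ d → 𝟙 (¬? (p ∣? d)) * F d) ≡ D m (λ d → 𝟙 (¬? (p ∣? d)) * F d)
  D-coprime-* {p} {m} pp 1≤m F = trans (D-split pp m 1≤m (λ d → 𝟙 (¬? (p ∣? d)) * F d))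
    (trans (cong₂ _+_ (D-cong m λ d _ _ → idem (¬? (p ∣? d)) (F d))
      (D-zero m λ d _ _ → 𝟙*-no (¬? (p ∣? p ℕ.* d)) (λ n → n (p∣p*m p d)) (F (p ℕ.* d)))) (ℚ.+-identityʳ (D m (λ d → 𝟙 (¬? (p ∣? d))
          * F d))))
    where idem : {A : Set} (d : Dec A) → ∀ x → 𝟙 d * (𝟙 d * x) ≡ 𝟙 d * x
          idem (yes _) x = ℚ.*-identityˡ (1ℚ * x)
          idem (no _)  x = trans (ℚ.*-zeroˡ (0ℚ * x)) (sym (ℚ.*-zeroˡ x))

  D-coprime-free : ∀ {p m} → ¬ p ∣ m → (F : ℕ → ℚ) → D m (λ d → 𝟙 (¬? (p ∣? d)) * F d) ≡ D m F
  D-coprime-free {p} {m} ¬p∣m F = D-cong m λ d _ d∣m → 𝟙*-yes (¬? (p ∣? d)) (λ p∣d → ¬p∣m (Div.∣-trans p∣d d∣m)) (F d)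

  -- χpow p m is the indicator of m being a power of p, as ∑ μ(d) over the divisors d of m prime to p.
  χpow : ℕ → ℕ → ℚ
  χpow p m = D m (λ d → 𝟙 (¬? (p ∣? d)) * μ d)

  χpow-coprime : ∀ {p m} → 1 ℕ.≤ m → ¬ p ∣ m → χpow p m ≡ 𝟙 (m ℕ.≟ 1)
  χpow-coprime 1≤m ¬p∣m = trans (D-coprime-free ¬p∣m μ) (D-μ 1≤m)

  χpow-* : ∀ {p m} → Prime p → 1 ℕ.≤ m → χpow p (p ℕ.* m) ≡ χpow p m
  χpow-* pp 1≤m = D-coprime-* pp 1≤m μ

  χpow-≥0 : ∀ {p m} → Prime p → 1 ℕ.≤ m → 0ℚ ≤ χpow p m
  χpow-≥0 {p} {m} pp = split-by pp (λ m → 0ℚ ≤ χpow p m)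
    (λ m 1≤m ¬p∣m → subst (0ℚ ≤_) (sym (χpow-coprime 1≤m ¬p∣m)) (𝟙-≥0 (m ℕ.≟ 1)))
    (λ m 1≤m c → subst (0ℚ ≤_) (sym (χpow-* pp 1≤m)) c) m

  module _ (T : ℕ) where

    -- `h` is additive only approximately; the completely additive function with the same values at
    -- primes makes the identities for `Λ` exact.
    ℓ : ℕ → ℚ
    ℓ n = sumL (h T) (fac n)

    ℓ-* : ∀ {p m} → Prime p → 1 ℕ.≤ m → ℓ (p ℕ.* m) ≡ h T p + ℓ m
    ℓ-* pp 1≤m = sumL-↭ (h T) (fac-* pp 1≤m)

    -- Möbius inversion of the relation that `D-Λ` verifies; the description through powers of p is
    -- `Λ-*`.
    Λ : ℕ → ℚ
    Λ n = - D n (λ d → μ d * ℓ d)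

    Λ-one : Λ 1 ≡ 0ℚ
    Λ-one = refl

    Λ-* : ∀ {p m} → Prime p → 1 ℕ.≤ m → Λ (p ℕ.* m) ≡ h T p * χpow p m
    Λ-* {p} {m} pp 1≤m = begin
      - D (p ℕ.* m) F ≡⟨ cong -_ (D-split pp m 1≤m F) ⟩
      - (D m A + D m (λ e → F (p ℕ.* e))) ≡⟨ cong -_ (sym (D-+ m A (λ e → F (p ℕ.* e)))) ⟩
      - D m (λ e → A e + F (p ℕ.* e)) ≡⟨ cong -_ (D-cong m λ e 1≤e _ → trans (cong (A e +_) (cong₂ _*_ (μ-* pp 1≤e) (ℓ-* pp 1≤e)))
          (lem (𝟙 (¬? (p ∣? e))) (μ e) (ℓ e) (h T p))) ⟩
      - D m (λ e → (- h T p) * (𝟙 (¬? (p ∣? e)) * μ e)) ≡⟨ cong -_ (D-*ˡ m (- h T p) (λ e → 𝟙 (¬? (p ∣? e)) * μ e)) ⟩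
      - ((- h T p) * χpow p m) ≡⟨ lem₂ (h T p) (χpow p m) ⟩
      h T p * χpow p m ∎
      where
      open ≡-Reasoning
      F A : ℕ → ℚ
      F d = μ d * ℓ d
      A d = 𝟙 (¬? (p ∣? d)) * F d
      lem : ∀ i m l hp → i * (m * l) + (- (i * m)) * (hp + l) ≡ (- hp) * (i * m)
      lem = solve-∀ ℚring
      lem₂ : ∀ a b → - ((- a) * b) ≡ a * b
      lem₂ = solve-∀ ℚring

    Λ-step : ∀ {p m} → Prime p → 1 ℕ.≤ m → Λ (p ℕ.* m) ≡ 𝟙 (p ∣? m) * Λ m + h T p * 𝟙 (m ℕ.≟ 1)
    Λ-step {p} {m} pp 1≤m = trans (Λ-* pp 1≤m) (go (p ∣? m))
      where
      go : (d : Dec (p ∣ m)) → h T p * χpow p m ≡ 𝟙 d * Λ m + h T p * 𝟙 (m ℕ.≟ 1)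
      go (no ¬p∣m) = trans (cong (h T p *_) (χpow-coprime 1≤m ¬p∣m))
        (trans (sym (ℚ.+-identityˡ (h T p * 𝟙 (m ℕ.≟ 1)))) (cong (_+ h T p * 𝟙 (m ℕ.≟ 1)) (sym (ℚ.*-zeroˡ (Λ m)))))
      go (yes (divides k refl)) = trans (cong (h T p *_) (trans (cong (χpow p) (ℕ.*-comm k p)) (χpow-* pp 1≤k)))
        (trans (sym (Λ-* pp 1≤k)) (trans (cong Λ (ℕ.*-comm p k)) (trans (lem (Λ (k ℕ.* p)) (h T p))
          (cong (λ z → 1ℚ * Λ (k ℕ.* p) + h T p * z) (sym (𝟙-no (k ℕ.* p ℕ.≟ 1) (λ e → p*m≢1 pp (trans (ℕ.*-comm p k) e))))))))
        where
        1≤k = ∣-pos (Div.m∣m*n p) 1≤m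
        lem : ∀ a b → a ≡ 1ℚ * a + b * 0ℚ
        lem = solve-∀ ℚring

    D-Λ : ∀ {n} → 1 ℕ.≤ n → D n Λ ≡ ℓ n
    D-Λ {n} = prime-induction (λ n → D n Λ ≡ ℓ n) refl step n
      where
      step : ∀ p m → Prime p → 1 ℕ.≤ m → D m Λ ≡ ℓ m → D (p ℕ.* m) Λ ≡ ℓ (p ℕ.* m)
      step p m pp 1≤m ih = begin
        D (p ℕ.* m) Λ ≡⟨ D-split pp m 1≤m Λ ⟩
        D m A + D m (λ e → Λ (p ℕ.* e)) ≡⟨ sym (D-+ m A (λ e → Λ (p ℕ.* e))) ⟩
        D m (λ e → A e + Λ (p ℕ.* e)) ≡⟨ D-cong m (λ e 1≤e _ → trans (cong (A e +_) (Λ-step pp 1≤e)) (recombine (p ∣? e) (Λ e) (h T p * 𝟙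
            (e ℕ.≟ 1)))) ⟩
        D m (λ e → Λ e + h T p * 𝟙 (e ℕ.≟ 1)) ≡⟨ D-+ m Λ (λ e → h T p * 𝟙 (e ℕ.≟ 1)) ⟩
        D m Λ + D m (λ e → h T p * 𝟙 (e ℕ.≟ 1)) ≡⟨ cong₂ _+_ ih (D-*ˡ m (h T p) (λ e → 𝟙 (e ℕ.≟ 1))) ⟩
        ℓ m + h T p * D m (λ e → 𝟙 (e ℕ.≟ 1)) ≡⟨ cong (λ z → ℓ m + h T p * z) unit ⟩
        ℓ m + h T p * 1ℚ ≡⟨ lem (ℓ m) (h T p) ⟩
        h T p + ℓ m ≡⟨ sym (ℓ-* pp 1≤m) ⟩
        ℓ (p ℕ.* m) ∎
        where
        open ≡-Reasoning
        A : ℕ → ℚ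
        A d = 𝟙 (¬? (p ∣? d)) * Λ d
        lem : ∀ a b → a + b * 1ℚ ≡ b + a
        lem = solve-∀ ℚring
        recombine : {X : Set} (d : Dec X) → ∀ x y → 𝟙 (¬? d) * x + (𝟙 d * x + y) ≡ x + y
        recombine (yes _) = solve-∀ ℚring
        recombine (no _)  = solve-∀ ℚring
        unit : D m (λ e → 𝟙 (e ℕ.≟ 1)) ≡ 1ℚ
        unit = trans (Σ-single m 1 {λ e → 𝟙 (e ∣? m) * 𝟙 (e ℕ.≟ 1)} z<s 1≤m
          λ i _ _ i≢1 → trans (cong (𝟙 (i ∣? m) *_) (𝟙-no (i ℕ.≟ 1) i≢1)) (ℚ.*-zeroʳ (𝟙 (i ∣? m))))
          (trans (cong (_* 1ℚ) (𝟙-yes (1 ∣? m) (Div.1∣ m))) refl)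

    -- The constant C = h(x) turns the weights into stand-ins for log(x/d), which are non-negative
    -- and have sum O(x) over d ≤ x; the price is a single term at n = 1.
    D-μ-gap : ∀ {n} → 1 ℕ.≤ n → ∀ C → D n (λ d → μ d * (C - ℓ d)) ≡ C * 𝟙 (n ℕ.≟ 1) + Λ n
    D-μ-gap {n} 1≤n C = begin
      D n (λ d → μ d * (C - ℓ d)) ≡⟨ D-cong n (λ d _ _ → lem C (μ d) (ℓ d)) ⟩
      D n (λ d → C * μ d + (- 1ℚ) * (μ d * ℓ d)) ≡⟨ D-+ n (λ d → C * μ d) (λ d → (- 1ℚ) * (μ d * ℓ d)) ⟩
      D n (λ d → C * μ d) + D n (λ d → (- 1ℚ) * (μ d * ℓ d)) ≡⟨ cong₂ _+_ (D-*ˡ n C μ) (D-*ˡ n (- 1ℚ) (λ d → μ d * ℓ d)) ⟩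
      C * D n μ + (- 1ℚ) * D n (λ d → μ d * ℓ d) ≡⟨ cong₂ _+_ (cong (C *_) (D-μ 1≤n)) (lem₂ (D n (λ d → μ d * ℓ d))) ⟩
      C * 𝟙 (n ℕ.≟ 1) + Λ n ∎
      where
      open ≡-Reasoning
      lem : ∀ C m l → m * (C - l) ≡ C * m + (- 1ℚ) * (m * l)
      lem = solve-∀ ℚring
      lem₂ : ∀ a → (- 1ℚ) * a ≡ - a
      lem₂ = solve-∀ ℚring

    module _ (1≤T : 1 ℕ.≤ T) where

      Λ-≥0 : ∀ {n} → 1 ℕ.≤ n → 0ℚ ≤ Λ n
      Λ-≥0 {n} = prime-induction (λ n → 0ℚ ≤ Λ n) ≤-refl
        (λ p m pp 1≤m _ → subst (0ℚ ≤_) (sym (Λ-* pp 1≤m)) (0≤* (h-≥0 T 1≤T (prime-≥1 pp)) (χpow-≥0 pp 1≤m))) n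

      ℓ-≤-h : ∀ {n} → 1 ℕ.≤ n → ℓ n ≤ h T n
      ℓ-≤-h {n} = prime-induction (λ n → ℓ n ≤ h T n) (≤-reflexive (sym (h-one T 1≤T)))
        (λ p m pp 1≤m ih → subst (_≤ h T (p ℕ.* m)) (sym (ℓ-* pp 1≤m))
          (≤-trans (ℚ.+-monoʳ-≤ (h T p) ih) (h-mult T 1≤T (prime-≥1 pp) 1≤m .proj₁))) n

      -- Each prime split off costs at most 1/T, and n has fewer than n prime factors.
      h-≤-ℓ : ∀ {n} → 1 ℕ.≤ n → h T n ≤ ℓ n + ι n * inv T
      h-≤-ℓ {n} = prime-induction (λ n → h T n ≤ ℓ n + ι n * inv T)
        (subst (_≤ 0ℚ + 1ℚ * inv T) (sym (h-one T 1≤T)) (0≤+ ≤-refl (0≤* 0≤1 (inv-≥0 T))))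
        (λ p m pp 1≤m ih → ≤-trans (h-mult T 1≤T (prime-≥1 pp) 1≤m .proj₂)
          (≤-trans (ℚ.+-monoˡ-≤ (inv T) (ℚ.+-monoʳ-≤ (h T p) ih))
          (≤-trans (≤-reflexive (lem (h T p) (ℓ m) (ι m) (inv T)))
          (≤-trans (ℚ.+-monoʳ-≤ (h T p + ℓ m) (*-monoˡ (inv-≥0 T) (ι-mono (grow p m pp 1≤m))))
          (≤-reflexive (cong (_+ ι (p ℕ.* m) * inv T) (sym (ℓ-* pp 1≤m)))))))) n
        where
        lem : ∀ a b i t → (a + (b + i * t)) + t ≡ (a + b) + (i + 1ℚ) * t
        lem = solve-∀ ℚring
        grow : ∀ p m → Prime p → 1 ℕ.≤ m → suc m ℕ.≤ p ℕ.* m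
        grow p m pp 1≤m = ℕ.≤-trans (ℕ.+-monoˡ-≤ m 1≤m) (ℕ.≤-trans (ℕ.≤-reflexive (cong (m ℕ.+_) (sym (ℕ.+-identityʳ m))))
          (ℕ.*-monoˡ-≤ m (prime-≥2 pp)))

  -- Estimates of Chebyshev and Mertens

  //-max : ∀ {x d m} → 1 ℕ.≤ d → m ℕ.* d ℕ.≤ x → m ℕ.≤ x // d
  //-max {x} {d} {m} 1≤d le = ℕ.m<1+n⇒m≤n (ℕ.*-cancelʳ-< d m (suc (x // d)) (ℕ.≤-<-trans le (//-< x 1≤d)))

  //-zero : ∀ {x d} → x ℕ.< d → x // d ≡ 0
  //-zero {x} {suc d} x<d = DM.m<n⇒m/n≡0 x<d

  *-// : ∀ {d} m → 1 ℕ.≤ d → (d ℕ.* m) // d ≡ m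
  *-// {suc d} m _ = trans (cong (_// suc d) (ℕ.*-comm (suc d) m)) (DM.m*n/n≡m m (suc d))

  ι-cancel : ∀ {m d n} → 1 ℕ.≤ d → m ℕ.* d ℕ.≤ n → ι m ≤ ι n * inv d
  ι-cancel {m} {d} {n} 1≤d le = subst (_≤ ι n * inv d) (trans (cong (_* inv d) (ι-* m d)) (trans (ℚ.*-assoc (ι m) (ι d) (inv d))
    (trans (cong (ι m *_) (ι*inv 1≤d)) (ℚ.*-identityʳ (ι m))))) (*-monoˡ (inv-≥0 d) (ι-mono le))

  ι-cancel′ : ∀ {m d n} → 1 ℕ.≤ d → n ℕ.≤ m ℕ.* d → ι n * inv d ≤ ι m
  ι-cancel′ {m} {d} {n} 1≤d le = subst (ι n * inv d ≤_) (trans (cong (_* inv d) (ι-* m d)) (trans (ℚ.*-assoc (ι m) (ι d) (inv d))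
    (trans (cong (ι m *_) (ι*inv 1≤d)) (ℚ.*-identityʳ (ι m))))) (*-monoˡ (inv-≥0 d) (ι-mono le))

  inv-suc-// : ∀ {x d} → 1 ℕ.≤ x → 1 ℕ.≤ d → inv (suc (x // d)) ≤ ι d * inv x
  inv-suc-// {x} {d} 1≤x 1≤d = subst (_≤ ι d * inv x) (ι*inv* d {suc (x // d)} 1≤d)
    (*-monoʳ (ι-≥0 d) (inv-anti 1≤x (ℕ.<⇒≤ (//-< x 1≤d))))

  inv-≤-2inv : ∀ {n} → 1 ℕ.≤ n → inv n ≤ ι 2 * inv (suc n)
  inv-≤-2inv {n} 1≤n = ≤-trans (ℚ.≤-reflexive (sym (trans (cong (ι 2 *_) (inv-* 2 n)) (trans (sym (ℚ.*-assoc (ι 2) (inv 2) (inv n)))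
      (ℚ.*-identityˡ (inv n))))))
    (*-monoʳ (ι-≥0 2) (inv-anti {suc n} {2 ℕ.* n} z<s (ℕ.≤-trans (ℕ.+-monoˡ-≤ n 1≤n) (ℕ.≤-reflexive (cong (n ℕ.+_) (sym
        (ℕ.+-identityʳ n)))))))

  Hs-≤-ι : ∀ n → Hs n ≤ ι n
  Hs-≤-ι n = ≤-trans (Σ-mono n {inv} {λ _ → 1ℚ} λ i _ _ → inv≤1 i) (≤-reflexive (trans (Σ-const n 1ℚ) (ℚ.*-identityʳ (ι n))))

  -- A geometric series with ratio 1/p ≤ 1/2: apart from m = 1 only multiples of p count, and by
  -- `χpow-tail` these reproduce the sum up to y/p, scaled by 1/p.
  χpow-sum : ∀ {p} → Prime p → ∀ y → Σ y (λ m → χpow p m * inv m) ≤ ι 2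
  χpow-tail : ∀ {p} → Prime p → ∀ y → Σ y (λ m → 𝟙 (p ∣? m) * (χpow p m * inv m)) ≡ inv p * Σ (y // p) (λ m → χpow p m * inv m)
  χpow-tail {p} pp y = trans (Σ-multiples y (prime-≥1 pp) (λ m → χpow p m * inv m))
    (trans (Σ-cong (y // p) λ m 1≤m _ → trans (cong₂ _*_ (χpow-* pp 1≤m) (inv-* p m)) (lem (χpow p m) (inv p) (inv m)))
      (Σ-*ˡ (y // p) (inv p) (λ m → χpow p m * inv m)))
    where lem : ∀ a b c → a * (b * c) ≡ b * (a * c)
          lem = solve-∀ ℚring
  χpow-sum {p} pp = ℕInd.<-rec _ go
    where
    C : ℕ → ℚ
    C m = χpow p m * inv m
    inv-p : inv p ≤ ½
    inv-p = inv-anti {2} {p} z<s (prime-≥2 pp)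
    pointwise : ∀ m → 1 ℕ.≤ m → C m ≡ 𝟙 (m ℕ.≟ 1) + 𝟙 (p ∣? m) * C m
    pointwise m 1≤m = split (p ∣? m) (m ℕ.≟ 1)
      where
      split : (d : Dec (p ∣ m)) (e : Dec (m ≡ 1)) → C m ≡ 𝟙 e + 𝟙 d * C m
      split (yes p∣m) (yes m≡1) = contradiction (Div.∣1⇒≡1 (subst (p ∣_) m≡1 p∣m)) (ℕ.>⇒≢ (prime-≥2 pp))
      split (yes _) (no _) = lem (C m)
        where lem : ∀ a → a ≡ 0ℚ + 1ℚ * a
              lem = solve-∀ ℚring
      split (no ¬p∣m) (yes m≡1) = trans (cong₂ _*_ (trans (χpow-coprime 1≤m ¬p∣m) (𝟙-yes (m ℕ.≟ 1) m≡1)) (cong inv m≡1)) (lem (C m))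
        where lem : ∀ a → 1ℚ ≡ 1ℚ + 0ℚ * a
              lem = solve-∀ ℚring
      split (no ¬p∣m) (no m≢1) = trans (cong (_* inv m) (trans (χpow-coprime 1≤m ¬p∣m) (𝟙-no (m ℕ.≟ 1) m≢1))) (lem (inv m) (C m))
        where lem : ∀ b a → 0ℚ * b ≡ 0ℚ + 0ℚ * a
              lem = solve-∀ ℚring
    unit : ∀ y → Σ y (λ m → 𝟙 (m ℕ.≟ 1)) ≤ 1ℚ
    unit zero    = 0≤1
    unit (suc y) = ≤-reflexive (Σ-single (suc y) 1 {λ m → 𝟙 (m ℕ.≟ 1)} z<s z<s λ i _ _ i≢1 → 𝟙-no (i ℕ.≟ 1) i≢1)
    go : ∀ y → (∀ {z} → z ℕ.< y → Σ z C ≤ ι 2) → Σ y C ≤ ι 2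
    go zero    rec = ι-≥0 2
    go (suc y) rec = ≤-trans (≤-reflexive (trans (Σ-cong (suc y) λ m 1≤m _ → pointwise m 1≤m)
        (trans (Σ-+ (suc y) (λ m → 𝟙 (m ℕ.≟ 1)) (λ m → 𝟙 (p ∣? m) * C m)) (cong (Σ (suc y) (λ m → 𝟙 (m ℕ.≟ 1)) +_) (χpow-tail pp
            (suc y))))))
      (+-mono-≤ (unit (suc y)) (*-mono {inv p} {½} {Σ (suc y // p) C} {ι 2} (<⇒≤ (ℚ.positive⁻¹ ½)) nonneg inv-p (rec smaller)))
      where
      nonneg : 0ℚ ≤ Σ (suc y // p) C
      nonneg = Σ-≥0 (suc y // p) λ m 1≤m _ → 0≤* (χpow-≥0 pp 1≤m) (inv-≥0 m)
      smaller : suc y // p ℕ.< suc y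
      smaller = ℕ.≤-<-trans (ℕ.≤-refl) (ℕ.≰⇒> λ le → ℕ.<⇒≱ (ℕ.m<m*n (suc y) p (prime-≥2 pp))
        (ℕ.≤-trans (ℕ.*-monoˡ-≤ p le) (//-*≤ (suc y) p)))

  module _ (T : ℕ) (1≤T : 1 ℕ.≤ T) where

    private
      H L Lm : ℕ → ℚ
      H  = h T
      L  = ℓ T
      Lm = Λ T

    ℓ-gap-≥0 : ∀ {x n} → 1 ℕ.≤ n → n ℕ.≤ x → 0ℚ ≤ h T x - ℓ T n
    ℓ-gap-≥0 1≤n n≤x = 0≤-diff (≤-trans (ℓ-≤-h T 1≤T 1≤n) (h-mono T 1≤T 1≤n n≤x))

    h-ℓ-≤1 : ∀ {n} → 1 ℕ.≤ n → n ℕ.≤ T → h T n - ℓ T n ≤ 1ℚ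
    h-ℓ-≤1 {n} 1≤n n≤T = ≤-trans (≤-by (ℓ T n + ι n * inv T - h T n) (0≤-diff (h-≤-ℓ T 1≤T 1≤n)) (lem (h T n) (ℓ T n) (ι n * inv T)))
      (ι-cancel′ {1} {T} {n} 1≤T (subst (n ℕ.≤_) (sym (ℕ.*-identityˡ T)) n≤T))
      where lem : ∀ a b c → c ≡ (a - b) + (b + c - a)
            lem = solve-∀ ℚring

    Σ-ℓ-gap : ∀ {x} → x ℕ.≤ T → Σ x (λ n → h T x - ℓ T n) ≤ ι x + ι x
    Σ-ℓ-gap {x} x≤T = ≤-trans (≤-reflexive (trans (Σ-ext x λ n → lem (H x) (H n) (L n)) (Σ-+ x (λ n → H x - H n) (λ n → H n - L n))))
      (+-mono-≤ (Σ-h-gap T 1≤T x) (≤-trans (Σ-mono x {λ n → H n - L n} {λ _ → 1ℚ} λ n 1≤n n≤x → h-ℓ-≤1 1≤n (ℕ.≤-trans n≤x x≤T))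
        (≤-reflexive (trans (Σ-const x 1ℚ) (ℚ.*-identityʳ (ι x))))))
      where lem : ∀ a b c → a - c ≡ (a - b) + (b - c)
            lem = solve-∀ ℚring

    Σℓ-upper : ∀ x → Σ x (ℓ T) ≤ ι x * h T x
    Σℓ-upper x = ≤-trans (Σ-mono x {L} {λ _ → H x} λ n 1≤n n≤x → ≤-trans (ℓ-≤-h T 1≤T 1≤n) (h-mono T 1≤T 1≤n n≤x))
      (≤-reflexive (Σ-const x (H x)))

    Σℓ-lower : ∀ {x} → x ℕ.≤ T → ι x * h T x ≤ Σ x (ℓ T) + (ι x + ι x)
    Σℓ-lower {x} x≤T = ≤-by (ι x + ι x - (ι x * H x - Σ x L))
      (0≤-diff (subst (_≤ ι x + ι x) (trans (Σ-diff x (λ _ → H x) L) (cong (_- Σ x L) (Σ-const x (H x)))) (Σ-ℓ-gap x≤T)))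
      (lem (Σ x L) (ι x) (ι x * H x))
      where lem : ∀ s i z → s + (i + i) ≡ z + (i + i - (z - s))
            lem = solve-∀ ℚring

    Σℓ-floor : ∀ x → Σ x (ℓ T) ≡ Σ x (λ d → Λ T d * ι (x // d))
    Σℓ-floor x = trans (Σ-cong x λ n 1≤n _ → sym (D-Λ T 1≤n)) (trans (hyperbola x (λ d _ → Lm d))
      (Σ-ext x λ d → trans (Σ-const (x // d) (Lm d)) (ℚ.*-comm (ι (x // d)) (Lm d))))

    -- The logarithm of the central binomial coefficient: the weight ⌊2y/d⌋ - 2⌊y/d⌋ is never
    -- negative and at least 1 for y < d ≤ 2y. Of 6y, the part 2y bounds 2y(h(2y) - h(y)) and 4y
    -- comes from the lower bound for the sum of `ℓ`.
    chebyshev-step : ∀ {y} → 1 ℕ.≤ y → 2 ℕ.* y ℕ.≤ T → Σ (2 ℕ.* y) (Λ T) ≤ Σ y (Λ T) + ι (6 ℕ.* y)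
    chebyshev-step {y} 1≤y 2y≤T = ≤-trans (≤-reflexive (Σ-tail Lm y≤2y)) (ℚ.+-monoʳ-≤ (Σ y Lm)
      (≤-trans (≤-trans (Σ-mono k {λ i → Lm (y ℕ.+ i)} {λ i → W (y ℕ.+ i)} tail) (≤-by (Σ y W) (Σ-≥0 y λ d 1≤d _ → W-≥0 d 1≤d)
        (trans (Σ-tail W y≤2y) (ℚ.+-comm (Σ y W) (Σ k (λ i → W (y ℕ.+ i)))))))
      (≤-trans (≤-reflexive W-sum) upper)))
      where
      k = 2 ℕ.* y ℕ.∸ y
      y≤2y : y ℕ.≤ 2 ℕ.* y
      y≤2y = ℕ.m≤m+n y _
      W : ℕ → ℚ
      W d = Lm d * (ι ((2 ℕ.* y) // d) - ι 2 * ι (y // d))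
      floor2 : ∀ d → 1 ℕ.≤ d → 2 ℕ.* (y // d) ℕ.≤ (2 ℕ.* y) // d
      floor2 d 1≤d = //-max {2 ℕ.* y} {d} 1≤d (ℕ.≤-trans (ℕ.≤-reflexive (ℕ.*-assoc 2 (y // d) d)) (ℕ.*-monoʳ-≤ 2 (//-*≤ y d)))
      W-≥0 : ∀ d → 1 ℕ.≤ d → 0ℚ ≤ W d
      W-≥0 d 1≤d = 0≤* (Λ-≥0 T 1≤T 1≤d) (0≤-diff (subst (_≤ ι ((2 ℕ.* y) // d)) (ι-* 2 (y // d)) (ι-mono (floor2 d 1≤d))))
      tail : ∀ i → 1 ℕ.≤ i → i ℕ.≤ k → Lm (y ℕ.+ i) ≤ W (y ℕ.+ i)
      tail i 1≤i i≤k = subst₂ _≤_ (ℚ.*-identityʳ (Lm d)) refl (*-monoʳ {Lm d} (Λ-≥0 T 1≤T 1≤d)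
        (≤-trans (ι-mono {1} {(2 ℕ.* y) // d} (//-max {2 ℕ.* y} {d} {1} 1≤d (ℕ.≤-trans (ℕ.≤-reflexive (ℕ.*-identityˡ d))
            (tail-range y≤2y i≤k))))
          (≤-reflexive (trans (lem (ι ((2 ℕ.* y) // d))) (cong (λ z → ι ((2 ℕ.* y) // d) - ι 2 * ι z) (sym (//-zero {y} {d}
              (ℕ.m<m+n y 1≤i))))))))
        where
        d = y ℕ.+ i
        1≤d : 1 ℕ.≤ d
        1≤d = ℕ.≤-trans 1≤y (ℕ.m≤m+n y i)
        lem : ∀ a → a ≡ a - ι 2 * 0ℚ
        lem = solve-∀ ℚring
      W-sum : Σ (2 ℕ.* y) W ≡ Σ (2 ℕ.* y) L - ι 2 * Σ y L
      W-sum = trans (Σ-ext (2 ℕ.* y) λ d → lem (Lm d) (ι ((2 ℕ.* y) // d)) (ι (y // d)))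
        (trans (Σ-diff (2 ℕ.* y) (λ d → Lm d * ι ((2 ℕ.* y) // d)) (λ d → ι 2 * (Lm d * ι (y // d))))
        (cong₂ _-_ (sym (Σℓ-floor (2 ℕ.* y))) (trans (Σ-*ˡ (2 ℕ.* y) (ι 2) (λ d → Lm d * ι (y // d)))
          (cong (ι 2 *_) (trans (Σ-extend y≤2y λ d y<d _ → trans (cong (λ z → Lm d * ι z) (//-zero y<d)) (ℚ.*-zeroʳ (Lm d))) (sym
              (Σℓ-floor y)))))))
        where lem : ∀ a b c → a * (b - ι 2 * c) ≡ a * b - ι 2 * (a * c)
              lem = solve-∀ ℚring
      upper : Σ (2 ℕ.* y) L - ι 2 * Σ y L ≤ ι (6 ℕ.* y)
      upper = ≤-by ((ι (2 ℕ.* y) * H (2 ℕ.* y) - Σ (2 ℕ.* y) L) + ι 2 * ((Σ y L + (ι y + ι y)) - ι y * H y) + ι (2 ℕ.* y) * (1ℚ - (H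
          (2 ℕ.* y) - H y)))
        (0≤+ (0≤+ (0≤-diff (Σℓ-upper (2 ℕ.* y))) (0≤* (ι-≥0 2) (0≤-diff (Σℓ-lower (ℕ.≤-trans y≤2y 2y≤T)))))
          (0≤* (ι-≥0 (2 ℕ.* y)) (0≤-diff (h-double T 1≤T 1≤y))))
        (subst₂ (λ a b → a ≡ (Σ (2 ℕ.* y) L - ι 2 * Σ y L) + ((b * H (2 ℕ.* y) - Σ (2 ℕ.* y) L) + ι 2 * ((Σ y L + (ι y + ι y)) - ι y * H y)
            + b * (1ℚ - (H (2 ℕ.* y) - H y))))
          (sym (ι-* 6 y)) (sym (ι-* 2 y)) (lem (Σ (2 ℕ.* y) L) (Σ y L) (ι y) (H (2 ℕ.* y)) (H y)))
        where lem : ∀ A B y H₂ H₁ → ι 6 * y ≡ (A - ι 2 * B) + ((ι 2 * y * H₂ - A) + ι 2 * ((B + (y + y)) - y * H₁) + ι 2 * y * (1ℚ -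
                  (H₂ - H₁)))
              lem = solve-∀ ℚring

    chebyshev : ∀ x → suc x ℕ.≤ T → Σ x (Λ T) ≤ ι (18 ℕ.* x)
    chebyshev = ℕInd.<-rec _ go
      where
      go : ∀ x → (∀ {y} → y ℕ.< x → suc y ℕ.≤ T → Σ y Lm ≤ ι (18 ℕ.* y)) → suc x ℕ.≤ T → Σ x Lm ≤ ι (18 ℕ.* x)
      go zero rec _ = ≤-refl
      go (suc zero) rec _ = ι-≥0 18
      go x@(suc (suc x₀)) rec le = ≤-trans (Σ-mono-range {x} {2 ℕ.* y} {Lm} x≤2y λ i x<i _ → Λ-≥0 T 1≤T (ℕ.≤-trans z<s x<i))
        (≤-trans (chebyshev-step 1≤y (ℕ.≤-trans 2y≤ le)) (≤-trans (ℚ.+-monoˡ-≤ (ι (6 ℕ.* y)) (rec y<x (ℕ.≤-trans y<x (ℕ.<⇒≤ le))))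
        (≤-trans (≤-reflexive (sym (ι-+ (18 ℕ.* y) (6 ℕ.* y)))) (ι-mono final))))
        where
        -- Half of x rounded up, so 2y ≤ x + 1. From x = 2 on, 4y ≤ 2x + 2 ≤ 3x, which is what 18y +
        -- 6y ≤ 18x requires.
        y = suc x // 2
        2y≤ : 2 ℕ.* y ℕ.≤ suc x
        2y≤ = ℕ.≤-trans (ℕ.≤-reflexive (ℕ.*-comm 2 y)) (//-*≤ (suc x) 2)
        x≤2y : x ℕ.≤ 2 ℕ.* y
        x≤2y = ℕ.≤-trans (ℕ.m<1+n⇒m≤n (ℕ.m<1+n⇒m≤n (//-< (suc x) {2} z<s))) (ℕ.≤-reflexive (ℕ.*-comm y 2))
        1≤y : 1 ℕ.≤ y
        1≤y = //-max {suc x} {2} {1} z<s (s≤s z<s)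
        4y≤3x : 4 ℕ.* y ℕ.≤ 3 ℕ.* x
        4y≤3x = ℕ.≤-trans (ℕ.≤-reflexive (ℕ.*-assoc 2 2 y)) (ℕ.≤-trans (ℕ.*-monoʳ-≤ 2 2y≤)
          (ℕ.≤-trans (ℕ.≤-reflexive (ℕ.*-suc 2 x)) (ℕ.+-monoˡ-≤ (2 ℕ.* x) (s≤s z<s))))
        y<x : y ℕ.< x
        y<x = ℕ.*-cancelˡ-< 4 y x (ℕ.≤-<-trans 4y≤3x (ℕ.*-monoˡ-< x {3} {4} ℕ.≤-refl))
        final : 18 ℕ.* y ℕ.+ 6 ℕ.* y ℕ.≤ 18 ℕ.* x
        final = ℕ.≤-trans (ℕ.≤-reflexive (trans (sym (ℕ.*-distribʳ-+ y 18 6)) (ℕ.*-assoc 6 4 y)))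
          (ℕ.≤-trans (ℕ.*-monoʳ-≤ 6 4y≤3x) (ℕ.≤-reflexive (sym (ℕ.*-assoc 6 3 x))))

    M : ℕ → ℚ
    M x = Σ x (λ n → Λ T n * inv n)

    M-≥0 : ∀ x → 0ℚ ≤ M x
    M-≥0 x = Σ-≥0 x λ n 1≤n _ → 0≤* (Λ-≥0 T 1≤T 1≤n) (inv-≥0 n)

    private
      -- The factor on the right is the fractional part of x/d, so the excess lies between 0 and the
      -- Chebyshev sum.
      M-excess : ∀ x → ι x * M x - Σ x L ≡ Σ x (λ d → Lm d * (ι x * inv d - ι (x // d)))
      M-excess x = trans (cong₂ _-_ (sym (Σ-*ˡ x (ι x) (λ n → Lm n * inv n))) (Σℓ-floor x))
        (trans (sym (Σ-diff x (λ n → ι x * (Lm n * inv n)) (λ d → Lm d * ι (x // d)))) (Σ-ext x λ d → lem (ι x) (Lm d) (inv d) (ι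
            (x // d))))
        where lem : ∀ a b c d → a * (b * c) - b * d ≡ b * (a * c - d)
              lem = solve-∀ ℚring

    mertens-lower : ∀ {x} → 1 ℕ.≤ x → suc x ℕ.≤ T → h T x ≤ M x + ι 2
    mertens-lower {x} 1≤x x<T = *-cancelˡ (0<ι 1≤x) (≤-trans (Σℓ-lower (ℕ.<⇒≤ x<T)) (≤-by (ι x * M x - Σ x L)
      (subst (0ℚ ≤_) (sym (M-excess x)) (Σ-≥0 x λ d 1≤d _ → 0≤* (Λ-≥0 T 1≤T 1≤d) (0≤-diff (ι-cancel {x // d} {d} {x} 1≤d (//-*≤ x d)))))
      (lem (ι x) (M x) (Σ x L))))
      where lem : ∀ i m s → i * (m + ι 2) ≡ (s + (i + i)) + (i * m - s)
            lem = solve-∀ ℚring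

    mertens-upper : ∀ {x} → 1 ℕ.≤ x → suc x ℕ.≤ T → M x ≤ h T x + ι 18
    mertens-upper {x} 1≤x x<T = *-cancelˡ (0<ι 1≤x) (≤-trans (≤-reflexive (lem (ι x * M x) (Σ x L)))
      (≤-trans (+-mono-≤ (Σℓ-upper x) (≤-trans (≤-reflexive (M-excess x)) (≤-trans (Σ-mono x {g = Lm} λ d 1≤d _ → bound d 1≤d)
          (chebyshev x x<T))))
      (≤-reflexive (trans (cong (ι x * H x +_) (ι-* 18 x)) (lem₂ (ι x) (H x))))))
      where
      lem : ∀ a b → a ≡ b + (a - b)
      lem = solve-∀ ℚring
      lem₂ : ∀ i a → i * a + ι 18 * i ≡ i * (a + ι 18)
      lem₂ = solve-∀ ℚring
      bound : ∀ d → 1 ℕ.≤ d → Lm d * (ι x * inv d - ι (x // d)) ≤ Lm d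
      bound d 1≤d = ≤-trans (*-monoʳ {Lm d} {ι x * inv d - ι (x // d)} {1ℚ} (Λ-≥0 T 1≤T 1≤d)
        (≤-by (ι (suc (x // d)) - ι x * inv d) (0≤-diff (ι-cancel′ {suc (x // d)} {d} {x} 1≤d (ℕ.<⇒≤ (//-< x 1≤d)))) (l (ι x * inv d) (ι
            (x // d)))))
        (≤-reflexive (ℚ.*-identityʳ (Lm d)))
        where l : ∀ a b → 1ℚ ≡ (a - b) + ((b + 1ℚ) - a)
              l = solve-∀ ℚring

  -- Contribution of prime powers

  prime-factor : ∀ n → 1 ℕ.≤ n → n ≡ 1 ⊎ ∃ λ p → ∃ λ m → Prime p × 1 ℕ.≤ m × n ≡ p ℕ.* m
  prime-factor = prime-induction _ (inj₁ refl) λ p m pp 1≤m _ → inj₂ (p , m , pp , 1≤m , refl)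

  common-prime : ∀ {n q} → 1 ℕ.≤ n → ¬ Coprime n q → ∃ λ p → Prime p × (p ∣ n) × (p ∣ q)
  common-prime {n} {q} 1≤n ¬c with prime-factor (GCD.gcd n q) (∣-pos (GCD.gcd[m,n]∣m n q) 1≤n)
  ... | inj₁ e = ⊥-elim (¬c (λ {d} → Coprimality.gcd≡1⇒coprime e {d}))
  ... | inj₂ (p , m , pp , _ , e) = p , pp , Div.∣-trans (subst (p ∣_) (sym e) (p∣p*m p m)) (GCD.gcd[m,n]∣m n q)
    , Div.∣-trans (subst (p ∣_) (sym e) (p∣p*m p m)) (GCD.gcd[m,n]∣n n q)

  module _ (T : ℕ) (1≤T : 1 ℕ.≤ T) where

    private
      H Lm : ℕ → ℚ
      H  = h T
      Lm = Λ T

    -- Prime powers n = p m are counted through the prime p, which makes the sum over m geometric.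
    prime-power-sum-≤ : ∀ x (U : ℕ → ℚ) (w : ℕ → ℕ → ℚ) → (∀ d m → 0ℚ ≤ w d m) →
      (∀ n → 1 ℕ.≤ n → U n ≤ 0ℚ ⊎ ∃ λ p → ∃ λ m → Prime p × 1 ℕ.≤ m × n ≡ p ℕ.* m × U n ≤ w p m * (h T p * χpow p m)) →
      Σ x (λ n → U n * inv n) ≤ Σ x (λ d → 𝟙 (prime? d) * ((h T d * inv d) * Σ (x // d) (λ m → w d m * (χpow d m * inv m))))
    prime-power-sum-≤ x U w w≥0 cover = ≤-trans (Σ-mono x λ n 1≤n _ → pointwise n 1≤n (cover n 1≤n))
      (≤-reflexive (trans (hyperbola x F) (Σ-cong x λ d 1≤d _ → inner d 1≤d)))
      where
      F : ℕ → ℕ → ℚ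
      F d n = 𝟙 (prime? d) * ((w d (n // d) * (H d * χpow d (n // d))) * inv n)
      F-≥0 : ∀ d n → 1 ℕ.≤ n // d → 0ℚ ≤ F d n
      F-≥0 d n 1≤m = by (prime? d)
        where
        by : (pd : Dec (Prime d)) → 0ℚ ≤ 𝟙 pd * ((w d (n // d) * (H d * χpow d (n // d))) * inv n)
        by (yes pd) = 0≤* 0≤1 (0≤* (0≤* (w≥0 d (n // d)) (0≤* (h-≥0 T 1≤T (prime-≥1 pd)) (χpow-≥0 pd 1≤m))) (inv-≥0 n))
        by (no _)   = ≤-reflexive (sym (ℚ.*-zeroˡ ((w d (n // d) * (H d * χpow d (n // d))) * inv n)))
      term-≥0 : ∀ n → 1 ℕ.≤ n → ∀ d → 1 ℕ.≤ d → 0ℚ ≤ 𝟙 (d ∣? n) * F d n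
      term-≥0 n 1≤n d 1≤d = by (d ∣? n)
        where
        by : (dn : Dec (d ∣ n)) → 0ℚ ≤ 𝟙 dn * F d n
        by (yes d∣n) = 0≤* 0≤1 (F-≥0 d n (//-max {n} {d} {1} 1≤d (ℕ.≤-trans (ℕ.≤-reflexive (ℕ.*-identityˡ d)) (∣-le d∣n 1≤n))))
        by (no _)    = ≤-reflexive (sym (ℚ.*-zeroˡ (F d n)))
      pointwise : ∀ n → 1 ℕ.≤ n → (U n ≤ 0ℚ ⊎ ∃ λ p → ∃ λ m → Prime p × 1 ℕ.≤ m × n ≡ p ℕ.* m × U n ≤ w p m * (H p * χpow p m)) →
        U n * inv n ≤ D n (λ d → F d n)
      pointwise n 1≤n (inj₁ neg) = ≤-trans (*-monoˡ (inv-≥0 n) neg) (≤-trans (≤-reflexive (ℚ.*-zeroˡ (inv n))) (Σ-≥0 n λ d 1≤d _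
          → term-≥0 n 1≤n d 1≤d))
      pointwise n 1≤n (inj₂ (p , m , pp , 1≤m , n≡pm , le)) = ≤-trans (*-monoˡ (inv-≥0 n) le)
        (≤-trans (≤-reflexive (sym (trans (𝟙*-yes (p ∣? n) p∣n (F p n)) (trans (𝟙*-yes (prime? p) pp _)
            (cong (λ z → (w p z * (H p * χpow p z)) * inv n) (trans (cong (_// p) n≡pm) (*-// m (prime-≥1 pp))))))))
          (Σ-term n p {λ d → 𝟙 (d ∣? n) * F d n} (prime-≥1 pp) (∣-le p∣n 1≤n) λ d 1≤d _ → term-≥0 n 1≤n d 1≤d))
        where p∣n = subst (p ∣_) (sym n≡pm) (p∣p*m p m)
      inner : ∀ d → 1 ℕ.≤ d → Σ (x // d) (λ m → F d (d ℕ.* m)) ≡ 𝟙 (prime? d) * ((H d * inv d) * Σ (x // d) (λ m → w d m *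
          (χpow d m * inv m)))
      inner d 1≤d = trans (Σ-ext (x // d) λ m → trans (cong₂ (λ a b → 𝟙 (prime? d) * ((w d a * (H d * χpow d a)) * b)) (*-// m 1≤d)
          (inv-* d m))
          (lem (𝟙 (prime? d)) (w d m) (H d) (χpow d m) (inv d) (inv m)))
        (trans (Σ-*ˡ (x // d) (𝟙 (prime? d)) (λ m → (H d * inv d) * (w d m * (χpow d m * inv m))))
          (cong (𝟙 (prime? d) *_) (Σ-*ˡ (x // d) (H d * inv d) (λ m → w d m * (χpow d m * inv m)))))
        where lem : ∀ a w h c i j → a * ((w * (h * c)) * (i * j)) ≡ a * ((h * i) * (w * (c * j)))
              lem = solve-∀ ℚring

    -- A prime power that is not prime is p m with p dividing m, so its series starts at 1/p: the
    -- sum over m is at most 2/p ≤ 4/(p + 1), and the sum of h(d)/(d(d + 1)) is at most 1.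
    Λ-nonprime-sum : ∀ x → Σ x (λ n → 𝟙 (¬? (prime? n)) * Λ T n * inv n) ≤ ι 4
    Λ-nonprime-sum x = ≤-trans (prime-power-sum-≤ x (λ n → 𝟙 (¬? (prime? n)) * Lm n) (λ d m → 𝟙 (d ∣? m)) (λ d m → 𝟙-≥0 (d ∣? m)) cover)
      (≤-trans (Σ-mono x {g = λ d → ι 4 * (H d * (inv d * inv (suc d)))} λ d 1≤d _ → bound d 1≤d (prime? d))
      (≤-trans (≤-reflexive (Σ-*ˡ x (ι 4) (λ d → H d * (inv d * inv (suc d))))) (*-monoʳ (ι-≥0 4) (Σ-h-inv² T 1≤T x))))
      where
      cover : ∀ n → 1 ℕ.≤ n → 𝟙 (¬? (prime? n)) * Lm n ≤ 0ℚ ⊎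
        ∃ λ p → ∃ λ m → Prime p × 1 ℕ.≤ m × n ≡ p ℕ.* m × 𝟙 (¬? (prime? n)) * Lm n ≤ 𝟙 (p ∣? m) * (H p * χpow p m)
      cover n 1≤n with prime-factor n 1≤n
      ... | inj₁ refl = inj₁ (≤-reflexive (trans (cong (𝟙 (¬? (prime? 1)) *_) (Λ-one T)) (ℚ.*-zeroʳ (𝟙 (¬? (prime? 1))))))
      ... | inj₂ (p , m , pp , 1≤m , refl) = inj₂ (p , m , pp , 1≤m , refl ,
        ≤-trans (≤-reflexive (cong (𝟙 (¬? (prime? (p ℕ.* m))) *_) (Λ-* T pp 1≤m))) (by (p ∣? m)))
        where
        X = H p * χpow p m
        X≥0 : 0ℚ ≤ X
        X≥0 = 0≤* (h-≥0 T 1≤T (prime-≥1 pp)) (χpow-≥0 pp 1≤m)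
        by₁ : ¬ p ∣ m → Dec (m ≡ 1) → 𝟙 (¬? (prime? (p ℕ.* m))) * X ≤ 0ℚ * X
        by₁ ¬p∣m (yes refl) = ≤-reflexive (cong (_* X) (𝟙-no (¬? (prime? (p ℕ.* 1))) (λ n → n (subst Prime (sym (ℕ.*-identityʳ p)) pp))))
        by₁ ¬p∣m (no m≢1) = ≤-reflexive (trans (cong (𝟙 (¬? (prime? (p ℕ.* m))) *_) X≡0) (trans (ℚ.*-zeroʳ (𝟙 (¬? (prime? (p ℕ.* m))))) (sym
            (ℚ.*-zeroˡ X))))
          where X≡0 : X ≡ 0ℚ
                X≡0 = trans (cong (H p *_) (trans (χpow-coprime 1≤m ¬p∣m) (𝟙-no (m ℕ.≟ 1) m≢1))) (ℚ.*-zeroʳ (H p))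
        by : (pm : Dec (p ∣ m)) → 𝟙 (¬? (prime? (p ℕ.* m))) * X ≤ 𝟙 pm * X
        by (yes _)   = *-monoˡ X≥0 (𝟙-≤1 (¬? (prime? (p ℕ.* m))))
        by (no ¬p∣m) = by₁ ¬p∣m (m ℕ.≟ 1)
      bound : ∀ d → 1 ℕ.≤ d → (pd : Dec (Prime d)) → 𝟙 pd * ((H d * inv d) * Σ (x // d) (λ m → 𝟙 (d ∣? m) * (χpow d m * inv m))) ≤ ι 4 *
          (H d * (inv d * inv (suc d)))
      bound d 1≤d (no _) = ≤-trans (≤-reflexive (ℚ.*-zeroˡ ((H d * inv d) * Σ (x // d) (λ m → 𝟙 (d ∣? m) * (χpow d m * inv m)))))
        (0≤* (ι-≥0 4) (0≤* (h-≥0 T 1≤T 1≤d) (0≤* (inv-≥0 d) (inv-≥0 (suc d)))))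
      bound d 1≤d (yes pd) = ≤-trans (≤-reflexive (ℚ.*-identityˡ _)) (≤-trans (*-monoʳ Hd≥0
        (≤-trans (≤-reflexive (χpow-tail pd (x // d))) (*-mono {inv d} {ι 2 * inv (suc d)} {Σ ((x // d) // d) (λ m
            → χpow d m * inv m)} {ι 2}
           (0≤* (ι-≥0 2) (inv-≥0 (suc d))) (Σ-≥0 ((x // d) // d) λ m 1≤m _ → 0≤* (χpow-≥0 pd 1≤m) (inv-≥0 m)) (inv-≤-2inv 1≤d) (χpow-sum pd
               ((x // d) // d)))))
        (≤-reflexive (lem (H d) (inv d) (inv (suc d)))))
        where
        Hd≥0 : 0ℚ ≤ H d * inv d
        Hd≥0 = 0≤* (h-≥0 T 1≤T 1≤d) (inv-≥0 d)
        lem : ∀ a b c → (a * b) * ((ι 2 * c) * ι 2) ≡ ι 4 * (a * (b * c))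
        lem = solve-∀ ℚring

    h-inv-≤1 : ∀ {d} → 1 ℕ.≤ d → h T d * inv d ≤ 1ℚ
    h-inv-≤1 {suc d} 1≤d = ≤-trans (*-monoˡ (inv-≥0 (suc d)) (≤-trans (h-≤-Hs T 1≤T d) (≤-trans (Hs-≤-ι d) (ι-mono (ℕ.n≤1+n d)))))
        (≤-reflexive (ι*inv {suc d} 1≤d))

    -- Each prime divisor p of q contributes at most 2 h(p)/p ≤ 2, and q has at most q divisors.
    Λ-noncoprime-sum : ∀ {q} → 1 ℕ.≤ q → ∀ x → Σ x (λ n → 𝟙 (¬? (coprime? n q)) * Λ T n * inv n) ≤ ι (2 ℕ.* q)
    Λ-noncoprime-sum {q} 1≤q x = ≤-trans (prime-power-sum-≤ x (λ n → 𝟙 (¬? (coprime? n q)) * Lm n) (λ d m → 𝟙 (d ∣? q)) (λ d m → 𝟙-≥0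
        (d ∣? q)) cover)
      (≤-trans (Σ-mono x {g = λ d → ι 2 * 𝟙 (d ∣? q)} λ d 1≤d _ → bound d 1≤d (prime? d))
      (≤-trans (≤-reflexive (Σ-*ˡ x (ι 2) (λ d → 𝟙 (d ∣? q)))) (≤-trans (*-monoʳ (ι-≥0 2) count) (≤-reflexive (sym (ι-* 2 q))))))
      where
      cover : ∀ n → 1 ℕ.≤ n → 𝟙 (¬? (coprime? n q)) * Lm n ≤ 0ℚ ⊎
        ∃ λ p → ∃ λ m → Prime p × 1 ℕ.≤ m × n ≡ p ℕ.* m × 𝟙 (¬? (coprime? n q)) * Lm n ≤ 𝟙 (p ∣? q) * (H p * χpow p m)
      cover n 1≤n = by (coprime? n q)
        where
        by : (c : Dec (Coprime n q)) → 𝟙 (¬? c) * Lm n ≤ 0ℚ ⊎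
          ∃ λ p → ∃ λ m → Prime p × 1 ℕ.≤ m × n ≡ p ℕ.* m × 𝟙 (¬? c) * Lm n ≤ 𝟙 (p ∣? q) * (H p * χpow p m)
        by (yes _) = inj₁ (≤-reflexive (ℚ.*-zeroˡ (Lm n)))
        by (no ¬c) with common-prime 1≤n ¬c
        ... | p , pp , divides m e , p∣q = inj₂ (p , m , pp , 1≤m , n≡ , ≤-reflexive (trans (ℚ.*-identityˡ (Lm n))
            (trans (trans (cong Lm n≡) (Λ-* T pp 1≤m)) (sym (𝟙*-yes (p ∣? q) p∣q (H p * χpow p m))))))
          where
          n≡ : n ≡ p ℕ.* m
          n≡ = trans e (ℕ.*-comm m p)
          1≤m : 1 ℕ.≤ m
          1≤m = ∣-pos (divides p n≡) 1≤n
      bound : ∀ d → 1 ℕ.≤ d → (pd : Dec (Prime d)) → 𝟙 pd * ((H d * inv d) * Σ (x // d) (λ m → 𝟙 (d ∣? q) * (χpow d m * inv m))) ≤ ι 2 * 𝟙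
          (d ∣? q)
      bound d 1≤d (no _) = ≤-trans (≤-reflexive (ℚ.*-zeroˡ ((H d * inv d) * Σ (x // d) (λ m → 𝟙 (d ∣? q) * (χpow d m * inv m)))))
        (0≤* (ι-≥0 2) (𝟙-≥0 (d ∣? q)))
      bound d 1≤d (yes pd) = ≤-trans (≤-reflexive (ℚ.*-identityˡ _)) (≤-trans (≤-reflexive (cong ((H d * inv d) *_) (Σ-*ˡ (x // d) (𝟙
          (d ∣? q)) (λ m → χpow d m * inv m))))
        (≤-trans (*-mono {H d * inv d} {1ℚ} {𝟙 (d ∣? q) * Σ (x // d) (λ m → χpow d m * inv m)} {𝟙 (d ∣? q) * ι 2} 0≤1
          (0≤* (𝟙-≥0 (d ∣? q)) (Σ-≥0 (x // d) λ m 1≤m _ → 0≤* (χpow-≥0 pd 1≤m) (inv-≥0 m))) (h-inv-≤1 1≤d) (*-monoʳ (𝟙-≥0 (d ∣? q))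
              (χpow-sum pd (x // d))))
        (≤-reflexive (lem (𝟙 (d ∣? q))))))
        where lem : ∀ a → 1ℚ * (a * ι 2) ≡ ι 2 * a
              lem = solve-∀ ℚring
      count : Σ x (λ d → 𝟙 (d ∣? q)) ≤ ι q
      -- x and q come in no fixed order, so both ranges are compared with q + x.
      count = ≤-trans (Σ-mono-range {x} {q ℕ.+ x} {λ d → 𝟙 (d ∣? q)} (ℕ.m≤n+m x q) λ d _ _ → 𝟙-≥0 (d ∣? q))
        (≤-trans (≤-reflexive (Σ-extend (ℕ.m≤m+n q x) λ d q<d _ → 𝟙-no (d ∣? q) (λ d∣q → ℕ.<⇒≱ q<d (∣-le d∣q 1≤q))))
        (≤-trans (Σ-mono q {g = λ _ → 1ℚ} λ d _ _ → 𝟙-≤1 (d ∣? q)) (≤-reflexive (trans (Σ-const q 1ℚ) (ℚ.*-identityʳ (ι q))))))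

  -- Sums against functions of bounded mean

  abel : ∀ x (f g : ℕ → ℚ) → Σ x (λ n → f n * g n) ≡ Σ x f * g (suc x) + Σ x (λ n → Σ n f * (g n - g (suc n)))
  abel zero    f g = sym (trans (cong (_+ 0ℚ) (ℚ.*-zeroˡ (g 1))) refl)
  abel (suc x) f g = trans (cong (_+ f (suc x) * g (suc x)) (abel x f g))
    (lem (Σ x f) (g (suc x)) (Σ x (λ n → Σ n f * (g n - g (suc n)))) (f (suc x)) (g (suc (suc x))))
    where lem : ∀ F g s f g' → (F * g + s) + f * g ≡ (F + f) * g' + (s + (F + f) * (g - g'))
          lem = solve-∀ ℚring

  -- Sums of f over initial segments of every progression d, 2d, 3d, … are bounded by K.
  Bounded : ℚ → (ℕ → ℚ) → Set
  Bounded K f = ∀ d n → 1 ℕ.≤ d → ∣ Σ n (λ m → f (d ℕ.* m)) ∣ ≤ K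

  Bounded-* : ∀ {K f} → Bounded K f → ∀ a → 1 ℕ.≤ a → Bounded K (λ n → f (a ℕ.* n))
  Bounded-* {K} {f} b a 1≤a d n 1≤d = subst (λ z → ∣ z ∣ ≤ K) (Σ-ext n λ m → cong f (ℕ.*-assoc a d m)) (b (a ℕ.* d) n (*-≥1 1≤a 1≤d))

  Bounded-Σ : ∀ {K f} → Bounded K f → ∀ n → ∣ Σ n f ∣ ≤ K
  Bounded-Σ {K} {f} b n = subst (λ z → ∣ z ∣ ≤ K) (Σ-ext n λ m → cong f (ℕ.*-identityˡ m)) (b 1 n ℕ.≤-refl)

  Bounded-val : ∀ {K f} → Bounded K f → ∀ n → 1 ℕ.≤ n → ∣ f n ∣ ≤ K
  Bounded-val {K} {f} b n 1≤n = subst (λ z → ∣ z ∣ ≤ K) (trans (ℚ.+-identityˡ (f (n ℕ.* 1))) (cong f (ℕ.*-identityʳ n))) (b n 1 1≤n)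

  Bounded-≥0 : ∀ {K f} → Bounded K f → 0ℚ ≤ K
  Bounded-≥0 b = b 1 0 ℕ.≤-refl

  abel-bound : ∀ {K} x (f g : ℕ → ℚ) → (∀ n → ∣ Σ n f ∣ ≤ K) →
    ∣ Σ x (λ n → f n * g n) ∣ ≤ K * ∣ g (suc x) ∣ + K * Σ x (λ n → ∣ g n - g (suc n) ∣)
  abel-bound {K} x f g b = subst₂ (λ u v → ∣ u ∣ ≤ K * ∣ g (suc x) ∣ + v) (sym (abel x f g)) (Σ-*ˡ x K (λ n → ∣ g n - g (suc n) ∣))
    (∣∣-tri {Σ x f * g (suc x)} (∣∣-* {Σ x f} {g (suc x)} (b x) ≤-refl)
      (Σ-abs x λ n _ _ → ∣∣-* {Σ n f} {g n - g (suc n)} (b n) ≤-refl))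

  -- For decreasing non-negative g the variation telescopes, so only the value at the start of the
  -- tail is left.
  abel-tail : ∀ {K y z} (f g : ℕ → ℚ) → (∀ n → ∣ Σ n f ∣ ≤ K) → (∀ n → 0ℚ ≤ g n) → (∀ n → 1 ℕ.≤ n → g (suc n) ≤ g n) → y ℕ.≤ z →
    ∣ Σ z (λ n → f n * g n) - Σ y (λ n → f n * g n) ∣ ≤ K * (ι 2 * g (suc y))
  abel-tail {K} {y} {z} f g b g≥0 anti y≤z = subst (λ w → ∣ w ∣ ≤ K * (ι 2 * g (suc y))) (sym eq)
    (≤-trans (∣∣-tri {Σ z f * g (suc z) - Σ y f * g (suc y)} {Σ k V}
       (∣∣-tri- {Σ z f * g (suc z)} {Σ y f * g (suc y)}
         (∣∣-* {Σ z f} {g (suc z)} (b z) (∣∣-nonneg (g≥0 (suc z)))) (∣∣-* {Σ y f} {g (suc y)} (b y) (∣∣-nonneg (g≥0 (suc y)))))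
       (Σ-abs k {V} {λ i → K * (g (y ℕ.+ i) - g (suc (y ℕ.+ i)))} vbound))
     (≤-reflexive (trans (cong ((K * g (suc z) + K * g (suc y)) +_) tele) (lem₂ K (g (suc z)) (g (suc y))))))
    where
    k = z ℕ.∸ y
    V : ℕ → ℚ
    V i = Σ (y ℕ.+ i) f * (g (y ℕ.+ i) - g (suc (y ℕ.+ i)))
    lem : ∀ a b c d → (a + (c + d)) - (b + c) ≡ (a - b) + d
    lem = solve-∀ ℚring
    lem₂ : ∀ K a b → (K * a + K * b) + K * (b - a) ≡ K * (ι 2 * b)
    lem₂ = solve-∀ ℚring
    eq : Σ z (λ n → f n * g n) - Σ y (λ n → f n * g n) ≡ (Σ z f * g (suc z) - Σ y f * g (suc y)) + Σ k V
    eq = trans (cong₂ _-_ (trans (abel z f g) (cong (Σ z f * g (suc z) +_) (Σ-tail (λ n → Σ n f * (g n - g (suc n))) y≤z))) (abel y f g))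
      (lem (Σ z f * g (suc z)) (Σ y f * g (suc y)) (Σ y (λ n → Σ n f * (g n - g (suc n)))) (Σ k V))
    vbound : ∀ i → 1 ℕ.≤ i → i ℕ.≤ k → ∣ V i ∣ ≤ K * (g (y ℕ.+ i) - g (suc (y ℕ.+ i)))
    vbound i 1≤i _ = ∣∣-* {Σ (y ℕ.+ i) f} (b (y ℕ.+ i)) (∣∣-nonneg (0≤-diff (anti (y ℕ.+ i) (ℕ.≤-trans 1≤i (ℕ.m≤n+m i y)))))
    telescope : ∀ k → Σ k (λ i → g (y ℕ.+ i) - g (suc (y ℕ.+ i))) ≡ g (suc y) - g (suc (y ℕ.+ k))
    telescope zero    = sym (trans (cong (λ w → g (suc y) - g (suc w)) (ℕ.+-identityʳ y)) (ℚ.+-inverseʳ (g (suc y))))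
    telescope (suc k) = trans (cong₂ _+_ (telescope k) (cong (λ w → g w - g (suc w)) (ℕ.+-suc y k)))
      (trans (l (g (suc y)) (g (suc (y ℕ.+ k))) (g (suc (suc (y ℕ.+ k))))) (cong (λ w → g (suc y) - g (suc w)) (sym (ℕ.+-suc y k))))
      where l : ∀ a b c → (a - b) + (b - c) ≡ a - c
            l = solve-∀ ℚring
    tele : Σ k (λ i → K * (g (y ℕ.+ i) - g (suc (y ℕ.+ i)))) ≡ K * (g (suc y) - g (suc z))
    tele = trans (Σ-*ˡ k K (λ i → g (y ℕ.+ i) - g (suc (y ℕ.+ i)))) (cong (K *_) (trans (telescope k) (cong (λ w → g (suc y) - g (suc w))
        (ℕ.m+[n∸m]≡n y≤z))))

  -- Truncated L-series and the relation between two scales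

  module _ (T : ℕ) (1≤T : 1 ℕ.≤ T) (Z : ℕ) where

    private
      H L Lm : ℕ → ℚ
      H  = h T
      L  = ℓ T
      Lm = Λ T

    -- The truncation at Z, beyond all scales in use, plays the role of L(1, f).
    Lser : (ℕ → ℚ) → ℚ
    Lser f = Σ Z (λ m → f m * inv m)

    -- Truncating at ⌊x/d⌋ instead of Z costs 2K/(⌊x/d⌋ + 1) ≤ 2K d/x; the factor d cancels the 1/d
    -- of the outer sums.
    Lser-tail : ∀ {K f x d} → Bounded K f → 1 ℕ.≤ d → 1 ℕ.≤ x → x ℕ.≤ Z →
      ∣ Σ (x // d) (λ m → f (d ℕ.* m) * inv m) - Lser (λ n → f (d ℕ.* n)) ∣ ≤ (K * ι 2) * (ι d * inv x)
    Lser-tail {K} {f} {x} {d} b 1≤d 1≤x x≤Z = subst (_≤ (K * ι 2) * (ι d * inv x))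
      (trans (sym (ℚ.∣-p∣≡∣p∣ (B - A))) (cong ∣_∣ (lem A B)))
      (≤-trans (abel-tail (λ m → f (d ℕ.* m)) inv (λ n → b d n 1≤d) inv-≥0 (λ n 1≤n → inv-anti 1≤n (ℕ.n≤1+n n)) (ℕ.≤-trans (//-≤ x d) x≤Z))
        (≤-trans (≤-reflexive (sym (ℚ.*-assoc K (ι 2) (inv (suc (x // d)))))) (*-monoʳ (0≤* (Bounded-≥0 {K} {f} b) (ι-≥0 2))
            (inv-suc-// 1≤x 1≤d))))
      where
      A B : ℚ
      A = Σ (x // d) (λ m → f (d ℕ.* m) * inv m)
      B = Lser (λ n → f (d ℕ.* n))
      lem : ∀ a b → - (b - a) ≡ a - b
      lem = solve-∀ ℚring

    -- The sum of f(n) ℓ(n)/n is evaluated twice. Partial summation bounds it by 4K; inserting `D-Λ`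
    -- turns it into the sum over d, up to tails 2K d/x that, weighted by Λ(d)/d, amount to at most
    -- 36K by `chebyshev`.
    Lser-Λ : ∀ {K f x} → Bounded K f → 1 ℕ.≤ x → suc x ℕ.≤ T → x ℕ.≤ Z →
      ∣ Σ x (λ d → (Λ T d * inv d) * Lser (λ n → f (d ℕ.* n))) ∣ ≤ K * ι 40
    Lser-Λ {K} {f} {x} b 1≤x x<T x≤Z = subst (λ z → ∣ z ∣ ≤ K * ι 40) (lem S₁ X)
      (≤-trans (∣∣-tri- {S₁} {S₁ - X} S₁-bound diff) (≤-reflexive (lem₂ K)))
      where
      K≥0 = Bounded-≥0 {K} {f} b
      S₁ X : ℚ
      S₁ = Σ x (λ n → f n * (inv n * L n))
      X = Σ x (λ d → (Lm d * inv d) * Lser (λ n → f (d ℕ.* n)))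
      lem : ∀ s x → s - (s - x) ≡ x
      lem = solve-∀ ℚring
      lem₂ : ∀ K → ((K * 1ℚ + K * ι 2) + K * 1ℚ) + K * ι 36 ≡ K * ι 40
      lem₂ = solve-∀ ℚring
      S₁-hyp : S₁ ≡ Σ x (λ d → (Lm d * inv d) * Σ (x // d) (λ m → f (d ℕ.* m) * inv m))
      S₁-hyp = trans (Σ-cong x λ n 1≤n _ → trans (cong (λ z → f n * (inv n * z)) (sym (D-Λ T 1≤n)))
          (trans (sym (ℚ.*-assoc (f n) (inv n) (D n Lm))) (sym (D-*ˡ n (f n * inv n) Lm))))
        (trans (hyperbola x (λ d n → (f n * inv n) * Lm d)) (Σ-ext x λ d → trans (Σ-ext (x // d) λ m →
          trans (cong (λ z → (f (d ℕ.* m) * z) * Lm d) (inv-* d m)) (l (f (d ℕ.* m)) (inv d) (inv m) (Lm d)))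
          (Σ-*ˡ (x // d) (Lm d * inv d) (λ m → f (d ℕ.* m) * inv m))))
        where l : ∀ a b c e → (a * (b * c)) * e ≡ (e * b) * (a * c)
              l = solve-∀ ℚring
      diff : ∣ S₁ - X ∣ ≤ K * ι 36
      diff = subst (λ z → ∣ z ∣ ≤ K * ι 36) (sym (trans (cong (_- X) S₁-hyp) (trans (sym (Σ-diff x _ _)) (Σ-ext x λ d → l (Lm d * inv d)
          _ _))))
        (≤-trans (Σ-abs x {g = λ d → ((K * ι 2) * inv x) * Lm d} λ d 1≤d _ → ≤-trans (∣∣-* {Lm d * inv d} (∣∣-nonneg (0≤* (Λ-≥0 T 1≤T 1≤d)
            (inv-≥0 d))) (Lser-tail {K} {f} {x} {d} b 1≤d 1≤x x≤Z))
            (≤-reflexive (trans (l₂ (Lm d) (inv d) (K * ι 2) (ι d) (inv x)) (trans (cong (_* (((K * ι 2) * inv x) * Lm d)) (ι*inv 1≤d))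
                (ℚ.*-identityˡ _)))))
          (≤-trans (≤-reflexive (Σ-*ˡ x ((K * ι 2) * inv x) Lm)) (≤-trans (*-monoʳ (0≤* (0≤* K≥0 (ι-≥0 2)) (inv-≥0 x)) (≤-trans
              (chebyshev T 1≤T x x<T) (≤-reflexive (ι-* 18 x))))
            (≤-reflexive (trans (l₃ K (inv x) (ι x)) (trans (cong (_* (K * ι 36)) (ι*inv 1≤x)) (ℚ.*-identityˡ (K * ι 36))))))))
        where
        l : ∀ a b c → a * b - a * c ≡ a * (b - c)
        l = solve-∀ ℚring
        l₂ : ∀ a b c e f → (a * b) * (c * (e * f)) ≡ (e * b) * ((c * f) * a)
        l₂ = solve-∀ ℚring
        l₃ : ∀ K i x → ((K * ι 2) * i) * (ι 18 * x) ≡ (x * i) * (K * ι 36)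
        l₃ = solve-∀ ℚring
      S₁-bound : ∣ S₁ ∣ ≤ (K * 1ℚ + K * ι 2) + K * 1ℚ
      S₁-bound = subst (λ z → ∣ z ∣ ≤ (K * 1ℚ + K * ι 2) + K * 1ℚ) (sym (trans (Σ-ext x λ n → l (f n) (inv n) (L n) (H n)) (Σ-diff x _ _)))
        (∣∣-tri- {Σ x (λ n → f n * (H n * inv n))} {Σ x (λ n → (f n * inv n) * (H n - L n))}
          (≤-trans (abel-bound x f (λ n → H n * inv n) (Bounded-Σ {K} {f} b))
            (+-mono-≤ (*-monoʳ K≥0 (≤-trans (∣∣-nonneg (0≤* (h-≥0 T 1≤T {suc x} z<s) (inv-≥0 (suc x)))) (h-inv-≤1 T 1≤T {suc x} z<s)))
                (*-monoʳ K≥0 (h-inv-variation T 1≤T x))))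
          (≤-trans (Σ-abs x {g = λ _ → K * inv T} λ n 1≤n n≤x → small n 1≤n) (≤-trans (≤-reflexive (trans (Σ-const x (K * inv T)) (l₂ (ι x)
              K (inv T))))
            (*-monoʳ K≥0 (ι-cancel′ {1} {T} {x} 1≤T (ℕ.≤-trans (ℕ.<⇒≤ x<T) (ℕ.≤-reflexive (sym (ℕ.*-identityˡ T)))))))))
        where
        l : ∀ a b c e → a * (b * c) ≡ a * (e * b) - (a * b) * (e - c)
        l = solve-∀ ℚring
        l₂ : ∀ a b c → a * (b * c) ≡ b * (a * c)
        l₂ = solve-∀ ℚring
        gap : ∀ n → 1 ℕ.≤ n → H n - L n ≤ ι n * inv T
        gap n 1≤n = ≤-by (L n + ι n * inv T - H n) (0≤-diff (h-≤-ℓ T 1≤T 1≤n)) (l₄ (H n) (L n) (ι n * inv T))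
          where l₄ : ∀ a b c → c ≡ (a - b) + (b + c - a)
                l₄ = solve-∀ ℚring
        small : ∀ n → 1 ℕ.≤ n → ∣ (f n * inv n) * (H n - L n) ∣ ≤ K * inv T
        small n 1≤n = ≤-trans (∣∣-* {f n * inv n} (∣∣-* {f n} (Bounded-val {K} {f} b n 1≤n) (∣∣-nonneg (inv-≥0 n)))
            (≤-trans (∣∣-nonneg (ℓ-gap-≥0 T 1≤T 1≤n ℕ.≤-refl)) (gap n 1≤n)))
          (≤-reflexive (trans (l₅ K (inv n) (ι n) (inv T)) (trans (cong (_* (K * inv T)) (ι*inv 1≤n)) (ℚ.*-identityˡ (K * inv T)))))
          where l₅ : ∀ K i n t → (K * i) * (n * t) ≡ (n * i) * (K * t)
                l₅ = solve-∀ ℚring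

    private
      coef : ℕ → ℕ → ℚ
      coef x d = (μ d * (H x - L d)) * inv d

    -- `D-μ-gap` with C = h(x), summed against f(n)/n. The weights h(x) - ℓ(d) total at most 2x, so
    -- the tails 2K d/x cost 4K altogether.
    Lser-μ : ∀ {K f x} → Bounded K f → 1 ℕ.≤ x → x ℕ.≤ T → x ℕ.≤ Z →
      ∣ (h T x * f 1 + Σ x (λ n → (Λ T n * inv n) * f n)) - Σ x (λ d → coef x d * Lser (λ n → f (d ℕ.* n))) ∣ ≤ K * ι 4
    Lser-μ {K} {f} {x} b 1≤x x≤T x≤Z = subst (λ z → ∣ z ∣ ≤ K * ι 4) (sym (trans (cong (_- X) expand) (trans (sym (Σ-diff x _ _))
        (Σ-ext x λ d → l (coef x d) _ _))))
      (≤-trans (Σ-abs x {g = λ d → ((K * ι 2) * inv x) * (H x - L d)} λ d 1≤d d≤x →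
          ≤-trans (∣∣-* {coef x d} (∣∣-* {μ d * (H x - L d)} (∣∣-* {μ d} (μ-abs d) (∣∣-nonneg (ℓ-gap-≥0 T 1≤T 1≤d d≤x))) (∣∣-nonneg
              (inv-≥0 d))) (Lser-tail {K} {f} {x} {d} b 1≤d 1≤x x≤Z))
            (≤-reflexive (trans (l₂ (H x - L d) (inv d) (K * ι 2) (ι d) (inv x)) (trans (cong (_* (((K * ι 2) * inv x) * (H x - L d)))
                (ι*inv 1≤d)) (ℚ.*-identityˡ _)))))
        (≤-trans (≤-reflexive (Σ-*ˡ x ((K * ι 2) * inv x) (λ d → H x - L d))) (≤-trans (*-monoʳ (0≤* (0≤* K≥0 (ι-≥0 2)) (inv-≥0 x))
            (Σ-ℓ-gap T 1≤T x≤T))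
            (≤-reflexive (trans (l₃ K (inv x) (ι x)) (trans (cong (_* (K * ι 4)) (ι*inv 1≤x)) (ℚ.*-identityˡ (K * ι 4))))))))
      where
      K≥0 = Bounded-≥0 {K} {f} b
      X = Σ x (λ d → coef x d * Lser (λ n → f (d ℕ.* n)))
      l : ∀ a b c → a * b - a * c ≡ a * (b - c)
      l = solve-∀ ℚring
      l₂ : ∀ a b c e f → ((1ℚ * a) * b) * (c * (e * f)) ≡ (e * b) * ((c * f) * a)
      l₂ = solve-∀ ℚring
      l₃ : ∀ K i x → ((K * ι 2) * i) * (x + x) ≡ (x * i) * (K * ι 4)
      l₃ = solve-∀ ℚring
      at-one : Σ x (λ n → (f n * inv n) * (H x * 𝟙 (n ℕ.≟ 1))) ≡ H x * f 1
      at-one = trans (Σ-single x 1 {λ n → (f n * inv n) * (H x * 𝟙 (n ℕ.≟ 1))} z<s 1≤x λ i _ _ i≢1 →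
          trans (cong (λ z → (f i * inv i) * (H x * z)) (𝟙-no (i ℕ.≟ 1) i≢1)) (z₀ (f i * inv i) (H x)))
        (z₁ (f 1) (H x))
        where z₀ : ∀ a b → a * (b * 0ℚ) ≡ 0ℚ
              z₀ = solve-∀ ℚring
              z₁ : ∀ a b → (a * 1ℚ) * (b * 1ℚ) ≡ b * a
              z₁ = solve-∀ ℚring
      expand : H x * f 1 + Σ x (λ n → (Lm n * inv n) * f n) ≡ Σ x (λ d → coef x d * Σ (x // d) (λ m → f (d ℕ.* m) * inv m))
      expand = trans (cong₂ _+_ (sym at-one) (Σ-ext x λ n → e₁ (Lm n) (inv n) (f n)))
        (trans (sym (Σ-+ x _ _))
        (trans (Σ-cong x λ n 1≤n _ → trans (sym (ℚ.*-distribˡ-+ (f n * inv n) (H x * 𝟙 (n ℕ.≟ 1)) (Lm n)))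
           (trans (cong ((f n * inv n) *_) (sym (D-μ-gap T 1≤n (H x)))) (sym (D-*ˡ n (f n * inv n) (λ d → μ d * (H x - L d))))))
        (trans (hyperbola x (λ d n → (f n * inv n) * (μ d * (H x - L d)))) (Σ-ext x λ d → trans (Σ-ext (x // d) λ m →
          trans (cong (λ z → (f (d ℕ.* m) * z) * (μ d * (H x - L d))) (inv-* d m)) (e₂ (f (d ℕ.* m)) (inv d) (inv m) (μ d * (H x - L d))))
          (Σ-*ˡ (x // d) (coef x d) (λ m → f (d ℕ.* m) * inv m))))))
        where
        e₁ : ∀ a b c → (a * b) * c ≡ (c * b) * a
        e₁ = solve-∀ ℚring
        e₂ : ∀ a b c e → (a * (b * c)) * e ≡ (e * b) * (a * c)
        e₂ = solve-∀ ℚring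

    -- The quadratic relation P(y) (log x + P(x)) ≈ 0 between two scales, tested against f; L(1, ·) has been eliminated.
    two-scales : ∀ {K f x y} → Bounded K f → 1 ℕ.≤ x → x ℕ.≤ T → x ℕ.≤ Z → 1 ℕ.≤ y → suc y ℕ.≤ T → y ℕ.≤ Z →
      ∣ h T x * Σ y (λ m → (Λ T m * inv m) * f m) + Σ y (λ m → (Λ T m * inv m) * Σ x (λ n → (Λ T n * inv n) * f (m ℕ.* n))) ∣
        ≤ K * (ι 4 * M T 1≤T y + ι 80 * ι x)
    two-scales {K} {f} {x} {y} b 1≤x x≤T x≤Z 1≤y y<T y≤Z = subst₂ (λ u v → ∣ u ∣ ≤ v) combine (l₀ K (M T 1≤T y) (ι x))
        (∣∣-tri {Σ y (λ m → W m * (A m - B m))} {Σ x (λ d → coef x d * Σ y (λ m → W m * Lser (λ n → f (d ℕ.* (m ℕ.* n)))))} part₁ part₂)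
      where
      K≥0 = Bounded-≥0 {K} {f} b
      W A B : ℕ → ℚ
      W m = Lm m * inv m
      A m = H x * f (m ℕ.* 1) + Σ x (λ n → W n * f (m ℕ.* n))
      B m = Σ x (λ d → coef x d * Lser (λ n → f (m ℕ.* (d ℕ.* n))))
      l₀ : ∀ K M x → M * (K * ι 4) + (x + x) * (K * ι 40) ≡ K * (ι 4 * M + ι 80 * x)
      l₀ = solve-∀ ℚring
      part₁ : ∣ Σ y (λ m → W m * (A m - B m)) ∣ ≤ M T 1≤T y * (K * ι 4)
      part₁ = ≤-trans (Σ-abs y {g = λ m → W m * (K * ι 4)} λ m 1≤m _ → ∣∣-* {W m} (∣∣-nonneg (0≤* (Λ-≥0 T 1≤T 1≤m) (inv-≥0 m)))
          (Lser-μ {K} {λ n → f (m ℕ.* n)} {x} (Bounded-* {K} {f} b m 1≤m) 1≤x x≤T x≤Z))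
        (≤-reflexive (Σ-*ʳ y (K * ι 4) W))
      -- By commutativity the L-terms of all m regroup (`swap`) into sums that `Lser-Λ` bounds at
      -- scale y. Bounding the coefficients without their factor 1/d costs a factor of order x,
      -- harmless once divided by h(y).
      part₂ : ∣ Σ x (λ d → coef x d * Σ y (λ m → W m * Lser (λ n → f (d ℕ.* (m ℕ.* n))))) ∣ ≤ (ι x + ι x) * (K * ι 40)
      part₂ = ≤-trans (Σ-abs x {g = λ d → (H x - L d) * (K * ι 40)} λ d 1≤d d≤x → ∣∣-* {coef x d} (coef-bound d 1≤d d≤x)
          (Lser-Λ {K} {λ n → f (d ℕ.* n)} {y} (Bounded-* {K} {f} b d 1≤d) 1≤y y<T y≤Z))
        (≤-trans (≤-reflexive (Σ-*ʳ x (K * ι 40) (λ d → H x - L d))) (*-monoˡ (0≤* K≥0 (ι-≥0 40)) (Σ-ℓ-gap T 1≤T x≤T)))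
        where
        coef-bound : ∀ d → 1 ℕ.≤ d → d ℕ.≤ x → ∣ coef x d ∣ ≤ H x - L d
        coef-bound d 1≤d d≤x = ≤-trans (∣∣-* {μ d * (H x - L d)} (∣∣-* {μ d} (μ-abs d) (∣∣-nonneg (ℓ-gap-≥0 T 1≤T 1≤d d≤x))) (≤-trans
            (∣∣-nonneg (inv-≥0 d)) (inv≤1 d)))
          (≤-reflexive (trans (ℚ.*-identityʳ (1ℚ * (H x - L d))) (ℚ.*-identityˡ (H x - L d))))
      swap : Σ x (λ d → coef x d * Σ y (λ m → W m * Lser (λ n → f (d ℕ.* (m ℕ.* n))))) ≡ Σ y (λ m → W m * B m)
      swap = trans (Σ-ext x λ d → trans (sym (Σ-*ˡ y (coef x d) _)) (Σ-ext y λ m → trans (l₁ (coef x d) (W m) _)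
          (cong (λ z → W m * (coef x d * z)) (Σ-ext Z λ n → cong (λ z → f z * inv n) (assoc d m n)))))
        (trans (Σ-swap x y (λ d m → W m * (coef x d * Lser (λ n → f (m ℕ.* (d ℕ.* n)))))) (Σ-ext y λ m → Σ-*ˡ x (W m) _))
        where
        l₁ : ∀ a b c → a * (b * c) ≡ b * (a * c)
        l₁ = solve-∀ ℚring
        assoc : ∀ d m n → d ℕ.* (m ℕ.* n) ≡ m ℕ.* (d ℕ.* n)
        assoc d m n = trans (sym (ℕ.*-assoc d m n)) (trans (cong (ℕ._* n) (ℕ.*-comm d m)) (ℕ.*-assoc m d n))
      combine : Σ y (λ m → W m * (A m - B m)) + Σ x (λ d → coef x d * Σ y (λ m → W m * Lser (λ n → f (d ℕ.* (m ℕ.* n)))))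
        ≡ H x * Σ y (λ m → W m * f m) + Σ y (λ m → W m * Σ x (λ n → W n * f (m ℕ.* n)))
      combine = trans (cong (Σ y (λ m → W m * (A m - B m)) +_) swap) (trans (sym (Σ-+ y (λ m → W m * (A m - B m)) (λ m → W m * B m)))
        (trans (Σ-ext y λ m → trans (cong (λ z → W m * ((H x * f z + Σ x (λ n → W n * f (m ℕ.* n))) - B m) + W m * B m) (ℕ.*-identityʳ m))
          (l₂ (W m) (H x) (f m) (Σ x (λ n → W n * f (m ℕ.* n))) (B m)))
        (trans (Σ-+ y (λ m → H x * (W m * f m)) (λ m → W m * Σ x (λ n → W n * f (m ℕ.* n))))
          (cong (_+ Σ y (λ m → W m * Σ x (λ n → W n * f (m ℕ.* n)))) (Σ-*ˡ y (H x) (λ m → W m * f m))))))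
        where l₂ : ∀ w h f s b → w * ((h * f + s) - b) + w * b ≡ h * (w * f) + w * s
              l₂ = solve-∀ ℚring

  -- Residue classes

  coprime-*ˡ : ∀ {a b q} → Coprime (a ℕ.* b) q → Coprime a q
  coprime-*ˡ {b = b} c (k∣a , k∣q) = c (Div.∣m⇒∣m*n b k∣a , k∣q)

  coprime-*ʳ : ∀ {a b q} → Coprime (a ℕ.* b) q → Coprime b q
  coprime-*ʳ {a} c (k∣b , k∣q) = c (Div.∣n⇒∣m*n a k∣b , k∣q)

  coprime-* : ∀ {a b q} → Coprime a q → Coprime b q → Coprime (a ℕ.* b) q
  coprime-* {a} {b} ca cb {k} (k∣ab , k∣q) = cb (Coprimality.coprime-divisor {k} {a} {b} (λ (j∣k , j∣a) → ca (j∣a , Div.∣-trans j∣k k∣q))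
      k∣ab , k∣q)

  Σ-periodic₀ : ∀ q (F : ℕ → ℚ) → (∀ n → F (q ℕ.+ n) ≡ F n) → Σ q F ≡ 0ℚ → ∀ k t → Σ (k ℕ.* q ℕ.+ t) F ≡ Σ t F
  Σ-periodic₀ q F per z zero    t = refl
  Σ-periodic₀ q F per z (suc k) t = trans (cong (λ n → Σ n F) (ℕ.+-assoc q (k ℕ.* q) t)) (trans (Σ-append q (k ℕ.* q ℕ.+ t) F)
    (trans (cong₂ _+_ z (trans (Σ-ext (k ℕ.* q ℕ.+ t) per) (Σ-periodic₀ q F per z k t))) (ℚ.+-identityˡ (Σ t F))))

  Σ-periodic-bound : ∀ {q c} → 1 ℕ.≤ q → 0ℚ ≤ c → (F : ℕ → ℚ) → (∀ n → F (q ℕ.+ n) ≡ F n) → Σ q F ≡ 0ℚ → (∀ n → ∣ F n ∣ ≤ c) →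
    ∀ n → ∣ Σ n F ∣ ≤ ι q * c
  Σ-periodic-bound {q} {c} 1≤q 0≤c F per z bound n with //-split n 1≤q
  ... | t , t<q , e = subst (λ w → ∣ w ∣ ≤ ι q * c) (sym (trans (cong (λ k → Σ k F) e) (Σ-periodic₀ q F per z (n // q) t)))
    (≤-trans (Σ-abs t {g = λ _ → c} λ i _ _ → bound i) (≤-trans (≤-reflexive (Σ-const t c)) (*-monoˡ 0≤c (ι-mono (ℕ.<⇒≤ t<q)))))

  module _ (q : ℕ) .{{q≢0 : NonZero q}} where

    1≤modulus : 1 ℕ.≤ q
    1≤modulus = ℕ.>-nonZero⁻¹ q

    _≈?_ : (m n : ℕ) → Dec (m % q ≡ n % q)
    m ≈? n = m % q ℕ.≟ n % q

    Periodic : (ℕ → ℚ) → Set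
    Periodic F = ∀ m n → m % q ≡ n % q → F m ≡ F n

    ≈-* : ∀ {a b c d} → a % q ≡ b % q → c % q ≡ d % q → (a ℕ.* c) % q ≡ (b ℕ.* d) % q
    ≈-* {a} {b} {c} {d} e f = trans (DM.%-distribˡ-* a c q) (trans (cong₂ (λ x y → (x ℕ.* y) % q) e f) (sym (DM.%-distribˡ-* b d q)))

    coprime-≈ : ∀ {m n} → m % q ≡ n % q → Coprime m q → Coprime n q
    coprime-≈ {m} {n} e c (k∣n , k∣q) = c (Div.∣n∣m%n⇒∣m k∣q (subst (_ ∣_) (sym e) (Div.%-presˡ-∣ k∣n k∣q)) , k∣q)

    -- Residues are represented in 1, ..., q, the range of `Σ`, so the class of 0 is represented by
    -- q.
    rep : ℕ → ℕ
    rep n with n % q ℕ.≟ 0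
    ... | yes _ = q
    ... | no _  = n % q

    1≤rep : ∀ n → 1 ℕ.≤ rep n
    1≤rep n with n % q ℕ.≟ 0
    ... | yes _ = 1≤modulus
    ... | no ≢0 = ℕ.n≢0⇒n>0 ≢0

    rep≤ : ∀ n → rep n ℕ.≤ q
    rep≤ n with n % q ℕ.≟ 0
    ... | yes _ = ℕ.≤-refl
    ... | no _  = DM.m%n≤n n q

    rep-≈ : ∀ n → n % q ≡ rep n % q
    rep-≈ n with n % q ℕ.≟ 0
    ... | yes e = trans e (sym (DM.n%n≡0 q))
    ... | no _  = sym (DM.m%n%n≡m%n n q)

    rep-unique : ∀ n r → 1 ℕ.≤ r → r ℕ.≤ q → n % q ≡ r % q → r ≡ rep n
    rep-unique n r 1≤r r≤q e with n % q ℕ.≟ 0 | ℕ.m≤n⇒m<n∨m≡n r≤q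
    ... | yes z | inj₁ r<q = contradiction (trans (sym (DM.m<n⇒m%n≡m r<q)) (trans (sym e) z)) (ℕ.>⇒≢ 1≤r)
    ... | yes _ | inj₂ r≡q = r≡q
    ... | no _  | inj₁ r<q = sym (trans e (DM.m<n⇒m%n≡m r<q))
    ... | no ≢0 | inj₂ refl = contradiction (trans e (DM.n%n≡0 q)) ≢0

    Σ-class : ∀ {F} → Periodic F → ∀ n → Σ q (λ r → 𝟙 (n ≈? r) * F r) ≡ F n
    Σ-class {F} per n = trans (Σ-single q (rep n) {λ r → 𝟙 (n ≈? r) * F r} (1≤rep n) (rep≤ n) λ r 1≤r r≤q r≢ → 𝟙*-no (n ≈? r) (λ e → r≢
        (rep-unique n r 1≤r r≤q e)) (F r))
      (trans (𝟙*-yes (n ≈? rep n) (rep-≈ n) (F (rep n))) (per (rep n) n (sym (rep-≈ n))))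

    classSum : ℕ → (ℕ → ℚ) → ℕ → ℚ
    classSum x w g = Σ x (λ n → 𝟙 (n ≈? g) * w n)

    classSum-periodic : ∀ x w → Periodic (classSum x w)
    classSum-periodic x w m n e = Σ-ext x λ k → cong (_* w k) (𝟙-cong (k ≈? m) (k ≈? n) (λ f → trans f e) (λ f → trans f (sym e)))

    Σ-by-class : ∀ {F} → Periodic F → ∀ x (w : ℕ → ℚ) → Σ x (λ n → w n * F n) ≡ Σ q (λ r → classSum x w r * F r)
    Σ-by-class {F} per x w = trans (Σ-ext x λ n → trans (cong (w n *_) (sym (Σ-class per n))) (sym (Σ-*ˡ q (w n) (λ r → 𝟙 (n ≈? r) * F r))))
      (trans (Σ-swap x q (λ n r → w n * (𝟙 (n ≈? r) * F r))) (Σ-ext q λ r → trans (Σ-ext x λ n → lem (w n) (𝟙 (n ≈? r)) (F r)) (Σ-*ʳ x (F r)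
          (λ n → 𝟙 (n ≈? r) * w n))))
      where lem : ∀ a b c → a * (b * c) ≡ (b * a) * c
            lem = solve-∀ ℚring

    unit : ℕ → ℚ
    unit n = 𝟙 (coprime? n q)

    unit-yes : ∀ {n} → Coprime n q → unit n ≡ 1ℚ
    unit-yes {n} c = 𝟙-yes (coprime? n q) c

    unit-no : ∀ {n} → ¬ Coprime n q → unit n ≡ 0ℚ
    unit-no {n} ¬c = 𝟙-no (coprime? n q) ¬c

    unit-periodic : Periodic unit
    unit-periodic m n e = 𝟙-cong (coprime? m q) (coprime? n q) (λ c {k} → coprime-≈ {m} {n} e c {k}) (λ c {k} → coprime-≈ {n} {m} (sym e)
        c {k})

    unit-* : ∀ m n → unit (m ℕ.* n) ≡ unit m * unit n
    unit-* m n = go (coprime? m q) (coprime? n q)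
      where
      go : (c : Dec (Coprime m q)) (d : Dec (Coprime n q)) → unit (m ℕ.* n) ≡ 𝟙 c * 𝟙 d
      go (yes c) (yes d) = unit-yes {m ℕ.* n} (λ {k} → coprime-* {m} {n} c d {k})
      go (yes c) (no ¬d) = unit-no {m ℕ.* n} (λ e → ¬d (λ {k} → coprime-*ʳ {m} {n} e {k}))
      go (no ¬c) (yes _) = unit-no {m ℕ.* n} (λ e → ¬c (λ {k} → coprime-*ˡ {m} {n} e {k}))
      go (no ¬c) (no _)  = unit-no {m ℕ.* n} (λ e → ¬c (λ {k} → coprime-*ˡ {m} {n} e {k}))

    coprime-1 : Coprime 1 q
    coprime-1 (k∣1 , _) = Div.∣1⇒≡1 k∣1

    inverse : ∀ {a} → Coprime a q → ∃ λ a′ → Coprime a′ q × (a′ ℕ.* a) % q ≡ 1 % q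
    inverse {a} c = let a′ , e = go (Coprimality.coprime-Bézout c) in
      a′ , (λ {k} → coprime-*ˡ {a′} {a} (λ {j} → coprime-≈ {1} {a′ ℕ.* a} (sym e) (λ {i} → coprime-1 {i}) {j}) {k}) , e
      where
      k = ℕ.pred q
      q≡ : suc k ≡ q
      q≡ = ℕ.suc-pred q
      go : GCD.Bézout.Identity 1 a q → ∃ λ a′ → (a′ ℕ.* a) % q ≡ 1 % q
      go (GCD.Bézout.Identity.+- x y e) = x , trans (cong (_% q) (sym e)) (DM.[m+kn]%n≡m%n 1 y q)
      -- Here 1 + x a = y q, so -x inverts a; k = q - 1 stands for -1.
      go (GCD.Bézout.Identity.-+ x y e) = k ℕ.* x , trans (sym (DM.[m+n]%n≡m%n (k ℕ.* x ℕ.* a) q)) (trans (cong (_% q) eq)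
          (DM.[m+kn]%n≡m%n 1 (k ℕ.* y) q))
        where
        open ≡-Reasoning
        eq : k ℕ.* x ℕ.* a ℕ.+ q ≡ 1 ℕ.+ k ℕ.* y ℕ.* q
        eq = begin
          k ℕ.* x ℕ.* a ℕ.+ q ≡⟨ cong₂ ℕ._+_ (ℕ.*-assoc k x a) (sym q≡) ⟩
          k ℕ.* (x ℕ.* a) ℕ.+ suc k ≡⟨ ℕ.+-suc _ k ⟩
          suc (k ℕ.* (x ℕ.* a) ℕ.+ k) ≡⟨ cong suc (trans (ℕ.+-comm _ k) (sym (ℕ.*-suc k (x ℕ.* a)))) ⟩
          suc (k ℕ.* suc (x ℕ.* a)) ≡⟨ cong (λ z → suc (k ℕ.* z)) e ⟩
          suc (k ℕ.* (y ℕ.* q)) ≡⟨ cong suc (sym (ℕ.*-assoc k y q)) ⟩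
          1 ℕ.+ k ℕ.* y ℕ.* q ∎

    divide : ∀ {a g} → Coprime a q → Coprime g q → ∃ λ k → Coprime k q × (a ℕ.* k) % q ≡ g % q × (∀ k′ → (a ℕ.* k′) % q ≡ g % q → k % q
        ≡ k′ % q)
    divide {a} {g} c d with inverse c
    ... | a′ , c′ , e = a′ ℕ.* g , (λ {j} → coprime-* {a′} {g} c′ d {j}) , trans (cong (_% q) (trans (sym (ℕ.*-assoc a a′ g)) (cong (ℕ._* g)
        (ℕ.*-comm a a′)))) (back g)
      , λ k′ f → trans (≈-* {a′} {a′} {g} {a ℕ.* k′} refl (sym f)) (trans (cong (_% q) (sym (ℕ.*-assoc a′ a k′))) (back k′))
      where
      back : ∀ g → (a′ ℕ.* a ℕ.* g) % q ≡ g % q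
      back g = trans (≈-* {a′ ℕ.* a} {1} {g} {g} e refl) (cong (_% q) (ℕ.*-identityˡ g))

    class-unit : ∀ {r s g} → Coprime g q → (r ℕ.* s) % q ≡ g % q → Coprime r q × Coprime s q
    class-unit {r} {s} {g} c e = (λ {k} → coprime-*ˡ {r} {s} rs {k}) , (λ {k} → coprime-*ʳ {r} {s} rs {k})
      where rs : Coprime (r ℕ.* s) q
            rs {k} = coprime-≈ {g} {r ℕ.* s} (sym e) c {k}

    Σ-quotient : ∀ {F a g k₀} → Periodic F → (a ℕ.* k₀) % q ≡ g % q → (∀ k′ → (a ℕ.* k′) % q ≡ g % q → k₀ % q ≡ k′ % q) →
      Σ q (λ k → 𝟙 ((a ℕ.* k) ≈? g) * F k) ≡ F k₀
    Σ-quotient {F} {a} {g} {k₀} per e un = trans (Σ-ext q λ k → cong (_* F k) (𝟙-cong ((a ℕ.* k) ≈? g) (k₀ ≈? k) (un k)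
      (λ f → trans (≈-* {a} {a} {k} {k₀} refl (sym f)) e))) (Σ-class per k₀)

    count : ∀ {g} → Coprime g q → ∀ a → Σ q (λ k → 𝟙 ((a ℕ.* k) ≈? g)) ≡ unit a
    count {g} d a = go (coprime? a q)
      where
      go : (c : Dec (Coprime a q)) → Σ q (λ k → 𝟙 ((a ℕ.* k) ≈? g)) ≡ 𝟙 c
      go (yes c) = let k₀ , _ , e , un = divide {a} {g} c d in
        trans (Σ-ext q λ k → sym (ℚ.*-identityʳ (𝟙 ((a ℕ.* k) ≈? g)))) (Σ-quotient {λ _ → 1ℚ} {a} {g} {k₀} (λ _ _ _ → refl) e un)
      go (no ¬c) = Σ-zero q λ k _ _ → 𝟙-no ((a ℕ.* k) ≈? g) (λ e → ¬c (λ {j} → class-unit {a} {k} {g} d e .proj₁ {j}))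

    count′ : ∀ {g} → Coprime g q → ∀ a → Σ q (λ k → 𝟙 ((k ℕ.* a) ≈? g)) ≡ unit a
    count′ {g} d a = trans (Σ-ext q λ k → cong (λ z → 𝟙 (z ≈? g)) (ℕ.*-comm k a)) (count d a)

    φ : ℚ
    φ = Σ q unit

    φ-≤ : φ ≤ ι q
    φ-≤ = ≤-trans (Σ-mono q {unit} {λ _ → 1ℚ} λ n _ _ → 𝟙-≤1 (coprime? n q)) (≤-reflexive (trans (Σ-const q 1ℚ) (ℚ.*-identityʳ (ι q))))

    1≤φ : 1ℚ ≤ φ
    1≤φ = subst (_≤ φ) (unit-yes {1} (λ {k} → coprime-1 {k})) (Σ-term q 1 {unit} z<s 1≤modulus λ n _ _ → 𝟙-≥0 (coprime? n q))

    Σ-unit-* : ∀ {d} → Coprime d q → ∀ {F} → Periodic F → (∀ n → ¬ Coprime n q → F n ≡ 0ℚ) → Σ q (λ m → F (d ℕ.* m)) ≡ Σ q F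
    Σ-unit-* {d} c {F} per z = trans (Σ-ext q λ m → sym (Σ-class per (d ℕ.* m))) (trans (Σ-swap q q (λ m r → 𝟙 ((d ℕ.* m) ≈? r) * F r))
      (Σ-ext q λ r → trans (Σ-*ʳ q (F r) (λ m → 𝟙 ((d ℕ.* m) ≈? r))) (go r (coprime? r q))))
      where
      go : ∀ r → Dec (Coprime r q) → Σ q (λ m → 𝟙 ((d ℕ.* m) ≈? r)) * F r ≡ F r
      go r (yes cr) = trans (cong (_* F r) (trans (count cr d) (unit-yes {d} c))) (ℚ.*-identityˡ (F r))
      go r (no ¬cr) = trans (cong (Σ q (λ m → 𝟙 ((d ℕ.* m) ≈? r)) *_) (z r ¬cr)) (trans (ℚ.*-zeroʳ (Σ q (λ m → 𝟙 ((d ℕ.* m) ≈? r)))) (sym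
          (z r ¬cr)))

    -- Multiplication by d prime to q permutes the unit classes, so the sum over a period stays
    -- zero; any other d makes every term vanish.
    zero-sum-Bounded : ∀ {F c} → Periodic F → (∀ n → ¬ Coprime n q → F n ≡ 0ℚ) → Σ q F ≡ 0ℚ → 0ℚ ≤ c → (∀ n → ∣ F n ∣ ≤ c) → Bounded
        (ι q * c) F
    zero-sum-Bounded {F} {c} per z sum0 0≤c bound d n 1≤d = Σ-periodic-bound 1≤modulus 0≤c (λ m → F (d ℕ.* m))
      (λ m → per (d ℕ.* (q ℕ.+ m)) (d ℕ.* m) (trans (cong (_% q) (trans (ℕ.*-distribˡ-+ d q m) (ℕ.+-comm (d ℕ.* q) (d ℕ.* m))))
          (DM.[m+kn]%n≡m%n (d ℕ.* m) d q)))
      (go (coprime? d q)) (λ m → bound (d ℕ.* m)) n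
      where
      go : Dec (Coprime d q) → Σ q (λ m → F (d ℕ.* m)) ≡ 0ℚ
      go (yes cd) = trans (Σ-unit-* cd per z) sum0
      go (no ¬cd) = Σ-zero q λ m _ _ → z (d ℕ.* m) (λ e → ¬cd (λ {k} → coprime-*ˡ {d} {m} e {k}))

    -- φ times the deviation of the class of g from equidistribution.
    deviation : ℕ → ℕ → ℚ
    deviation g n = φ * 𝟙 (n ≈? g) - unit n

    deviation-Bounded : ∀ {g} → Coprime g q → Bounded (ι q * (ι q + 1ℚ)) (deviation g)
    deviation-Bounded {g} cg = zero-sum-Bounded per vanish total (0≤+ (ι-≥0 q) 0≤1)
      (λ n → ∣∣-tri- {φ * 𝟙 (n ≈? g)} {unit n}
        (≤-trans (∣∣-nonneg (0≤* φ≥0 (𝟙-≥0 (n ≈? g)))) (≤-trans (*-monoʳ φ≥0 (𝟙-≤1 (n ≈? g))) (≤-trans (≤-reflexive (ℚ.*-identityʳ φ))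
            φ-≤)))
        (≤-trans (∣∣-nonneg (𝟙-≥0 (coprime? n q))) (𝟙-≤1 (coprime? n q))))
      where
      φ≥0 = ≤-trans 0≤1 1≤φ
      per : Periodic (deviation g)
      per m n e = cong₂ (λ a b → φ * a - b) (𝟙-cong (m ≈? g) (n ≈? g) (λ f → trans (sym e) f) (λ f → trans e f)) (unit-periodic m n e)
      vanish : ∀ n → ¬ Coprime n q → deviation g n ≡ 0ℚ
      vanish n ¬c = trans (cong₂ (λ a b → φ * a - b) (𝟙-no (n ≈? g) (λ e → ¬c (λ {k} → coprime-≈ {g} {n} (sym e) cg {k}))) (unit-no {n} ¬c))
          (lem φ)
        where lem : ∀ a → a * 0ℚ - 0ℚ ≡ 0ℚ
              lem = solve-∀ ℚring
      total : Σ q (deviation g) ≡ 0ℚ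
      total = trans (Σ-diff q (λ n → φ * 𝟙 (n ≈? g)) unit) (trans (cong (_- φ) (trans (Σ-*ˡ q φ (λ n → 𝟙 (n ≈? g)))
        (trans (cong (φ *_) (trans (Σ-ext q λ n → cong (λ z → 𝟙 (z ≈? g)) (sym (ℕ.*-identityˡ n))) (trans (count cg 1) (unit-yes {1} (λ {k}
            → coprime-1 {k}))))) (ℚ.*-identityʳ φ))))
        (ℚ.+-inverseʳ φ))

  -- Deviation from equidistribution

  reciprocal : ∀ {a} A → 1 ℕ.≤ A → ι A ≤ a → ∃ λ ν → 0ℚ ≤ ν × ν * a ≡ 1ℚ × ν ≤ inv A
  reciprocal {a} A 1≤A A≤a = ν , ν≥0 , ν*a≡1 , ≤-trans (≤-reflexive (trans (sym (ℚ.*-identityʳ ν)) (cong (ν *_) (sym (ι*inv 1≤A)))))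
      (≤-trans (*-monoʳ ν≥0 (*-monoˡ (inv-≥0 A) A≤a)) (≤-reflexive (trans (sym (ℚ.*-assoc ν a (inv A))) (trans (cong (_* inv A) ν*a≡1)
          (ℚ.*-identityˡ (inv A))))))
    where
    0<a = ℚ.<-≤-trans (0<ι 1≤A) A≤a
    ν = ℚ.1/_ a {{ℚ.pos⇒nonZero a {{ℚ.positive 0<a}}}}
    ν*a≡1 : ν * a ≡ 1ℚ
    ν*a≡1 = ℚ.*-inverseˡ a {{ℚ.pos⇒nonZero a {{ℚ.positive 0<a}}}}
    ν≥0 : 0ℚ ≤ ν
    ν≥0 = *-cancelˡ 0<a (subst₂ _≤_ (sym (ℚ.*-zeroʳ a)) (sym (trans (ℚ.*-comm a ν) ν*a≡1)) 0≤1)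

  module _ (q : ℕ) .{{q≢0 : NonZero q}} (g : ℕ) where

    -- For g prime to q this is convolution on the group of units, as r s ≡ g forces r and s to be
    -- units.
    bilinear : (ℕ → ℚ) → (ℕ → ℚ) → ℚ
    bilinear α β = Σ q (λ r → Σ q (λ s → 𝟙 (_≈?_ q (r ℕ.* s) g) * (α r * β s)))

  module _ (q : ℕ) .{{q≢0 : NonZero q}} (T : ℕ) (1≤T : 1 ℕ.≤ T) where

    private
      1≤q = 1≤modulus q
      H Lm W : ℕ → ℚ
      H  = h T
      Lm = Λ T
      W n = Lm n * inv n
      _≈_ : ℕ → ℕ → Set
      m ≈ n = m % q ≡ n % q
      W-≥0 : ∀ {n} → 1 ℕ.≤ n → 0ℚ ≤ W n
      W-≥0 {n} 1≤n = 0≤* (Λ-≥0 T 1≤T 1≤n) (inv-≥0 n)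
      Φ = φ q
      Φ≥0 : 0ℚ ≤ Φ
      Φ≥0 = ≤-trans 0≤1 (1≤φ q)

    primeMass : ℕ → ℕ → ℚ
    primeMass x = classSum q x (λ n → Λ T n * inv n)

    primeMass-≥0 : ∀ x g → 0ℚ ≤ primeMass x g
    primeMass-≥0 x g = Σ-≥0 x λ n 1≤n _ → 0≤* (𝟙-≥0 (_≈?_ q n g)) (W-≥0 1≤n)

    unitMass : ℕ → ℚ
    unitMass x = Σ x (λ n → (Λ T n * inv n) * unit q n)

    unitMass-≥0 : ∀ x → 0ℚ ≤ unitMass x
    unitMass-≥0 x = Σ-≥0 x λ n 1≤n _ → 0≤* (W-≥0 1≤n) (𝟙-≥0 (coprime? n q))

    -- 18 is the error of `mertens-upper`, and 2 q that of omitting the prime powers not coprime to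
    -- q; the 2 of `mertens-lower` is absorbed.
    massError : ℚ
    massError = ι (18 ℕ.+ 2 ℕ.* q)

    unitMass-≤ : ∀ {x} → 1 ℕ.≤ x → suc x ℕ.≤ T → unitMass x ≤ h T x + ι 18
    unitMass-≤ {x} 1≤x x<T = ≤-trans (Σ-mono x {g = W} λ n 1≤n _ →
      ≤-trans (*-monoʳ (W-≥0 1≤n) (𝟙-≤1 (coprime? n q))) (≤-reflexive (ℚ.*-identityʳ (W n)))) (mertens-upper T 1≤T 1≤x x<T)

    unitMass-error : ∀ {x} → 1 ℕ.≤ x → suc x ℕ.≤ T → ∣ unitMass x - h T x ∣ ≤ massError
    unitMass-error {x} 1≤x x<T = ∣∣-≤
      (≤-trans (≤-by (H x + ι 18 - unitMass x) (0≤-diff (unitMass-≤ 1≤x x<T)) (lem (unitMass x) (H x))) (ι-mono (ℕ.m≤m+n 18 (2 ℕ.* q))))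
      (≤-trans (ℚ.neg-antimono-≤ (ι-mono (ℕ.+-monoˡ-≤ (2 ℕ.* q) {2} {18} (s≤s z<s))))
        (≤-trans (≤-reflexive (cong -_ (ι-+ 2 (2 ℕ.* q)))) (≤-by _ (0≤+ (0≤-diff (mertens-lower T 1≤T 1≤x x<T)) (0≤-diff lower)) (lem₂
            (unitMass x) (H x) (M T 1≤T x) (ι (2 ℕ.* q))))))
      where
      lem : ∀ u h → ι 18 ≡ (u - h) + (h + ι 18 - u)
      lem = solve-∀ ℚring
      lem₂ : ∀ u h m q → u - h ≡ (- (ι 2 + q)) + ((m + ι 2 - h) + (u + q - m))
      lem₂ = solve-∀ ℚring
      lower : M T 1≤T x ≤ unitMass x + ι (2 ℕ.* q)
      lower = ≤-trans (≤-reflexive (trans (Σ-ext x λ n → trans (sym (ℚ.*-identityʳ (W n))) (trans (cong (W n *_) (sym (𝟙-¬ (coprime? n q))))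
          (l (Lm n) (inv n) (unit q n) (𝟙 (¬? (coprime? n q)))))) (Σ-+ x (λ n → W n * unit q n) (λ n → 𝟙 (¬? (coprime? n q))
              * Lm n * inv n))))
        (ℚ.+-monoʳ-≤ (unitMass x) (Λ-noncoprime-sum T 1≤T 1≤q x))
        where l : ∀ a b c e → (a * b) * (c + e) ≡ (a * b) * c + e * a * b
              l = solve-∀ ℚring

    -- Nonprime n contribute at most 4, and those up to N at most M(N) ≤ h(N) + 18 ≤ N + 18; nothing
    -- else lies in the class.
    primeMass-bound : ∀ {N x a} → 1 ℕ.≤ N → N ℕ.≤ x → suc x ℕ.≤ T →
      (∀ p → N ℕ.< p → p ℕ.≤ x → Prime p → ¬ p % q ≡ a % q) → primeMass x a ≤ ι (22 ℕ.+ N)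
    primeMass-bound {N} {x} {a} 1≤N N≤x x<T none = ≤-trans
      (Σ-mono x {g = λ n → 𝟙 (¬? (prime? n)) * Lm n * inv n + 𝟙 (n ℕ.≤? N) * W n} λ n 1≤n n≤x → pointwise n 1≤n n≤x)
      (≤-trans (≤-reflexive (Σ-+ x (λ n → 𝟙 (¬? (prime? n)) * Lm n * inv n) (λ n → 𝟙 (n ℕ.≤? N) * W n)))
      (≤-trans (+-mono-≤ (Λ-nonprime-sum T 1≤T x) small) (≤-reflexive (trans (lem (ι N)) (sym (ι-+ 22 N))))))
      where
      lem : ∀ n → ι 4 + (n + ι 18) ≡ ι 22 + n
      lem = solve-∀ ℚring
      h-≤-ι : ∀ {N} → 1 ℕ.≤ N → H N ≤ ι N
      h-≤-ι {suc N} _ = ≤-trans (h-≤-Hs T 1≤T N) (≤-trans (Hs-≤-ι N) (ι-mono (ℕ.n≤1+n N)))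
      small : Σ x (λ n → 𝟙 (n ℕ.≤? N) * W n) ≤ ι N + ι 18
      small = ≤-trans (≤-reflexive (trans (Σ-extend N≤x λ n N<n _ → 𝟙*-no (n ℕ.≤? N) (ℕ.<⇒≱ N<n) (W n)) (Σ-cong N λ n _ n≤N → 𝟙*-yes
          (n ℕ.≤? N) n≤N (W n))))
        (≤-trans (mertens-upper T 1≤T 1≤N (ℕ.≤-trans (s≤s N≤x) x<T)) (ℚ.+-monoˡ-≤ (ι 18) (h-≤-ι 1≤N)))
      pointwise : ∀ n → 1 ℕ.≤ n → n ℕ.≤ x → 𝟙 (_≈?_ q n a) * W n ≤ 𝟙 (¬? (prime? n)) * Lm n * inv n + 𝟙 (n ℕ.≤? N) * W n
      pointwise n 1≤n n≤x = by (prime? n) (n ℕ.≤? N) (_≈?_ q n a)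
        where
        Wn = W-≥0 {n} 1≤n
        l₁ : ∀ a b → 1ℚ * a * b ≡ a * b
        l₁ = solve-∀ ℚring
        l₂ : ∀ a b → 0ℚ * a * b + 1ℚ * (a * b) ≡ a * b
        l₂ = solve-∀ ℚring
        l₃ : ∀ a b → 0ℚ * (a * b) ≡ 0ℚ * a * b + 0ℚ * (a * b)
        l₃ = solve-∀ ℚring
        by : (pn : Dec (Prime n)) (le : Dec (n ℕ.≤ N)) (c : Dec (n ≈ a)) → 𝟙 c * W n ≤ 𝟙 (¬? pn) * Lm n * inv n + 𝟙 le * W n
        by (no _) le c = ≤-trans (≤-trans (*-monoˡ Wn (𝟙-≤1 c)) (≤-reflexive (ℚ.*-identityˡ (W n)))) (≤-by (𝟙 le * W n) (0≤* (𝟙-≥0 le) Wn)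
            (cong (_+ 𝟙 le * W n) (l₁ (Lm n) (inv n))))
        by (yes _) (yes _) c = ≤-trans (≤-trans (*-monoˡ Wn (𝟙-≤1 c)) (≤-reflexive (ℚ.*-identityˡ (W n)))) (≤-reflexive (sym (l₂ (Lm n)
            (inv n))))
        by (yes pn) (no ¬le) (yes c) = contradiction c (none n (ℕ.≰⇒> ¬le) n≤x pn)
        by (yes _) (no _) (no _) = ≤-reflexive (l₃ (Lm n) (inv n))

    -- 1 - φ · (share of the class of g in h(x)), where ν stands for 1 / h(x).
    excess : ℕ → ℚ → ℕ → ℚ
    excess x ν g = 1ℚ - (φ q * ν) * primeMass x g

    excess-periodic : ∀ x ν → Periodic q (excess x ν)
    excess-periodic x ν m n e = cong (λ z → 1ℚ - (Φ * ν) * z) (classSum-periodic q x W m n e)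

    excess-≤1 : ∀ {x ν} → 0ℚ ≤ ν → ∀ g → excess x ν g ≤ 1ℚ
    excess-≤1 {x} {ν} ν≥0 g = ≤-by ((Φ * ν) * primeMass x g) (0≤* (0≤* Φ≥0 ν≥0) (primeMass-≥0 x g)) (lem ((Φ * ν) * primeMass x g))
      where lem : ∀ a → 1ℚ ≡ (1ℚ - a) + a
            lem = solve-∀ ℚring

    private
      unitMass-class : ∀ x → Σ q (λ r → primeMass x r * unit q r) ≡ unitMass x
      unitMass-class x = sym (Σ-by-class q {unit q} (unit-periodic q) x W)

    -- Only the total mass of the unit classes enters, which is h(x) up to `massError`: the excess
    -- has almost no component along the trivial character.
    excess-sum : ∀ {x ν} → 1 ℕ.≤ x → suc x ℕ.≤ T → 0ℚ ≤ ν → ν * h T x ≡ 1ℚ →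
      ∣ Σ q (λ r → unit q r * excess x ν r) ∣ ≤ (ι q * massError) * ν
    excess-sum {x} {ν} 1≤x x<T ν≥0 ν*h = subst (λ z → ∣ z ∣ ≤ (ι q * massError) * ν) (sym eq)
      (≤-trans (∣∣-* {Φ * ν} {H x - unitMass x} (∣∣-nonneg (0≤* Φ≥0 ν≥0)) (subst (_≤ massError) (trans (sym (ℚ.∣-p∣≡∣p∣ (unitMass x - H x)))
          (cong ∣_∣ (l₀ (unitMass x) (H x)))) (unitMass-error 1≤x x<T)))
        (≤-trans (*-monoˡ (ι-≥0 (18 ℕ.+ 2 ℕ.* q)) (*-monoˡ ν≥0 (φ-≤ q))) (≤-reflexive (l₁ (ι q) ν massError))))
      where
      l₀ : ∀ a b → - (a - b) ≡ b - a
      l₀ = solve-∀ ℚring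
      l₁ : ∀ a b c → (a * b) * c ≡ (a * c) * b
      l₁ = solve-∀ ℚring
      l₂ : ∀ u c p → u * (1ℚ - c * p) ≡ u - c * (p * u)
      l₂ = solve-∀ ℚring
      l₃ : ∀ f n h u → f * (n * h) - (f * n) * u ≡ (f * n) * (h - u)
      l₃ = solve-∀ ℚring
      eq : Σ q (λ r → unit q r * excess x ν r) ≡ (Φ * ν) * (H x - unitMass x)
      eq = trans (Σ-ext q λ r → l₂ (unit q r) (Φ * ν) (primeMass x r)) (trans (Σ-diff q (unit q) (λ r → (Φ * ν) *
          (primeMass x r * unit q r)))
        (trans (cong (λ z → Φ - z) (trans (Σ-*ˡ q (Φ * ν) (λ r → primeMass x r * unit q r)) (cong ((Φ * ν) *_) (unitMass-class x))))
        (trans (cong (_- (Φ * ν) * unitMass x) (trans (sym (ℚ.*-identityʳ Φ)) (cong (Φ *_) (sym ν*h)))) (l₃ Φ ν (H x) (unitMass x)))))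

    -- The bound of `two-scales` divided by h(x) h(y): 76 = 4·19 since ν′ M(y) ≤ 19, and the last
    -- term accounts for replacing the unit mass at y by h(y). The terms in ν′ are small only when
    -- h(y) is much larger than x.
    pairError : ℕ → ℚ → ℚ → ℚ
    pairError x ν ν′ = ι q * ((ι q * (ι q + 1ℚ)) * (ι 76 * ν + ι 80 * ι x * ν′) + ι 19 * massError * ν′)

    module _ {x y : ℕ} {ν ν′ : ℚ} (1≤x : 1 ℕ.≤ x) (x<T : suc x ℕ.≤ T) (1≤y : 1 ℕ.≤ y) (y<T : suc y ℕ.≤ T)
      (ν≥0 : 0ℚ ≤ ν) (ν*h : ν * h T x ≡ 1ℚ) (ν≤1 : ν ≤ 1ℚ) (ν′≥0 : 0ℚ ≤ ν′) (ν′*h : ν′ * h T y ≡ 1ℚ) (ν′≤1 : ν′ ≤ 1ℚ)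
      {g : ℕ} (cg : Coprime g q) where

      private
        Q star X B : ℚ
        Q = Σ y (λ m → W m * Σ x (λ n → W n * 𝟙 (_≈?_ q (m ℕ.* n) g)))
        X = Σ y (λ m → W m * deviation q g m)
        star = H x * X + Σ y (λ m → W m * Σ x (λ n → W n * deviation q g (m ℕ.* n)))
        B = bilinear q g (excess y ν′) (excess x ν)
        K = ι q * (ι q + 1ℚ)
        K≥0 : 0ℚ ≤ K
        K≥0 = 0≤* (ι-≥0 q) (0≤+ (ι-≥0 q) 0≤1)

        star-bound : ∣ star ∣ ≤ K * (ι 4 * M T 1≤T y + ι 80 * ι x)
        star-bound = two-scales T 1≤T T {K} {deviation q g} (deviation-Bounded q cg) 1≤x (ℕ.<⇒≤ x<T) (ℕ.<⇒≤ x<T) 1≤y y<T (ℕ.<⇒≤ y<T)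

        X-eq : X ≡ Φ * primeMass y g - unitMass y
        X-eq = trans (Σ-ext y λ m → l (W m) Φ (𝟙 (_≈?_ q m g)) (unit q m)) (trans (Σ-diff y (λ m → Φ * (𝟙 (_≈?_ q m g) * W m)) (λ m
            → W m * unit q m))
          (cong (_- unitMass y) (Σ-*ˡ y Φ (λ m → 𝟙 (_≈?_ q m g) * W m))))
          where l : ∀ w f a u → w * (f * a - u) ≡ f * (a * w) - w * u
                l = solve-∀ ℚring

        star-eq : star ≡ H x * (Φ * primeMass y g - unitMass y) + (Φ * Q - unitMass y * unitMass x)
        star-eq = cong₂ _+_ (cong (H x *_) X-eq) (trans (Σ-ext y λ m → trans (cong (W m *_) (inner m)) (l₁ (W m) Φ _ (unit q m)
            (unitMass x)))
            (trans (Σ-diff y (λ m → Φ * (W m * Σ x (λ n → W n * 𝟙 (_≈?_ q (m ℕ.* n) g)))) (λ m → (W m * unit q m) * unitMass x))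
              (cong₂ _-_ (Σ-*ˡ y Φ (λ m → W m * Σ x (λ n → W n * 𝟙 (_≈?_ q (m ℕ.* n) g)))) (Σ-*ʳ y (unitMass x) (λ m → W m * unit q m)))))
          where
          l₀ : ∀ w f a u v → w * (f * a - u * v) ≡ f * (w * a) - u * (w * v)
          l₀ = solve-∀ ℚring
          l₁ : ∀ w f s u U → w * (f * s - u * U) ≡ f * (w * s) - (w * u) * U
          l₁ = solve-∀ ℚring
          inner : ∀ m → Σ x (λ n → W n * deviation q g (m ℕ.* n)) ≡ Φ * Σ x (λ n → W n * 𝟙 (_≈?_ q (m ℕ.* n) g)) - unit q m * unitMass x
          inner m = trans (Σ-ext x λ n → trans (cong (λ z → W n * (Φ * 𝟙 (_≈?_ q (m ℕ.* n) g) - z)) (unit-* q m n)) (l₀ (W n) Φ (𝟙 (_≈?_ q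
              (m ℕ.* n) g)) (unit q m) (unit q n)))
            (trans (Σ-diff x (λ n → Φ * (W n * 𝟙 (_≈?_ q (m ℕ.* n) g))) (λ n → unit q m * (W n * unit q n)))
              (cong₂ _-_ (Σ-*ˡ x Φ (λ n → W n * 𝟙 (_≈?_ q (m ℕ.* n) g))) (Σ-*ˡ x (unit q m) (λ n → W n * unit q n))))

        I : ℕ → ℕ → ℚ
        I r s = 𝟙 (_≈?_ q (r ℕ.* s) g)

        Q-class : Σ q (λ r → Σ q (λ s → I r s * (primeMass y r * primeMass x s))) ≡ Q
        Q-class = trans (Σ-ext q λ r → trans (Σ-ext q λ s → l (I r s) (primeMass y r) (primeMass x s)) (Σ-*ˡ q (primeMass y r) (λ s
            → primeMass x s * I r s)))
          (trans (sym (Σ-by-class q {λ r → Σ q (λ s → primeMass x s * I r s)} (λ m n e → Σ-ext q λ s → cong (primeMass x s *_)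
              (I-left m n s e)) y W))
          (Σ-ext y λ m → cong (W m *_) (sym (Σ-by-class q {I m} (λ s t e → I-right m s t e) x W))))
          where
          l : ∀ i a b → i * (a * b) ≡ a * (b * i)
          l = solve-∀ ℚring
          I-left : ∀ m n s → m ≈ n → I m s ≡ I n s
          I-left m n s e = 𝟙-cong (_≈?_ q (m ℕ.* s) g) (_≈?_ q (n ℕ.* s) g) (trans (sym (≈-* q {m} {n} {s} {s} e refl))) (trans
              (≈-* q {m} {n} {s} {s} e refl))
          I-right : ∀ m s t → s ≈ t → I m s ≡ I m t
          I-right m s t e = 𝟙-cong (_≈?_ q (m ℕ.* s) g) (_≈?_ q (m ℕ.* t) g) (trans (sym (≈-* q {m} {m} {s} {t} refl e))) (trans
              (≈-* q {m} {m} {s} {t} refl e))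

        c c′ : ℚ
        c  = Φ * ν
        c′ = Φ * ν′

        B-eq : B ≡ (Φ - c′ * unitMass y) - c * unitMass x + c′ * c * Q
        B-eq = trans (Σ-ext q λ r → row r)
          (trans (Σ-+ q (λ r → (unit q r - c′ * (primeMass y r * unit q r)) - c * Σ q (λ s → I r s * primeMass x s)) (λ r → (c′ * c) * Σ q
              (λ s → I r s * (primeMass y r * primeMass x s))))
            (cong₂ _+_ (trans (Σ-diff q (λ r → unit q r - c′ * (primeMass y r * unit q r)) (λ r → c * Σ q (λ s → I r s * primeMass x s)))
                (cong₂ _-_ (trans (Σ-diff q (unit q) (λ r → c′ * (primeMass y r * unit q r))) (cong (λ z → Φ - z) (trans (Σ-*ˡ q c′ (λ r
                    → primeMass y r * unit q r)) (cong (c′ *_) (unitMass-class y)))))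
                  (trans (Σ-*ˡ q c (λ r → Σ q (λ s → I r s * primeMass x s))) (cong (c *_) col))))
              (trans (Σ-*ˡ q (c′ * c) (λ r → Σ q (λ s → I r s * (primeMass y r * primeMass x s)))) (cong ((c′ * c) *_) Q-class))))
          where
          l₁ : ∀ i a b c′ c → i * ((1ℚ - c′ * a) * (1ℚ - c * b)) ≡ (i - (c′ * a) * i - c * (i * b)) + (c′ * c) * (i * (a * b))
          l₁ = solve-∀ ℚring
          l₂ : ∀ a b u → u - (a * b) * u ≡ u - a * (b * u)
          l₂ = solve-∀ ℚring
          row : ∀ r → Σ q (λ s → I r s * (excess y ν′ r * excess x ν s)) ≡
            ((unit q r - c′ * (primeMass y r * unit q r)) - c * Σ q (λ s → I r s * primeMass x s)) + (c′ * c) * Σ q (λ s → I r s *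
                (primeMass y r * primeMass x s))
          row r = trans (Σ-ext q λ s → l₁ (I r s) (primeMass y r) (primeMass x s) c′ c)
            (trans (Σ-+ q (λ s → I r s - (c′ * primeMass y r) * I r s - c * (I r s * primeMass x s)) (λ s → (c′ * c) * (I r s *
                (primeMass y r * primeMass x s))))
              (cong₂ _+_ (trans (Σ-diff q (λ s → I r s - (c′ * primeMass y r) * I r s) (λ s → c * (I r s * primeMass x s)))
                  (cong₂ _-_ (trans (Σ-diff q (I r) (λ s → (c′ * primeMass y r) * I r s)) (trans (cong₂ _-_ (count q cg r) (trans (Σ-*ˡ q
                      (c′ * primeMass y r) (I r)) (cong ((c′ * primeMass y r) *_) (count q cg r))))
                     (l₂ c′ (primeMass y r) (unit q r))))
                    (Σ-*ˡ q c (λ s → I r s * primeMass x s))))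
                (Σ-*ˡ q (c′ * c) (λ s → I r s * (primeMass y r * primeMass x s)))))
          col : Σ q (λ r → Σ q (λ s → I r s * primeMass x s)) ≡ unitMass x
          col = trans (Σ-swap q q (λ r s → I r s * primeMass x s)) (trans (Σ-ext q λ s → trans (Σ-*ʳ q (primeMass x s) (λ r → I r s))
            (trans (cong (_* primeMass x s) (count′ q cg s)) (ℚ.*-comm (unit q s) (primeMass x s)))) (unitMass-class x))

        -- Writing each stray 1 as ν h(x) or ν′ h(y) makes the expression of `two-scales` appear in
        -- the expanded convolution; what is left over is proportional to the error of the unit mass
        -- at y.
        key : B - Φ * excess y ν′ g ≡ (Φ * (ν * ν′)) * star + (Φ * (ν * unitMass x)) * (ν′ * (unitMass y - H y))
        key = trans (cong (_- Φ * excess y ν′ g) B-eq) (trans (l Φ ν ν′ (unitMass y) (unitMass x) Q (primeMass y g))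
          (trans (cong₂ (λ a b → (Φ * (ν * ν′)) * (Φ * Q - unitMass y * unitMass x) + (a * (Φ * ν′)) * (Φ * primeMass y g - unitMass y) +
              (Φ * (ν * unitMass x)) * (ν′ * unitMass y - b)) (sym ν*h) (sym ν′*h))
          (trans (l′ Φ ν ν′ (unitMass y) (unitMass x) Q (primeMass y g) (H x) (H y))
          (cong (λ z → (Φ * (ν * ν′)) * z + (Φ * (ν * unitMass x)) * (ν′ * (unitMass y - H y))) (sym star-eq)))))
          where
          l : ∀ f n n′ Uy Ux Q p → ((f - (f * n′) * Uy) - (f * n) * Ux + (f * n′) * (f * n) * Q) - f * (1ℚ - (f * n′) * p) ≡
            (f * (n * n′)) * (f * Q - Uy * Ux) + (1ℚ * (f * n′)) * (f * p - Uy) + (f * (n * Ux)) * (n′ * Uy - 1ℚ)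
          l = solve-∀ ℚring
          l′ : ∀ f n n′ Uy Ux Q p hx hy → (f * (n * n′)) * (f * Q - Uy * Ux) + ((n * hx) * (f * n′)) * (f * p - Uy) + (f * (n * Ux)) *
              (n′ * Uy - n′ * hy) ≡
            (f * (n * n′)) * (hx * (f * p - Uy) + (f * Q - Uy * Ux)) + (f * (n * Ux)) * (n′ * (Uy - hy))
          l′ = solve-∀ ℚring

        normal : ∀ {n a b} → 0ℚ ≤ n → n ≤ 1ℚ → n * b ≡ 1ℚ → a ≤ b + ι 18 → n * a ≤ ι 19
        normal {n} {a} {b} n≥0 n≤1 nb le = ≤-trans (*-monoʳ n≥0 le) (≤-trans (≤-reflexive (trans (ℚ.*-distribˡ-+ n b (ι 18)) (cong
            (_+ n * ι 18) nb)))
          (ℚ.+-monoʳ-≤ 1ℚ (*-monoˡ (ι-≥0 18) n≤1)))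

      -- On characters: wherever the coefficient at scale y is not negligible, the coefficient at
      -- scale x is close to φ.
      bilinear-excess : ∣ bilinear q g (excess y ν′) (excess x ν) - φ q * excess y ν′ g ∣ ≤ pairError x ν ν′
      bilinear-excess = subst (λ z → ∣ z ∣ ≤ pairError x ν ν′) (sym key)
        (≤-trans (∣∣-tri {(Φ * (ν * ν′)) * star} {(Φ * (ν * unitMass x)) * (ν′ * (unitMass y - H y))}
          (∣∣-* {Φ * (ν * ν′)} {star} (∣∣-nonneg (0≤* Φ≥0 (0≤* ν≥0 ν′≥0))) star-bound)
          (∣∣-* {Φ * (ν * unitMass x)} (∣∣-nonneg (0≤* Φ≥0 (0≤* ν≥0 (unitMass-≥0 x)))) (∣∣-* {ν′} {unitMass y - H y} (∣∣-nonneg ν′≥0)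
              (unitMass-error 1≤y y<T))))
        (≤-trans (≤-reflexive (l Φ K ν ν′ (M T 1≤T y) (ι x) (unitMass x) massError))
        (*-mono (ι-≥0 q) inner≥0 (φ-≤ q) (+-mono-≤ (*-monoʳ K≥0 (+-mono-≤ part₁ part₂)) part₃))))
        where
        l : ∀ f K n n′ M x U e → (f * (n * n′)) * (K * (ι 4 * M + ι 80 * x)) + (f * (n * U)) * (n′ * e) ≡
          f * (K * (ι 4 * (n′ * M) * n + ι 80 * x * n′ * n) + (n * U) * e * n′)
        l = solve-∀ ℚring
        U≥0 = unitMass-≥0 x
        E≥0 : 0ℚ ≤ massError
        E≥0 = ι-≥0 (18 ℕ.+ 2 ℕ.* q)
        80x≥0 : 0ℚ ≤ ι 80 * ι x
        80x≥0 = 0≤* (ι-≥0 80) (ι-≥0 x)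
        inner≥0 : 0ℚ ≤ K * (ι 4 * (ν′ * M T 1≤T y) * ν + ι 80 * ι x * ν′ * ν) + (ν * unitMass x) * massError * ν′
        inner≥0 = 0≤+ (0≤* K≥0 (0≤+ (0≤* (0≤* (ι-≥0 4) (0≤* ν′≥0 (M-≥0 T 1≤T y))) ν≥0) (0≤* (0≤* 80x≥0 ν′≥0) ν≥0))) (0≤* (0≤* (0≤* ν≥0 U≥0)
            E≥0) ν′≥0)
        part₁ : ι 4 * (ν′ * M T 1≤T y) * ν ≤ ι 76 * ν
        part₁ = *-monoˡ ν≥0 (*-monoʳ (ι-≥0 4) (normal ν′≥0 ν′≤1 ν′*h (mertens-upper T 1≤T 1≤y y<T)))
        part₂ : ι 80 * ι x * ν′ * ν ≤ ι 80 * ι x * ν′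
        part₂ = ≤-trans (*-monoʳ (0≤* 80x≥0 ν′≥0) ν≤1) (≤-reflexive (ℚ.*-identityʳ (ι 80 * ι x * ν′)))
        part₃ : (ν * unitMass x) * massError * ν′ ≤ ι 19 * massError * ν′
        part₃ = *-monoˡ ν′≥0 (*-monoˡ E≥0 (normal ν≥0 ν≤1 ν*h (unitMass-≤ 1≤x x<T)))

  -- From deviations to a real character

  -- `zero-sum` expresses that the character is nontrivial, in the form that yields bounded partial
  -- sums.
  record RealCharacter (q : ℕ) .{{q≢0 : NonZero q}} (ψ : ℕ → ℚ) : Set where
    field
      periodic : Periodic q ψ
      vanish   : ∀ n → ¬ Coprime n q → ψ n ≡ 0ℚ
      mult     : ∀ m n → ψ (m ℕ.* n) ≡ ψ m * ψ n
      values   : ∀ n → Coprime n q → ψ n ≡ 1ℚ ⊎ ψ n ≡ - 1ℚ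
      zero-sum : Σ q ψ ≡ 0ℚ

    bounded-by-1 : ∀ n → ∣ ψ n ∣ ≤ 1ℚ
    bounded-by-1 n = go (coprime? n q)
      where
      go : Dec (Coprime n q) → ∣ ψ n ∣ ≤ 1ℚ
      go (no ¬c) = subst (λ z → ∣ z ∣ ≤ 1ℚ) (sym (vanish n ¬c)) 0≤1
      go (yes c) with values n c
      ... | inj₁ e = subst (λ z → ∣ z ∣ ≤ 1ℚ) (sym e) ≤-refl
      ... | inj₂ e = subst (λ z → ∣ z ∣ ≤ 1ℚ) (sym e) ≤-refl

    bounded : Bounded (ι q * 1ℚ) ψ
    bounded = zero-sum-Bounded q periodic vanish zero-sum 0≤1 bounded-by-1

  <⇒≱ : ∀ {a b : ℚ} → a < b → ¬ b ≤ a
  <⇒≱ a<b b≤a = ℚ.<-irrefl refl (ℚ.<-≤-trans a<b b≤a)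

  sg : ℚ → ℚ
  sg x with 0ℚ ≤? x
  ... | yes _ = 1ℚ
  ... | no _  = - 1ℚ

  sg-values : ∀ x → sg x ≡ 1ℚ ⊎ sg x ≡ - 1ℚ
  sg-values x with 0ℚ ≤? x
  ... | yes _ = inj₁ refl
  ... | no _  = inj₂ refl

  sg-sq : ∀ x → sg x * sg x ≡ 1ℚ
  sg-sq x with 0ℚ ≤? x
  ... | yes _ = refl
  ... | no _  = refl

  sg-abs : ∀ x → sg x * x ≡ ∣ x ∣
  sg-abs x with 0ℚ ≤? x
  ... | yes p = trans (ℚ.*-identityˡ x) (sym (ℚ.0≤p⇒∣p∣≡p p))
  ... | no ¬p = trans (lem x) (trans (sym (ℚ.0≤p⇒∣p∣≡p (ℚ.neg-antimono-≤ (<⇒≤ (ℚ.≰⇒> ¬p))))) (ℚ.∣-p∣≡∣p∣ x))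
    where lem : ∀ x → (- 1ℚ) * x ≡ - x
          lem = solve-∀ ℚring

  sg-unique : ∀ {x s} → s ≡ 1ℚ ⊎ s ≡ - 1ℚ → 0ℚ < s * x → sg x ≡ s
  sg-unique {x} (inj₁ refl) 0<x with 0ℚ ≤? x
  ... | yes _ = refl
  ... | no ¬p = contradiction (subst (0ℚ ≤_) (ℚ.*-identityˡ x) (<⇒≤ 0<x)) ¬p
  sg-unique {x} (inj₂ refl) 0<-x with 0ℚ ≤? x
  ... | no _ = refl
  ... | yes p = contradiction (≤-trans (≤-reflexive (lem x)) (ℚ.neg-antimono-≤ p)) (<⇒≱ 0<-x)
    where lem : ∀ x → (- 1ℚ) * x ≡ - x
          lem = solve-∀ ℚring

  sg-* : ∀ {x y σ} → σ ≡ 1ℚ ⊎ σ ≡ - 1ℚ → 0ℚ < σ * (x * y) → σ ≡ sg x * sg y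
  sg-* {x} {y} {σ} σ± pos = trans (sym (lem₀ σ)) (trans (cong (σ *_) (sym (sg-sq y))) (trans (lem σ (sg y)) (cong (_* sg y) (sym sgx))))
    where
    lem₀ : ∀ a → a * 1ℚ ≡ a
    lem₀ = solve-∀ ℚring
    lem : ∀ σ t → σ * (t * t) ≡ (σ * t) * t
    lem = solve-∀ ℚring
    ±* : ∀ {s t} → s ≡ 1ℚ ⊎ s ≡ - 1ℚ → t ≡ 1ℚ ⊎ t ≡ - 1ℚ → s * t ≡ 1ℚ ⊎ s * t ≡ - 1ℚ
    ±* (inj₁ refl) (inj₁ refl) = inj₁ refl
    ±* (inj₁ refl) (inj₂ refl) = inj₂ refl
    ±* (inj₂ refl) (inj₁ refl) = inj₂ refl
    ±* (inj₂ refl) (inj₂ refl) = inj₁ refl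
    0<-cancel : ∀ {a b} → 0ℚ ≤ b → 0ℚ < a * b → 0ℚ < a
    0<-cancel {a} {b} 0≤b 0<ab = ℚ.≰⇒> λ a≤0 → <⇒≱ 0<ab (≤-trans (*-monoˡ 0≤b a≤0) (≤-reflexive (ℚ.*-zeroˡ b)))
    sgx : sg x ≡ σ * sg y
    sgx = sg-unique (±* σ± (sg-values y)) (0<-cancel {(σ * sg y) * x} {∣ y ∣} (0≤∣p∣ y)
      (subst (0ℚ <_) (trans (cong (λ z → σ * (x * z)) y≡) (lem₃ σ x (sg y) ∣ y ∣)) pos))
      where
      y≡ : y ≡ sg y * ∣ y ∣
      y≡ = trans (lem₁ y) (trans (cong (_* y) (sym (sg-sq y))) (trans (ℚ.*-assoc (sg y) (sg y) y) (cong (sg y *_) (sg-abs y))))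
        where lem₁ : ∀ y → y ≡ 1ℚ * y
              lem₁ = solve-∀ ℚring
      lem₃ : ∀ σ x s a → σ * (x * (s * a)) ≡ ((σ * s) * x) * a
      lem₃ = solve-∀ ℚring

  module _ (q : ℕ) .{{q≢0 : NonZero q}} where

    private
      Φ = φ q
      u = unit q
      I : ℕ → ℕ → ℕ → ℚ
      I g r s = 𝟙 (_≈?_ q (r ℕ.* s) g)
      Φ≥0 : 0ℚ ≤ Φ
      Φ≥0 = ≤-trans 0≤1 (1≤φ q)
      0<Φ : 0ℚ < Φ
      0<Φ = ℚ.<-≤-trans 0<1 (1≤φ q)
      I-≥0 : ∀ g r s → 0ℚ ≤ I g r s
      I-≥0 g r s = 𝟙-≥0 (_≈?_ q (r ℕ.* s) g)

    Σ-bilinear-const : ∀ {g} → Coprime g q → ∀ c → Σ q (λ r → Σ q (λ s → 𝟙 (_≈?_ q (r ℕ.* s) g) * c)) ≡ φ q * c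
    Σ-bilinear-const {g} cg c = trans (Σ-ext q λ r → trans (Σ-*ʳ q c (I g r)) (cong (_* c) (count q cg r))) (Σ-*ʳ q c u)

    Σ-bilinear-left : ∀ {g} → Coprime g q → (α : ℕ → ℚ) → Σ q (λ r → Σ q (λ s → 𝟙 (_≈?_ q (r ℕ.* s) g) * α r)) ≡ Σ q (λ r → unit q r * α r)
    Σ-bilinear-left {g} cg α = Σ-ext q λ r → trans (Σ-*ʳ q (α r) (I g r)) (cong (_* α r) (count q cg r))

    Σ-bilinear-right : ∀ {g} → Coprime g q → (β : ℕ → ℚ) → Σ q (λ r → Σ q (λ s → 𝟙 (_≈?_ q (r ℕ.* s) g) * β s)) ≡ Σ q (λ s → unit q s * β s)
    Σ-bilinear-right {g} cg β = trans (Σ-swap q q (λ r s → I g r s * β s)) (Σ-ext q λ s → trans (Σ-*ʳ q (β s) (λ r → I g r s)) (cong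
        (_* β s) (count′ q cg s)))

    -- The factors 1 - α and 1 - β are non-negative, hence so is their convolution, which is close
    -- to φ + φ α(g) because the sums of α and β over the units are negligible.
    excess-lower : ∀ {ε} (α β : ℕ → ℚ) → 0ℚ ≤ ε → (∀ n → α n ≤ 1ℚ) → (∀ n → β n ≤ 1ℚ) →
      ∣ Σ q (λ r → unit q r * α r) ∣ ≤ ε → ∣ Σ q (λ r → unit q r * β r) ∣ ≤ ε →
      (∀ {g} → Coprime g q → ∣ bilinear q g α β - φ q * α g ∣ ≤ ε) → ∀ {g} → Coprime g q → - (1ℚ + ι 3 * ε) ≤ α g
    excess-lower {ε} α β ε≥0 α≤1 β≤1 Sα Sβ bil {g} cg = *-cancelˡ 0<Φ (≤-by
        (Σ q (λ r → Σ q (λ s → I g r s * ((1ℚ - α r) * (1ℚ - β s)))) + (ε + Sa) + (ε + Sb) + (ε - (B - Φ * α g)) + (ι 3 * ε) * (Φ - 1ℚ))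
        (0≤+ (0≤+ (0≤+ (0≤+ (Σ-≥0 q λ r _ _ → Σ-≥0 q λ s _ _ → 0≤* (I-≥0 g r s) (0≤* (0≤-diff (α≤1 r)) (0≤-diff (β≤1 s))))
          (plus (∣∣-lower {Sa} Sα))) (plus (∣∣-lower {Sb} Sβ))) (0≤-diff (∣∣-upper {B - Φ * α g} (bil cg)))) (0≤* (0≤* (ι-≥0 3) ε≥0)
              (0≤-diff (1≤φ q))))
        (trans (lem Φ (α g) ε Sa Sb B) (cong (λ z → Φ * (- (1ℚ + ι 3 * ε)) + (z + (ε + Sa) + (ε + Sb) + (ε - (B - Φ * α g)) + (ι 3 * ε) *
            (Φ - 1ℚ))) (sym expand))))
      where
      Sa = Σ q (λ r → u r * α r)
      Sb = Σ q (λ r → u r * β r)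
      B = bilinear q g α β
      plus : ∀ {a e} → - e ≤ a → 0ℚ ≤ e + a
      plus {a} {e} p = subst (0ℚ ≤_) (l a e) (0≤-diff p)
        where l : ∀ a e → a - (- e) ≡ e + a
              l = solve-∀ ℚring
      l₁ : ∀ i a b → i * ((1ℚ - a) * (1ℚ - b)) ≡ (i * 1ℚ - i * a) - i * b + i * (a * b)
      l₁ = solve-∀ ℚring
      expand : Σ q (λ r → Σ q (λ s → I g r s * ((1ℚ - α r) * (1ℚ - β s)))) ≡ (Φ * 1ℚ - Sa) - Sb + B
      expand = trans (Σ-ext q λ r → trans (Σ-ext q λ s → l₁ (I g r s) (α r) (β s))
          (trans (Σ-+ q (λ s → I g r s * 1ℚ - I g r s * α r - I g r s * β s) (λ s → I g r s * (α r * β s)))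
            (cong (_+ Σ q (λ s → I g r s * (α r * β s))) (trans (Σ-diff q (λ s → I g r s * 1ℚ - I g r s * α r) (λ s → I g r s * β s))
              (cong (_- Σ q (λ s → I g r s * β s)) (Σ-diff q (λ s → I g r s * 1ℚ) (λ s → I g r s * α r)))))))
        (trans (Σ-+ q (λ r → Σ q (λ s → I g r s * 1ℚ) - Σ q (λ s → I g r s * α r) - Σ q (λ s → I g r s * β s)) (λ r → Σ q (λ s → I g r s *
            (α r * β s))))
          (cong (_+ B) (trans (Σ-diff q (λ r → Σ q (λ s → I g r s * 1ℚ) - Σ q (λ s → I g r s * α r)) (λ r → Σ q (λ s → I g r s * β s)))
            (cong₂ _-_ (trans (Σ-diff q (λ r → Σ q (λ s → I g r s * 1ℚ)) (λ r → Σ q (λ s → I g r s * α r))) (cong₂ _-_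
                (Σ-bilinear-const cg 1ℚ) (Σ-bilinear-left cg α))) (Σ-bilinear-right cg β)))))
      lem : ∀ f a e Sa Sb B → f * a ≡ f * (- (1ℚ + ι 3 * e)) + (((f * 1ℚ - Sa) - Sb + B) + (e + Sa) + (e + Sb) + (e - (B - f * a)) +
          (ι 3 * e) * (f - 1ℚ))
      lem = solve-∀ ℚring

    -- If the average of the products α(r) β(s), each at most c, is close to c then so is every single product.
    bilinear-extremal : ∀ {c σ g r s} (α β : ℕ → ℚ) → Periodic q α → Periodic q β → Coprime g q →
      (∀ r s → Coprime r q → Coprime s q → σ * (α r * β s) ≤ c) → (r ℕ.* s) % q ≡ g % q →
      c - σ * (α r * β s) ≤ φ q * c - σ * bilinear q g α β
    bilinear-extremal {c} {σ} {g} {r} {s} α β pα pβ cg bound e = subst (c - σ * (α r * β s) ≤_) total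
      (≤-trans (≤-reflexive (sym (trans (𝟙*-yes (_≈?_ q (r′ ℕ.* s′) g) e′ _) (cong₂ (λ a b → c - σ * (a * b)) (pα r′ r (sym (rep-≈ q r)))
          (pβ s′ s (sym (rep-≈ q s)))))))
        (≤-trans (Σ-term q s′ {λ s → I g r′ s * (c - σ * (α r′ * β s))} (1≤rep q s) (rep≤ q s) λ j _ _ → term-≥0 r′ j)
          (Σ-term q r′ {λ r → Σ q (λ s → I g r s * (c - σ * (α r * β s)))} (1≤rep q r) (rep≤ q r) λ i _ _ → Σ-≥0 q λ j _ _ → term-≥0 i j)))
      where
      r′ = rep q r
      s′ = rep q s
      e′ : (r′ ℕ.* s′) % q ≡ g % q
      e′ = trans (≈-* q {r′} {r} {s′} {s} (sym (rep-≈ q r)) (sym (rep-≈ q s))) e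
      term-≥0 : ∀ i j → 0ℚ ≤ I g i j * (c - σ * (α i * β j))
      term-≥0 i j = go (_≈?_ q (i ℕ.* j) g)
        where
        go : (d : Dec ((i ℕ.* j) % q ≡ g % q)) → 0ℚ ≤ 𝟙 d * (c - σ * (α i * β j))
        go (no _)  = ≤-reflexive (sym (ℚ.*-zeroˡ (c - σ * (α i * β j))))
        go (yes d) = 0≤* 0≤1 (0≤-diff (bound i j (λ {k} → class-unit q {i} {j} {g} cg d .proj₁ {k}) (λ {k}
            → class-unit q {i} {j} {g} cg d .proj₂ {k})))
      l₁ : ∀ i c σ p → i * (c - σ * p) ≡ i * c - σ * (i * p)
      l₁ = solve-∀ ℚring
      total : Σ q (λ r → Σ q (λ s → I g r s * (c - σ * (α r * β s)))) ≡ Φ * c - σ * bilinear q g α β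
      total = trans (Σ-ext q λ r → trans (Σ-ext q λ s → l₁ (I g r s) c σ (α r * β s)) (trans (Σ-diff q (λ s → I g r s * c) (λ s → σ *
          (I g r s * (α r * β s))))
          (cong (λ z → Σ q (λ s → I g r s * c) - z) (Σ-*ˡ q σ (λ s → I g r s * (α r * β s))))))
        (trans (Σ-diff q (λ r → Σ q (λ s → I g r s * c)) (λ r → σ * Σ q (λ s → I g r s * (α r * β s))))
          (cong₂ _-_ (Σ-bilinear-const cg c) (Σ-*ˡ q σ (λ r → Σ q (λ s → I g r s * (α r * β s))))))

  -- Three functions with values at most 1, whose twisted convolutions nearly reproduce them (as for 0/1-valued Fourier
  -- transforms) and one of which is nearly 1 at a, are nearly ±1 everywhere; the signs then form a character.
  module Rounding (q : ℕ) .{{q≢0 : NonZero q}} {ε : ℚ} {e₀ e₁ e₂ : ℕ → ℚ} {a : ℕ} (ca : Coprime a q)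
    (ε≥0 : 0ℚ ≤ ε) (small : ι 100 * (φ q * φ q * ε) ≤ 1ℚ)
    (p₁ : Periodic q e₁) (p₂ : Periodic q e₂) (e₀≤1 : ∀ n → e₀ n ≤ 1ℚ) (e₁≤1 : ∀ n → e₁ n ≤ 1ℚ) (e₂≤1 : ∀ n → e₂ n ≤ 1ℚ)
    (S₀ : ∣ Σ q (λ r → unit q r * e₀ r) ∣ ≤ ε) (S₁ : ∣ Σ q (λ r → unit q r * e₁ r) ∣ ≤ ε) (S₂ : ∣ Σ q (λ r → unit q r * e₂ r) ∣ ≤ ε)
    (A₀₁ : ∀ {g} → Coprime g q → ∣ bilinear q g e₁ e₀ - φ q * e₁ g ∣ ≤ ε)
    (A₀₂ : ∀ {g} → Coprime g q → ∣ bilinear q g e₂ e₀ - φ q * e₂ g ∣ ≤ ε)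
    (A₁₂ : ∀ {g} → Coprime g q → ∣ bilinear q g e₂ e₁ - φ q * e₂ g ∣ ≤ ε)
    (at-a : 1ℚ - ε ≤ e₂ a) where

    private
      -- `β` bounds the absolute values of e₁ and e₂ at units, and `c` those of their products; `b`
      -- and `d` are `ε` enlarged by one and by two sums over the φ classes.
      Φ b d β c : ℚ
      Φ = φ q
      b = Φ * ε
      d = Φ * Φ * ε
      β = 1ℚ + ι 3 * ε
      c = 1ℚ + ι 7 * ε
      Φ≥0 : 0ℚ ≤ Φ
      Φ≥0 = ≤-trans 0≤1 (1≤φ q)
      ε≤b : ε ≤ b
      ε≤b = ≤-trans (≤-reflexive (sym (ℚ.*-identityˡ ε))) (*-monoˡ ε≥0 (1≤φ q))
      b≤d : b ≤ d
      b≤d = ≤-trans (≤-reflexive (sym (ℚ.*-identityˡ b))) (≤-trans (*-monoˡ (≤-trans ε≥0 ε≤b) (1≤φ q)) (≤-reflexive (sym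
          (ℚ.*-assoc Φ Φ ε))))
      b≥0 : 0ℚ ≤ b
      b≥0 = ≤-trans ε≥0 ε≤b
      d≥0 : 0ℚ ≤ d
      d≥0 = ≤-trans b≥0 b≤d
      100ε≤1 : ι 100 * ε ≤ 1ℚ
      100ε≤1 = ≤-trans (*-monoʳ (ι-≥0 100) (≤-trans ε≤b b≤d)) small
      9ε²≤ε : ι 9 * (ε * ε) ≤ ε
      9ε²≤ε = ≤-by ((1ℚ - ι 100 * ε) * ε + ι 91 * (ε * ε)) (0≤+ (0≤* (0≤-diff 100ε≤1) ε≥0) (0≤* (ι-≥0 91) (0≤* ε≥0 ε≥0))) (lem ε)
        where lem : ∀ e → e ≡ ι 9 * (e * e) + ((1ℚ - ι 100 * e) * e + ι 91 * (e * e))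
              lem = solve-∀ ℚring
      1≤β : 1ℚ ≤ β
      1≤β = ≤-by (ι 3 * ε) (0≤* (ι-≥0 3) ε≥0) refl
      β²≤c : β * β ≤ c
      β²≤c = ≤-by (ε - ι 9 * (ε * ε)) (0≤-diff 9ε²≤ε) (lem ε)
        where lem : ∀ e → 1ℚ + ι 7 * e ≡ (1ℚ + ι 3 * e) * (1ℚ + ι 3 * e) + (e - ι 9 * (e * e))
              lem = solve-∀ ℚring

      abs₁ : ∀ {n} → Coprime n q → ∣ e₁ n ∣ ≤ β
      abs₁ {n} cn = ∣∣-≤ (≤-trans (e₁≤1 n) 1≤β) (excess-lower q {ε} e₁ e₀ ε≥0 e₁≤1 e₀≤1 S₁ S₀ A₀₁ {n} cn)
      abs₂ : ∀ {n} → Coprime n q → ∣ e₂ n ∣ ≤ β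
      abs₂ {n} cn = ∣∣-≤ (≤-trans (e₂≤1 n) 1≤β) (excess-lower q {ε} e₂ e₀ ε≥0 e₂≤1 e₀≤1 S₂ S₀ A₀₂ {n} cn)

      ±-abs : ∀ {σ} → σ ≡ 1ℚ ⊎ σ ≡ - 1ℚ → ∣ σ ∣ ≤ 1ℚ
      ±-abs (inj₁ refl) = ≤-refl
      ±-abs (inj₂ refl) = ≤-refl

      -- φ products, each at most `c` in absolute value, add up to about φ e₂(g); if e₂(g) is nearly
      -- σ, no single product can fall far short of σ.
      product-lower : ∀ {σ κ g r s} → σ ≡ 1ℚ ⊎ σ ≡ - 1ℚ → Coprime g q → 1ℚ - κ ≤ σ * e₂ g → (r ℕ.* s) % q ≡ g % q →
        1ℚ - ι 7 * b - Φ * κ ≤ σ * (e₂ r * e₁ s)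
      product-lower {σ} {κ} {g} {r} {s} σ± cg near e = ≤-by
        ((Φ * c - σ * B - (c - σ * (e₂ r * e₁ s))) + Φ * (σ * e₂ g - (1ℚ - κ)) + (1ℚ * ε + σ * (B - Φ * e₂ g)) + ι 6 * ε)
        (0≤+ (0≤+ (0≤+ (0≤-diff (bilinear-extremal q {c} {σ} {g} {r} {s} e₂ e₁ p₂ p₁ cg bound e)) (0≤* Φ≥0 (0≤-diff near)))
          (subst (0ℚ ≤_) (l₁ (1ℚ * ε) (σ * (B - Φ * e₂ g))) (0≤-diff (∣∣-lower {σ * (B - Φ * e₂ g)} (∣∣-* {σ} {B - Φ * e₂ g} (±-abs σ±)
              (A₁₂ {g} cg))))))
          (0≤* (ι-≥0 6) ε≥0))
        (lem Φ ε σ κ B (e₂ g) (e₂ r * e₁ s))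
        where
        B = bilinear q g e₂ e₁
        l₁ : ∀ a x → x - (- a) ≡ a + x
        l₁ = solve-∀ ℚring
        lem : ∀ f e σ k B eg p → σ * p ≡ (1ℚ - ι 7 * (f * e) - f * k) +
          ((f * (1ℚ + ι 7 * e) - σ * B - ((1ℚ + ι 7 * e) - σ * p)) + f * (σ * eg - (1ℚ - k)) + (1ℚ * e + σ * (B - f * eg)) + ι 6 * e)
        lem = solve-∀ ℚring
        bound : ∀ r s → Coprime r q → Coprime s q → σ * (e₂ r * e₁ s) ≤ c
        bound r s cr cs = ≤-trans (∣∣-upper {σ * (e₂ r * e₁ s)} (∣∣-* {σ} {e₂ r * e₁ s} (±-abs σ±) (∣∣-* {e₂ r} {e₁ s} (abs₂ {r} cr)
            (abs₁ {s} cs))))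
          (≤-trans (≤-reflexive (ℚ.*-identityˡ (β * β))) β²≤c)

      at-a-product : ∀ {r s} → (r ℕ.* s) % q ≡ a % q → 1ℚ - ι 8 * b ≤ e₂ r * e₁ s
      at-a-product {r} {s} e = ≤-trans (≤-reflexive (l₁ Φ ε)) (≤-trans (product-lower {1ℚ} {ε} {a} {r} {s} (inj₁ refl) ca (≤-trans at-a
          (≤-reflexive (sym (ℚ.*-identityˡ (e₂ a))))) e)
        (≤-reflexive (ℚ.*-identityˡ (e₂ r * e₁ s))))
        where l₁ : ∀ f e → 1ℚ - ι 8 * (f * e) ≡ 1ℚ - ι 7 * (f * e) - f * e
              l₁ = solve-∀ ℚring

      -- The other factor is at most `β`, so a product near 1 keeps x away from 0.
      factor-lower : ∀ {x y} → ∣ x ∣ ≤ β → ∣ y ∣ ≤ β → 1ℚ - ι 8 * b ≤ x * y → 1ℚ - ι 12 * b ≤ ∣ x ∣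
      factor-lower {x} {y} x≤ y≤ le = ≤-by
        ((∣ x ∣ * β - (1ℚ - ι 8 * b)) + (ι 3 * ε) * (β - ∣ x ∣) + (ε - ι 9 * (ε * ε)) + ι 4 * (b - ε))
        (0≤+ (0≤+ (0≤+ (0≤-diff (≤-trans le (≤-trans (x≤∣x∣ (x * y)) (∣∣-* {x} {y} ≤-refl y≤)))) (0≤* (0≤* (ι-≥0 3) ε≥0) (0≤-diff x≤)))
            (0≤-diff 9ε²≤ε)) (0≤* (ι-≥0 4) (0≤-diff ε≤b)))
        (lem ∣ x ∣ ε b)
        where lem : ∀ x e b → x ≡ (1ℚ - ι 12 * b) + ((x * (1ℚ + ι 3 * e) - (1ℚ - ι 8 * b)) + (ι 3 * e) * ((1ℚ + ι 3 * e) - x) + (e - ι 9 *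
                  (e * e)) + ι 4 * (b - e))
              lem = solve-∀ ℚring

      near₂ : ∀ {r} → Coprime r q → 1ℚ - ι 12 * b ≤ ∣ e₂ r ∣
      near₂ {r} cr = let s , cs , e , _ = divide q {r} {a} cr ca in
        factor-lower {e₂ r} {e₁ s} (abs₂ {r} cr) (abs₁ {s} cs) (at-a-product {r} {s} e)

      near₁ : ∀ {s} → Coprime s q → 1ℚ - ι 12 * b ≤ ∣ e₁ s ∣
      near₁ {s} cs = let r , cr , e , _ = divide q {s} {a} cs ca in
        factor-lower {e₁ s} {e₂ r} (abs₁ {s} cs) (abs₂ {r} cr) (≤-trans (at-a-product {r} {s} (trans (cong (_% q) (ℕ.*-comm r s)) e))
            (≤-reflexive (ℚ.*-comm (e₂ r) (e₁ s))))

      d≤ : ι 50 * d ≤ ½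
      d≤ = *-cancelˡ {ι 2} {ι 50 * d} {½} (0<ι {2} z<s) (≤-trans (≤-reflexive (lem d)) small)
        where lem : ∀ d → ι 2 * (ι 50 * d) ≡ ι 100 * d
              lem = solve-∀ ℚring

      -- The room that the factor 100 in `small` provides: 25b + 25d ≤ 50d ≤ 1/2.
      ½≤ : ∀ k l → k ℕ.≤ 25 → l ℕ.≤ 25 → ½ ≤ 1ℚ - ι k * b - ι l * d
      ½≤ k l k≤ l≤ = ≤-by ((½ - ι 50 * d) + ((ι 25 * d - ι k * b) + (ι 25 * d - ι l * d)))
          (0≤+ (0≤-diff d≤) (0≤+ (0≤-diff (*-mono {ι k} {ι 25} {b} {d} (ι-≥0 25) b≥0 (ι-mono k≤) b≤d)) (0≤-diff (*-monoˡ d≥0 (ι-mono l≤)))))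
          (lem (ι k) (ι l) b d)
        where lem : ∀ k l b d → 1ℚ - k * b - l * d ≡ ½ + ((½ - ι 50 * d) + ((ι 25 * d - k * b) + (ι 25 * d - l * d)))
              lem = solve-∀ ℚring

      0<½ : 0ℚ < ½
      0<½ = ℚ.positive⁻¹ ½

      ½≤near : ½ ≤ 1ℚ - ι 12 * b
      ½≤near = ≤-trans (½≤ 12 0 (ℕ.m≤m+n 12 13) z≤n) (≤-reflexive (lem b d))
        where lem : ∀ b d → 1ℚ - ι 12 * b - ι 0 * d ≡ 1ℚ - ι 12 * b
              lem = solve-∀ ℚring

      -- At a the extremality is given; `near₂` extends it to every unit g, so all products over r s
      -- ≡ g take the sign of e₂(g).
      sign-rule : ∀ {r s} → Coprime r q → Coprime s q → sg (e₂ (r ℕ.* s)) ≡ sg (e₂ r) * sg (e₁ s)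
      sign-rule {r} {s} cr cs = sg-* {e₂ r} {e₁ s} {sg (e₂ g)} (sg-values (e₂ g)) (ℚ.<-≤-trans 0<½ (≤-trans (≤-trans (½≤ 7 12 (ℕ.m≤m+n 7 18)
          (ℕ.m≤m+n 12 13)) (≤-reflexive (l Φ ε)))
          (product-lower {sg (e₂ g)} {ι 12 * b} {g} {r} {s} (sg-values (e₂ g)) (λ {k} → cg {k}) (≤-trans (near₂ {g} (λ {k} → cg {k}))
              (≤-reflexive (sym (sg-abs (e₂ g))))) refl)))
        where
        g = r ℕ.* s
        cg : Coprime g q
        cg {k} = coprime-* {r} {s} cr cs {k}
        l : ∀ f e → 1ℚ - ι 7 * (f * e) - ι 12 * (f * f * e) ≡ 1ℚ - ι 7 * (f * e) - f * (ι 12 * (f * e))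
        l = solve-∀ ℚring

    ψ : ℕ → ℚ
    ψ n = unit q n * sg (e₁ n)

    private
      t = sg (e₂ 1)

      -- `sign-rule` relates two different functions. Taking r = 1 shows that their signs agree up
      -- to the constant `t`, which cancels because its square is 1.
      sign-mult : ∀ {m n} → Coprime m q → Coprime n q → sg (e₁ (m ℕ.* n)) ≡ sg (e₁ m) * sg (e₁ n)
      sign-mult {m} {n} cm cn = begin
        sg (e₁ (m ℕ.* n)) ≡⟨ l₁ (sg (e₁ (m ℕ.* n))) ⟩
        1ℚ * sg (e₁ (m ℕ.* n)) ≡⟨ cong (_* sg (e₁ (m ℕ.* n))) (sym (sg-sq (e₂ 1))) ⟩
        t * t * sg (e₁ (m ℕ.* n)) ≡⟨ ℚ.*-assoc t t (sg (e₁ (m ℕ.* n))) ⟩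
        t * (t * sg (e₁ (m ℕ.* n))) ≡⟨ cong (t *_) (sym (twist {m ℕ.* n} (λ {k} → coprime-* {m} {n} cm cn {k}))) ⟩
        t * sg (e₂ (m ℕ.* n)) ≡⟨ cong (t *_) (trans (sign-rule {m} {n} cm cn) (cong (_* sg (e₁ n)) (twist {m} cm))) ⟩
        t * ((t * sg (e₁ m)) * sg (e₁ n)) ≡⟨ l₂ t (sg (e₁ m)) (sg (e₁ n)) ⟩
        (t * t) * (sg (e₁ m) * sg (e₁ n)) ≡⟨ cong (_* (sg (e₁ m) * sg (e₁ n))) (sg-sq (e₂ 1)) ⟩
        1ℚ * (sg (e₁ m) * sg (e₁ n)) ≡⟨ sym (l₁ (sg (e₁ m) * sg (e₁ n))) ⟩
        sg (e₁ m) * sg (e₁ n) ∎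
        where
        open ≡-Reasoning
        l₁ : ∀ a → a ≡ 1ℚ * a
        l₁ = solve-∀ ℚring
        l₂ : ∀ t a b → t * ((t * a) * b) ≡ (t * t) * (a * b)
        l₂ = solve-∀ ℚring
        twist : ∀ {k} → Coprime k q → sg (e₂ k) ≡ t * sg (e₁ k)
        twist {k} ck = trans (cong (λ z → sg (e₂ z)) (sym (ℕ.*-identityˡ k))) (sign-rule {1} {k} (λ {j} → coprime-1 q {j}) ck)

      ψ-unit : ∀ {n} → Coprime n q → ψ n ≡ sg (e₁ n)
      ψ-unit {n} cn = trans (cong (_* sg (e₁ n)) (unit-yes q {n} cn)) (ℚ.*-identityˡ (sg (e₁ n)))

      ψ-vanish : ∀ n → ¬ Coprime n q → ψ n ≡ 0ℚ
      ψ-vanish n ¬c = trans (cong (_* sg (e₁ n)) (unit-no q {n} ¬c)) (ℚ.*-zeroˡ (sg (e₁ n)))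

      ψ-mult : ∀ m n → ψ (m ℕ.* n) ≡ ψ m * ψ n
      ψ-mult m n = trans (cong (_* sg (e₁ (m ℕ.* n))) (unit-* q m n)) (go (coprime? m q) (coprime? n q))
        where
        go : (x : Dec (Coprime m q)) (y : Dec (Coprime n q)) → 𝟙 x * 𝟙 y * sg (e₁ (m ℕ.* n)) ≡ (𝟙 x * sg (e₁ m)) * (𝟙 y * sg (e₁ n))
        go (yes cm) (yes cn) = trans (cong (1ℚ * 1ℚ *_) (sign-mult {m} {n} cm cn)) (l (sg (e₁ m)) (sg (e₁ n)))
          where l : ∀ a b → 1ℚ * 1ℚ * (a * b) ≡ (1ℚ * a) * (1ℚ * b)
                l = solve-∀ ℚring
        go (yes _) (no _) = l (sg (e₁ (m ℕ.* n))) (sg (e₁ m)) (sg (e₁ n))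
          where l : ∀ x a b → 1ℚ * 0ℚ * x ≡ (1ℚ * a) * (0ℚ * b)
                l = solve-∀ ℚring
        go (no _) y = l (𝟙 y) (sg (e₁ (m ℕ.* n))) (sg (e₁ m)) (sg (e₁ n))
          where l : ∀ y x a b → 0ℚ * y * x ≡ (0ℚ * a) * (y * b)
                l = solve-∀ ℚring

      ψ-periodic : Periodic q ψ
      ψ-periodic m n e = cong₂ _*_ (unit-periodic q m n e) (cong sg (p₁ m n e))

      Σ-ψ-translate : ∀ {k} → Coprime k q → ψ k * Σ q ψ ≡ Σ q ψ
      Σ-ψ-translate {k} ck = trans (sym (Σ-*ˡ q (ψ k) ψ)) (trans (Σ-ext q λ m → sym (ψ-mult k m))
          (Σ-unit-* q {k} ck {ψ} ψ-periodic ψ-vanish))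

      Σ-half : ∀ {F : ℕ → ℚ} → (∀ n → Coprime n q → ½ ≤ F n) → ½ * Φ ≤ Σ q (λ r → unit q r * F r)
      Σ-half {F} low = ≤-trans (≤-reflexive (trans (ℚ.*-comm ½ Φ) (sym (Σ-*ʳ q ½ (unit q))))) (Σ-mono q {λ r → unit q r * ½} λ r _ _ → go r
          (coprime? r q))
        where
        go : ∀ r → (x : Dec (Coprime r q)) → 𝟙 x * ½ ≤ 𝟙 x * F r
        go r (yes cr) = *-monoʳ 0≤1 (low r cr)
        go r (no _) = ≤-reflexive (trans (ℚ.*-zeroˡ ½) (sym (ℚ.*-zeroˡ (F r))))

      -- Translation by k multiplies the sum by ψ(k), so a nonzero sum makes every sign positive.
      -- Then e₁ ≥ 1/2 at all units, contrary to `S₁`.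
      ψ-zero-sum : Σ q ψ ≡ 0ℚ
      ψ-zero-sum = go (Σ q ψ ℚ.≟ 0ℚ)
        where
        go : Dec (Σ q ψ ≡ 0ℚ) → Σ q ψ ≡ 0ℚ
        go (yes z) = z
        go (no ≢0) = ⊥-elim (<⇒≱ (ℚ.<-≤-trans ε<½ (≤-trans half (Σ-half {e₁} positive))) (∣∣-upper {Σ q (λ r → unit q r * e₁ r)} S₁))
          where
          half : ½ ≤ ½ * Φ
          half = ≤-trans (≤-reflexive (sym (ℚ.*-identityʳ ½))) (*-monoʳ (<⇒≤ 0<½) (1≤φ q))
          ε<½ : ε < ½
          ε<½ = ℚ.≰⇒> λ ½≤ε → <⇒≱ (ℚ.+-monoʳ-< 1ℚ 0<1) (≤-trans (*-mono {ι 4} {ι 100} {½} {ε} (ι-≥0 100) (<⇒≤ 0<½) (ι-mono (ℕ.m≤m+n 4 96))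
              ½≤ε) 100ε≤1)
          not-minus : ∀ {n} → Coprime n q → sg (e₁ n) ≡ 1ℚ
          not-minus {n} cn with sg-values (e₁ n)
          ... | inj₁ e = e
          ... | inj₂ e = contradiction (twice (trans (cong (_* Σ q ψ) (sym (trans (ψ-unit {n} cn) e))) (Σ-ψ-translate {n} cn))) ≢0
            where
            twice : ∀ {x} → - 1ℚ * x ≡ x → x ≡ 0ℚ
            twice {x} e = trans (l x) (trans (cong (λ z → ½ * (z - - 1ℚ * x)) (sym e)) (l₂ x))
              where l : ∀ x → x ≡ ½ * (x - - 1ℚ * x)
                    l = solve-∀ ℚring
                    l₂ : ∀ x → ½ * (- 1ℚ * x - - 1ℚ * x) ≡ 0ℚ
                    l₂ = solve-∀ ℚring
          positive : ∀ n → Coprime n q → ½ ≤ e₁ n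
          positive n cn = ≤-trans (≤-trans ½≤near (near₁ {n} cn)) (≤-reflexive (trans (sym (sg-abs (e₁ n))) (trans (cong (_* e₁ n)
              (not-minus {n} cn)) (ℚ.*-identityˡ (e₁ n)))))

    ψ-character : RealCharacter q ψ
    ψ-character = record { periodic = ψ-periodic ; vanish = ψ-vanish ; mult = ψ-mult ; values = values ; zero-sum = ψ-zero-sum }
      where
      values : ∀ n → Coprime n q → ψ n ≡ 1ℚ ⊎ ψ n ≡ - 1ℚ
      values n cn with sg-values (e₁ n)
      ... | inj₁ e = inj₁ (trans (ψ-unit {n} cn) e)
      ... | inj₂ e = inj₂ (trans (ψ-unit {n} cn) e)

    ψ-correlation : ½ * φ q ≤ Σ q (λ r → ψ r * e₁ r)
    ψ-correlation = ≤-trans (Σ-half {λ r → ∣ e₁ r ∣} λ n cn → ≤-trans ½≤near (near₁ {n} cn))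
      (≤-reflexive (Σ-ext q λ r → trans (cong (unit q r *_) (sym (sg-abs (e₁ r)))) (sym (ℚ.*-assoc (unit q r) (sg (e₁ r)) (e₁ r)))))

  -- Lower bound for L(1, ψ)

  -- The sum of x^j over j ≤ k in Horner form; at x = ψ(p) it is the value of 1 ∗ ψ at p^k.
  geometric : ℚ → ℕ → ℚ
  geometric x zero    = 1ℚ
  geometric x (suc k) = 1ℚ + x * geometric x k

  Sign : ℚ → Set
  Sign x = x ≡ 0ℚ ⊎ x ≡ 1ℚ ⊎ x ≡ - 1ℚ

  geometric-≥0 : ∀ {x} → Sign x → ∀ k → 0ℚ ≤ geometric x k
  geometric-≥0 (inj₁ refl) zero    = 0≤1
  geometric-≥0 (inj₁ refl) (suc k) = ≤-trans 0≤1 (≤-reflexive (lem (geometric 0ℚ k)))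
    where lem : ∀ a → 1ℚ ≡ 1ℚ + 0ℚ * a
          lem = solve-∀ ℚring
  geometric-≥0 (inj₂ (inj₁ refl)) zero    = 0≤1
  geometric-≥0 (inj₂ (inj₁ refl)) (suc k) = 0≤+ 0≤1 (0≤* 0≤1 (geometric-≥0 (inj₂ (inj₁ refl)) k))
  geometric-≥0 (inj₂ (inj₂ refl)) k = go k .proj₁
    where
    go : ∀ k → 0ℚ ≤ geometric (- 1ℚ) k × geometric (- 1ℚ) k ≤ 1ℚ
    go zero = 0≤1 , ≤-refl
    go (suc k) with go k
    ... | lo , up = ≤-trans (0≤-diff up) (≤-reflexive (lem (geometric (- 1ℚ) k)))
      , ≤-by (geometric (- 1ℚ) k) lo (lem₂ (geometric (- 1ℚ) k))
      where lem : ∀ a → 1ℚ - a ≡ 1ℚ + (- 1ℚ) * a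
            lem = solve-∀ ℚring
            lem₂ : ∀ a → 1ℚ ≡ (1ℚ + (- 1ℚ) * a) + a
            lem₂ = solve-∀ ℚring

  geometric-even : ∀ {x} → Sign x → ∀ k → 1ℚ ≤ geometric x (k ℕ.+ k)
  geometric-even s zero = ≤-refl
  geometric-even {x} s (suc k) = subst (λ j → 1ℚ ≤ geometric x (suc j)) (sym (ℕ.+-suc k k)) (go s)
    where
    go : Sign x → 1ℚ ≤ 1ℚ + x * (1ℚ + x * geometric x (k ℕ.+ k))
    go (inj₁ refl) = ≤-reflexive (lem (geometric 0ℚ (k ℕ.+ k)))
      where lem : ∀ a → 1ℚ ≡ 1ℚ + 0ℚ * (1ℚ + 0ℚ * a)
            lem = solve-∀ ℚring
    go (inj₂ (inj₁ refl)) = ≤-by (1ℚ + geometric 1ℚ (k ℕ.+ k)) (0≤+ 0≤1 (geometric-≥0 s (k ℕ.+ k))) (lem (geometric 1ℚ (k ℕ.+ k)))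
      where lem : ∀ a → 1ℚ + 1ℚ * (1ℚ + 1ℚ * a) ≡ 1ℚ + (1ℚ + a)
            lem = solve-∀ ℚring
    go (inj₂ (inj₂ refl)) = ≤-trans (geometric-even s k) (≤-reflexive (lem (geometric (- 1ℚ) (k ℕ.+ k))))
      where lem : ∀ a → a ≡ 1ℚ + (- 1ℚ) * (1ℚ + (- 1ℚ) * a)
            lem = solve-∀ ℚring

  factor-out : ∀ {p} → Prime p → ∀ n → 1 ℕ.≤ n → ∃ λ k → ∃ λ m → 1 ℕ.≤ m × ¬ (p ∣ m) × n ≡ p ℕ.^ k ℕ.* m
  factor-out {p} pp = split-by pp (λ n → ∃ λ k → ∃ λ m → 1 ℕ.≤ m × ¬ (p ∣ m) × n ≡ p ℕ.^ k ℕ.* m)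
    (λ m 1≤m ¬p∣m → 0 , m , 1≤m , ¬p∣m , sym (ℕ.*-identityˡ m))
    (λ n _ (k , m , 1≤m , ¬p∣m , e) → suc k , m , 1≤m , ¬p∣m , trans (cong (p ℕ.*_) e) (sym (ℕ.*-assoc p (p ℕ.^ k) m)))

  ^-≥1 : ∀ {p} → 1 ℕ.≤ p → ∀ k → 1 ℕ.≤ p ℕ.^ k
  ^-≥1 1≤p zero    = z<s
  ^-≥1 1≤p (suc k) = *-≥1 1≤p (^-≥1 1≤p k)

  module _ {ψ : ℕ → ℚ} (ψ-one : ψ 1 ≡ 1ℚ) (ψ-mult : ∀ m n → ψ (m ℕ.* n) ≡ ψ m * ψ n) (ψ-sign : ∀ n → Sign (ψ n)) where

    -- The multiplicativity of 1 ∗ ψ, in the only case that an induction over the prime powers in n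
    -- uses.
    D-prime-power : ∀ {p m} → Prime p → 1 ℕ.≤ m → ¬ p ∣ m → ∀ k → D (p ℕ.^ k ℕ.* m) ψ ≡ geometric (ψ p) k * D m ψ
    D-prime-power {p} {m} pp 1≤m ¬p∣m zero = trans (cong (λ n → D n ψ) (ℕ.*-identityˡ m)) (sym (ℚ.*-identityˡ (D m ψ)))
    D-prime-power {p} {m} pp 1≤m ¬p∣m (suc k) = trans (cong (λ n → D n ψ) (ℕ.*-assoc p (p ℕ.^ k) m))
      (trans (D-split pp N (1≤N k) ψ) (trans (cong₂ _+_ (free k) (trans (D-cong N λ e _ _ → ψ-mult p e) (trans (D-*ˡ N (ψ p) ψ) (cong
          (ψ p *_) (D-prime-power pp 1≤m ¬p∣m k)))))
      (lem (D m ψ) (ψ p) (geometric (ψ p) k))))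
      where
      N = p ℕ.^ k ℕ.* m
      1≤N : ∀ k → 1 ℕ.≤ p ℕ.^ k ℕ.* m
      1≤N k = *-≥1 (^-≥1 (prime-≥1 pp) k) 1≤m
      lem : ∀ d x g → d + x * (g * d) ≡ (1ℚ + x * g) * d
      lem = solve-∀ ℚring
      free : ∀ k → D (p ℕ.^ k ℕ.* m) (λ d → 𝟙 (¬? (p ∣? d)) * ψ d) ≡ D m ψ
      free zero    = trans (cong (λ n → D n (λ d → 𝟙 (¬? (p ∣? d)) * ψ d)) (ℕ.*-identityˡ m)) (D-coprime-free ¬p∣m ψ)
      free (suc k) = trans (cong (λ n → D n (λ d → 𝟙 (¬? (p ∣? d)) * ψ d)) (ℕ.*-assoc p (p ℕ.^ k) m)) (trans (D-coprime-* pp (1≤N k) ψ)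
          (free k))

    private
      smaller : ∀ {p m} k → Prime p → 1 ℕ.≤ m → ¬ p ∣ m → p ∣ p ℕ.^ k ℕ.* m → m ℕ.< p ℕ.^ k ℕ.* m
      smaller {p} {m} zero    pp 1≤m ¬p∣m p∣ = contradiction (subst (p ∣_) (ℕ.*-identityˡ m) p∣) ¬p∣m
      smaller {p} {m} (suc k) pp 1≤m _ _ = ℕ.<-≤-trans (ℕ.m<m*n m p {{ℕ.>-nonZero 1≤m}} (prime-≥2 pp))
        (ℕ.≤-trans (ℕ.≤-reflexive (ℕ.*-comm m p)) (ℕ.*-monoˡ-≤ m (ℕ.m≤m*n p (p ℕ.^ k) {{ℕ.>-nonZero (^-≥1 (prime-≥1 pp) k)}})))

    D-character-≥0 : ∀ n → 1 ℕ.≤ n → 0ℚ ≤ D n ψ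
    D-character-≥0 = ℕInd.<-rec _ go
      where
      go : ∀ n → (∀ {m} → m ℕ.< n → 1 ℕ.≤ m → 0ℚ ≤ D m ψ) → 1 ℕ.≤ n → 0ℚ ≤ D n ψ
      go n rec 1≤n with prime-factor n 1≤n
      ... | inj₁ refl = ≤-trans 0≤1 (≤-reflexive (sym (trans (D-one ψ) ψ-one)))
      ... | inj₂ (p , m₀ , pp , _ , e) with factor-out pp n 1≤n
      ... | k , m , 1≤m , ¬p∣m , refl = subst (0ℚ ≤_) (sym (D-prime-power pp 1≤m ¬p∣m k))
        (0≤* (geometric-≥0 (ψ-sign p) k) (rec (smaller k pp 1≤m ¬p∣m (subst (p ∣_) (sym e) (p∣p*m p m₀))) 1≤m))

    D-character-square : ∀ n → 1 ℕ.≤ n → 1ℚ ≤ D (n ℕ.* n) ψ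
    D-character-square = ℕInd.<-rec _ go
      where
      go : ∀ n → (∀ {m} → m ℕ.< n → 1 ℕ.≤ m → 1ℚ ≤ D (m ℕ.* m) ψ) → 1 ℕ.≤ n → 1ℚ ≤ D (n ℕ.* n) ψ
      go n rec 1≤n with prime-factor n 1≤n
      ... | inj₁ refl = ≤-reflexive (sym (trans (D-one ψ) ψ-one))
      ... | inj₂ (p , m₀ , pp , _ , e) with factor-out pp n 1≤n
      ... | k , m , 1≤m , ¬p∣m , refl = subst (1ℚ ≤_) (sym (trans (cong (λ n → D n ψ) square) (D-prime-power pp (*-≥1 1≤m 1≤m) ¬p∣mm
          (k ℕ.+ k))))
        (≤-trans (≤-reflexive (sym (ℚ.*-identityˡ 1ℚ))) (*-mono {1ℚ} {geometric (ψ p) (k ℕ.+ k)} {1ℚ} {D (m ℕ.* m) ψ} (geometric-≥0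
            (ψ-sign p) (k ℕ.+ k)) 0≤1 (geometric-even (ψ-sign p) k)
          (rec (smaller k pp 1≤m ¬p∣m (subst (p ∣_) (sym e) (p∣p*m p m₀))) 1≤m)))
        where
        ¬p∣mm : ¬ p ∣ m ℕ.* m
        ¬p∣mm d with euclidsLemma m m pp d
        ... | inj₁ x = ¬p∣m x
        ... | inj₂ x = ¬p∣m x
        square : p ℕ.^ k ℕ.* m ℕ.* (p ℕ.^ k ℕ.* m) ≡ p ℕ.^ (k ℕ.+ k) ℕ.* (m ℕ.* m)
        square = trans (ℕ.[m*n]*[o*p]≡[m*o]*[n*p] (p ℕ.^ k) m (p ℕ.^ k) m) (cong (ℕ._* (m ℕ.* m)) (sym (ℕ.^-distribˡ-+-* p k k)))

  Σ-squares-≤ : ∀ w {f : ℕ → ℚ} → (∀ n → 1 ℕ.≤ n → n ℕ.≤ w ℕ.* w → 0ℚ ≤ f n) → Σ w (λ t → f (t ℕ.* t)) ≤ Σ (w ℕ.* w) f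
  Σ-squares-≤ zero    f≥0 = ≤-refl
  Σ-squares-≤ (suc w) {f} f≥0 = +-mono-≤ (≤-trans (Σ-squares-≤ w λ n 1≤n n≤ → f≥0 n 1≤n (ℕ.≤-trans n≤ (ℕ.<⇒≤ (s≤s w*w≤))))
      (Σ-mono-range w*w≤ λ i lo hi → f≥0 i (ℕ.≤-trans z<s lo) (ℕ.m≤n⇒m≤1+n hi))) ≤-refl
    where w*w≤ : w ℕ.* w ℕ.≤ w ℕ.+ w ℕ.* suc w
          w*w≤ = ℕ.≤-trans (ℕ.*-monoʳ-≤ w (ℕ.n≤1+n w)) (ℕ.m≤n+m (w ℕ.* suc w) w)

  Σ-ι : ∀ n → ι 2 * Σ n ι ≡ ι n * (ι n + 1ℚ)
  Σ-ι zero    = refl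
  Σ-ι (suc n) = trans (ℚ.*-distribˡ-+ (ι 2) (Σ n ι) (ι (suc n))) (trans (cong (_+ ι 2 * ι (suc n)) (Σ-ι n)) (lem (ι n)))
    where lem : ∀ n → n * (n + 1ℚ) + ι 2 * (n + 1ℚ) ≡ (n + 1ℚ) * ((n + 1ℚ) + 1ℚ)
          lem = solve-∀ ℚring

  -- The weight y - n makes the inner sums over multiples of d a decreasing function of d.
  tent : ℕ → ℕ → ℚ
  tent y d = Σ (y // d) (λ m → ι y - ι (d ℕ.* m))

  private
    tent-term : ∀ {y d m} → m ℕ.≤ y // d → d ℕ.* m ℕ.≤ y
    tent-term {y} {d} {m} m≤ = ℕ.≤-trans (ℕ.*-monoʳ-≤ d m≤) (ℕ.≤-trans (ℕ.≤-reflexive (ℕ.*-comm d (y // d))) (//-*≤ y d))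

  tent-≥0 : ∀ y d → 0ℚ ≤ tent y d
  tent-≥0 y d = Σ-≥0 (y // d) λ m _ m≤ → 0≤-diff (ι-mono (tent-term {y} {d} m≤))

  tent-anti : ∀ y d → 1 ℕ.≤ d → tent y (suc d) ≤ tent y d
  tent-anti y d 1≤d = ≤-trans (Σ-mono (y // suc d) {g = λ m → ι y - ι (d ℕ.* m)} λ m _ _ → ℚ.+-monoʳ-≤ (ι y) (ℚ.neg-antimono-≤ (ι-mono
      (ℕ.*-monoˡ-≤ m (ℕ.n≤1+n d)))))
    (Σ-mono-range {y // suc d} {y // d} (//-max {y} {d} 1≤d (ℕ.≤-trans (ℕ.*-monoʳ-≤ (y // suc d) (ℕ.n≤1+n d)) (//-*≤ y (suc d)))) λ m _ m≤
        → 0≤-diff (ι-mono (tent-term {y} {d} m≤)))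

  tent-upper : ∀ y {d} → 1 ℕ.≤ d → tent y d ≤ ι y * ι y * inv d
  tent-upper y {d} 1≤d = ≤-trans (Σ-mono (y // d) {g = λ _ → ι y} λ m _ _ → ≤-by (ι (d ℕ.* m)) (ι-≥0 (d ℕ.* m)) (lem (ι y) (ι (d ℕ.* m))))
    (≤-trans (≤-reflexive (Σ-const (y // d) (ι y))) (≤-trans (*-monoˡ (ι-≥0 y) (ι-cancel {y // d} {d} {y} 1≤d (//-*≤ y d))) (≤-reflexive
        (lem₂ (ι y) (inv d)))))
    where lem : ∀ a b → a ≡ (a - b) + b
          lem = solve-∀ ℚring
          lem₂ : ∀ a b → a * b * a ≡ a * a * b
          lem₂ = solve-∀ ℚring

  -- The model for the tent sum is y²/(2d) - y/2. Without the linear weight, ⌊y/d⌋ and y/d differ by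
  -- O(1), and even the best cut leaves a bound of order √y for the total error, no better than the
  -- guaranteed contribution of the squares.
  tent-error : ℕ → ℕ → ℚ
  tent-error y d = ι 2 * tent y d - (ι y * ι y * inv d - ι y)

  -- With y = Q d + t and 0 ≤ t < d the error is exactly t(d - t)/d.
  tent-approx : ∀ y {d} → 1 ℕ.≤ d → ∣ tent-error y d ∣ ≤ ι d
  tent-approx y {d} 1≤d with //-split y 1≤d
  ... | t , t<d , e = subst (λ z → ∣ z ∣ ≤ ι d) (sym eq) (≤-trans (∣∣-* {ι t} {(ι d - ι t) * inv d} (∣∣-nonneg (ι-≥0 t))
        (≤-trans (∣∣-nonneg (0≤* (0≤-diff t≤d) (inv-≥0 d))) (≤-trans (*-monoˡ {inv d} {ι d - ι t} {ι d} (inv-≥0 d) (≤-by (ι t) (ι-≥0 t) (l₀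
            (ι d) (ι t)))) (≤-reflexive (ι*inv 1≤d)))))
      (≤-trans (≤-reflexive (ℚ.*-identityʳ (ι t))) t≤d))
    where
    t≤d : ι t ≤ ι d
    t≤d = ι-mono (ℕ.<⇒≤ t<d)
    l₀ : ∀ a b → a ≡ (a - b) + b
    l₀ = solve-∀ ℚring
    Q = y // d
    y≡ : ι y ≡ ι Q * ι d + ι t
    y≡ = trans (cong ι e) (trans (ι-+ (Q ℕ.* d) t) (cong (_+ ι t) (ι-* Q d)))
    tent≡ : ι 2 * tent y d ≡ ι 2 * (ι Q * ι y) - ι d * (ι Q * (ι Q + 1ℚ))
    tent≡ = trans (cong (ι 2 *_) (trans (Σ-diff Q (λ _ → ι y) (λ m → ι (d ℕ.* m))) (cong₂ _-_ (Σ-const Q (ι y)) (trans (Σ-ext Q λ m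
        → ι-* d m) (Σ-*ˡ Q (ι d) ι)))))
      (trans (l₁ (ι Q * ι y) (ι d) (Σ Q ι)) (cong (λ z → ι 2 * (ι Q * ι y) - ι d * z) (Σ-ι Q)))
      where l₁ : ∀ a b c → ι 2 * (a - b * c) ≡ ι 2 * a - b * (ι 2 * c)
            l₁ = solve-∀ ℚring
    eq : tent-error y d ≡ ι t * ((ι d - ι t) * inv d)
    eq = trans (cong (_- (ι y * ι y * inv d - ι y)) tent≡) (trans (cong (λ z → ι 2 * (ι Q * z) - ι d * (ι Q * (ι Q + 1ℚ)) -
        (z * z * inv d - z)) y≡)
      (trans (l₂ (ι Q) (ι d) (ι t) (inv d)) (trans (cong (λ z → (ι 2 * (ι Q * ι t) + ι Q * ι Q * ι d) * (1ℚ - z) + (ι d * ι Q) * (1ℚ - 1ℚ) +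
          (ι t - ι t * ι t * inv d)) (ι*inv 1≤d))
        (trans (l₃ (ι Q) (ι d) (ι t) (inv d)) (trans (cong (λ z → ι t * z - ι t * ι t * inv d) (sym (ι*inv 1≤d))) (l₄ (ι t) (ι d)
            (inv d)))))))
      where
      l₂ : ∀ Q d t i → ι 2 * (Q * (Q * d + t)) - d * (Q * (Q + 1ℚ)) - ((Q * d + t) * (Q * d + t) * i - (Q * d + t)) ≡
        (ι 2 * (Q * t) + Q * Q * d) * (1ℚ - d * i) + (d * Q) * (1ℚ - 1ℚ) + (t - t * t * i)
      l₂ = solve-∀ ℚring
      l₃ : ∀ Q d t i → (ι 2 * (Q * t) + Q * Q * d) * (1ℚ - 1ℚ) + (d * Q) * (1ℚ - 1ℚ) + (t - t * t * i) ≡ t * 1ℚ - t * t * i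
      l₃ = solve-∀ ℚring
      l₄ : ∀ t d i → t * (d * i) - t * t * i ≡ t * ((d - t) * i)
      l₄ = solve-∀ ℚring

  module L1 (q : ℕ) .{{q≢0 : NonZero q}} where

    -- With K = q bounding the partial sums of ψ, the squares contribute y w = z⁹, while the tails
    -- beyond `cut` and the model errors cost at most (6K + 1) z⁸, because y²/cut and cut² both
    -- equal z⁸. The surplus of z = 7K + 3 over 6K + 1 pays for the terms of order y = z⁶.
    z w y cut : ℕ
    z = 7 ℕ.* q ℕ.+ 3
    w = z ℕ.* z ℕ.* z
    y = w ℕ.* w
    cut = z ℕ.* z ℕ.* z ℕ.* z

    private
      1≤z : 1 ℕ.≤ z
      1≤z = ℕ.≤-trans z<s (ℕ.m≤n+m 3 (7 ℕ.* q))
      1≤w : 1 ℕ.≤ w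
      1≤w = *-≥1 (*-≥1 1≤z 1≤z) 1≤z
      1≤cut : 1 ℕ.≤ cut
      1≤cut = *-≥1 1≤w 1≤z

    1≤y : 1 ℕ.≤ y
    1≤y = *-≥1 1≤w 1≤w

    private
      cut≤y : cut ℕ.≤ y
      cut≤y = ℕ.*-monoʳ-≤ w (ℕ.m≤n*m z (z ℕ.* z) {{ℕ.>-nonZero (*-≥1 1≤z 1≤z)}})
      ζ K : ℚ
      ζ = ι z
      K = ι q * 1ℚ
      ζ≡ : ζ ≡ ι 7 * K + ι 3
      ζ≡ = trans (ι-+ (7 ℕ.* q) 3) (cong (_+ ι 3) (trans (ι-* 7 q) (cong (ι 7 *_) (sym (ℚ.*-identityʳ (ι q))))))
      ιw : ι w ≡ ζ * ζ * ζ
      ιw = trans (ι-* (z ℕ.* z) z) (cong (_* ζ) (ι-* z z))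
      ιcut : ι cut ≡ ζ * ζ * ζ * ζ
      ιcut = trans (ι-* w z) (cong (_* ζ) ιw)

    module _ {ψ : ℕ → ℚ} (χ : RealCharacter q ψ) where

      open RealCharacter χ

      private
        ψ-one : ψ 1 ≡ 1ℚ
        ψ-one with values 1 (λ {k} → coprime-1 q {k})
        ... | inj₁ e = e
        ... | inj₂ e = trans (mult 1 1) (cong₂ _*_ e e)
        sign : ∀ n → Sign (ψ n)
        sign n = go (coprime? n q)
          where
          go : Dec (Coprime n q) → Sign (ψ n)
          go (yes c) = inj₂ (values n c)
          go (no ¬c) = inj₁ (vanish n ¬c)

        V A S E : ℚ
        V = Σ y (λ n → D n ψ * (ι y - ι n))
        A = Σ cut (λ d → ψ d * tent y d)
        S = Σ cut (λ d → ψ d * inv d)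
        E = Σ cut (λ d → ψ d * tent-error y d)

        V-tent : V ≡ Σ y (λ d → ψ d * tent y d)
        V-tent = trans (Σ-ext y λ n → trans (ℚ.*-comm (D n ψ) (ι y - ι n)) (trans (sym (D-*ˡ n (ι y - ι n) ψ)) refl))
          (trans (hyperbola y (λ d n → (ι y - ι n) * ψ d)) (Σ-ext y λ d → trans (Σ-*ʳ (y // d) (ψ d) (λ m → ι y - ι (d ℕ.* m))) (ℚ.*-comm
              (tent y d) (ψ d))))

        -- Only the squares are kept, where 1 ∗ ψ is at least 1, and w² - t² ≥ w(w - t).
        V-lower : ι y * (ι w - 1ℚ) ≤ ι 2 * V
        V-lower = ≤-trans (≤-reflexive square-sum) (*-monoʳ (ι-≥0 2) (≤-trans
            (Σ-mono w {λ t → ι w * (ι w - ι t)} {λ t → D (t ℕ.* t) ψ * (ι y - ι (t ℕ.* t))} λ t 1≤t t≤w → term t 1≤t t≤w)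
            (Σ-squares-≤ w {λ n → D n ψ * (ι y - ι n)} λ n 1≤n n≤y → 0≤* (D-character-≥0 {ψ} ψ-one mult sign n 1≤n) (0≤-diff
                (ι-mono n≤y)))))
          where
          term : ∀ t → 1 ℕ.≤ t → t ℕ.≤ w → ι w * (ι w - ι t) ≤ D (t ℕ.* t) ψ * (ι y - ι (t ℕ.* t))
          term t 1≤t t≤w = ≤-trans (≤-by (ι t * (ι w - ι t)) (0≤* (ι-≥0 t) (0≤-diff (ι-mono t≤w)))
              (trans (cong₂ (λ a b → 1ℚ * (a - b)) (ι-* w w) (ι-* t t)) (l (ι w) (ι t))))
            (*-monoˡ (0≤-diff (ι-mono (ℕ.*-mono-≤ t≤w t≤w))) (D-character-square {ψ} ψ-one mult sign t 1≤t))
            where l : ∀ w t → 1ℚ * (w * w - t * t) ≡ w * (w - t) + t * (w - t)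
                  l = solve-∀ ℚring
          square-sum : ι y * (ι w - 1ℚ) ≡ ι 2 * Σ w (λ t → ι w * (ι w - ι t))
          square-sum = trans (cong (_* (ι w - 1ℚ)) (ι-* w w)) (trans (l₂ (ι w)) (trans (cong (λ s → ι w * (ι 2 * (ι w * ι w) - s)) (sym
              (Σ-ι w))) (trans (l₃ (ι w) (Σ w ι))
            (cong (ι 2 *_) (sym (trans (Σ-*ˡ w (ι w) (λ t → ι w - ι t)) (cong (ι w *_) (trans (Σ-diff w (λ _ → ι w) ι) (cong (_- Σ w ι)
                (Σ-const w (ι w)))))))))))
            where
            l₂ : ∀ w → w * w * (w - 1ℚ) ≡ w * (ι 2 * (w * w) - w * (w + 1ℚ))
            l₂ = solve-∀ ℚring
            l₃ : ∀ w s → w * (ι 2 * (w * w) - ι 2 * s) ≡ ι 2 * (w * (w * w - s))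
            l₃ = solve-∀ ℚring

        K≥0 : 0ℚ ≤ K
        K≥0 = Bounded-≥0 {K} {ψ} bounded

        V-A : V - A ≤ ι 2 * K * (ι y * ι y * inv cut)
        V-A = ≤-trans (≤-reflexive (cong (_- A) V-tent)) (≤-trans (∣∣-upper {Σ y (λ d → ψ d * tent y d) - A} (abel-tail ψ (tent y)
            (Bounded-Σ {K} {ψ} bounded) (tent-≥0 y) (tent-anti y) cut≤y))
          (≤-trans (*-monoʳ K≥0 (*-monoʳ (ι-≥0 2) (≤-trans (tent-upper y {suc cut} z<s) (*-monoʳ (0≤* (ι-≥0 y) (ι-≥0 y)) (inv-anti 1≤cut
              (ℕ.n≤1+n cut))))))
            (≤-reflexive (l K (ι y * ι y * inv cut)))))
          where l : ∀ K x → K * (ι 2 * x) ≡ ι 2 * K * x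
                l = solve-∀ ℚring

        A-eq : ι 2 * A ≡ (ι y * ι y) * S - ι y * Σ cut ψ + E
        A-eq = trans (sym (Σ-*ˡ cut (ι 2) (λ d → ψ d * tent y d))) (trans (Σ-ext cut λ d → l (ψ d) (tent y d) (ι y) (inv d))
          (trans (Σ-+ cut (λ d → (ι y * ι y) * (ψ d * inv d) - ι y * ψ d) (λ d → ψ d * tent-error y d)) (cong (_+ E)
            (trans (Σ-diff cut (λ d → (ι y * ι y) * (ψ d * inv d)) (λ d → ι y * ψ d)) (cong₂ _-_ (Σ-*ˡ cut (ι y * ι y) (λ d → ψ d * inv d))
                (Σ-*ˡ cut (ι y) ψ))))))
          where l : ∀ p t y i → ι 2 * (p * t) ≡ (y * y) * (p * i) - y * p + p * (ι 2 * t - (y * y * i - y))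
                l = solve-∀ ℚring

        E-upper : E ≤ ι cut * ι cut
        E-upper = ∣∣-upper {E} (≤-trans (Σ-abs cut {g = λ _ → ι cut} λ d 1≤d d≤ → ≤-trans (∣∣-* {ψ d} (bounded-by-1 d) (tent-approx y 1≤d))
            (≤-trans (≤-reflexive (ℚ.*-identityˡ (ι d))) (ι-mono d≤)))
          (≤-reflexive (Σ-const cut (ι cut))))

      L1-lower : ∀ {Z} → cut ℕ.≤ Z → inv (y ℕ.* y) ≤ Σ Z (λ n → ψ n * inv n)
      L1-lower {Z} cut≤Z = *-cancelˡ {ι (y ℕ.* y)} (0<ι (*-≥1 1≤y 1≤y)) (≤-trans (≤-reflexive (ι*inv (*-≥1 1≤y 1≤y)))
        -- The slacks of the five estimates, together with those of y ≤ cut² and 1 ≤ cut², add up to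
        -- exactly y² L - 1.
        (≤-by (s₁ + ι 2 * s₂ + s₃ + s₄ + s₅ + ((v - u) * (K + 1ℚ) + (v - 1ℚ)))
          (0≤+ (0≤+ (0≤+ (0≤+ (0≤+ (0≤-diff V-lower) (0≤* (ι-≥0 2) (0≤-diff V-A))) (0≤* (0≤* (ι-≥0 y) (ι-≥0 y)) (0≤-diff S-upper))) (0≤*
              (ι-≥0 y) P-lower)) (0≤-diff E-upper))
            (0≤+ (0≤* (0≤-diff (ι-mono u≤v)) (0≤+ K≥0 0≤1)) (0≤-diff (ι-mono {1} 1≤v))))
          (trans (cong (_* L) (ι-* y y)) final)))
        where
        L P : ℚ
        L = Σ Z (λ n → ψ n * inv n)
        P = Σ cut ψ
        i = inv cut
        vₙ uₙ : ℕ
        vₙ = cut ℕ.* cut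
        uₙ = y
        u v s₁ s₂ s₃ s₄ s₅ : ℚ
        u = ι uₙ
        v = ι vₙ
        1≤v : 1 ℕ.≤ vₙ
        1≤v = *-≥1 1≤cut 1≤cut
        u≤v : uₙ ℕ.≤ vₙ
        u≤v = ℕ.*-mono-≤ w≤cut w≤cut
          where w≤cut : w ℕ.≤ cut
                w≤cut = ℕ.m≤m*n w z {{ℕ.>-nonZero 1≤z}}
        s₁ = ι 2 * V - ι y * (ι w - 1ℚ)
        s₂ = ι 2 * K * (ι y * ι y * i) - (V - A)
        S-upper : S ≤ L + K * (ι 2 * i)
        S-upper = ≤-by (K * (ι 2 * i) + (L - S)) (subst (0ℚ ≤_) (l₁ (K * (ι 2 * i)) (L - S)) (0≤-diff (∣∣-lower {L - S}
            (≤-trans (abel-tail ψ inv (Bounded-Σ {K} {ψ} bounded) inv-≥0 (λ n 1≤n → inv-anti 1≤n (ℕ.n≤1+n n)) cut≤Z)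
              (*-monoʳ K≥0 (*-monoʳ (ι-≥0 2) (inv-anti 1≤cut (ℕ.n≤1+n cut))))))))
            (l₂ L S (K * (ι 2 * i)))
          where l₁ : ∀ a x → x - (- a) ≡ a + x
                l₁ = solve-∀ ℚring
                l₂ : ∀ L S k → L + k ≡ S + (k + (L - S))
                l₂ = solve-∀ ℚring
        s₃ = (ι y * ι y) * (L + K * (ι 2 * i) - S)
        P-lower : 0ℚ ≤ P + K
        P-lower = subst (0ℚ ≤_) (l P K) (0≤-diff (∣∣-lower {P} (Bounded-Σ {K} {ψ} bounded cut)))
          where l : ∀ a k → a - (- k) ≡ a + k
                l = solve-∀ ℚring
        s₄ = ι y * (P + K)
        s₅ = ι cut * ι cut - E
        yyi : ι y * ι y * i ≡ v
        yyi = trans (cong (λ a → a * a * i) (trans (ι-* w w) (cong₂ _*_ ιw ιw))) (trans (l ζ i) (trans (cong (λ a → (a * a) * (a * i))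
            (sym ιcut))
            (trans (cong (ι cut * ι cut *_) (ι*inv 1≤cut)) (trans (ℚ.*-identityʳ (ι cut * ι cut)) (sym (ι-* cut cut))))))
          where l : ∀ z i → ((z * z * z) * (z * z * z)) * ((z * z * z) * (z * z * z)) * i ≡ ((z * z * z * z) * (z * z * z * z)) *
                    ((z * z * z * z) * i)
                l = solve-∀ ℚring
        yw : ι y * ι w ≡ v * (ι 7 * K + ι 3)
        yw = trans (cong₂ _*_ (trans (ι-* w w) (cong₂ _*_ ιw ιw)) ιw) (trans (l ζ) (cong₂ _*_ (trans (cong₂ _*_ (sym ιcut) (sym ιcut)) (sym
            (ι-* cut cut))) ζ≡))
          where l : ∀ z → ((z * z * z) * (z * z * z)) * (z * z * z) ≡ ((z * z * z * z) * (z * z * z * z)) * z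
                l = solve-∀ ℚring
        final : ι y * ι y * L ≡ 1ℚ + (s₁ + ι 2 * s₂ + s₃ + s₄ + s₅ + ((v - u) * (K + 1ℚ) + (v - 1ℚ)))
        final = sym (trans (l₁ V (ι y) (ι w) K i A L S P E (ι cut) v) (trans (cong (λ a → rest a) A-eq) (trans (l₂ (ι y) (ι w) K i L S P E
            (ι cut) v)
            (trans (cong₂ (λ a b → tidy a b (ι cut * ι cut)) yyi yw) (trans (cong (λ a → tidy v (v * (ι 7 * K + ι 3)) a) (sym
                (ι-* cut cut))) (l₃ (ι y) K L v))))))
          where
          rest : ℚ → ℚ
          rest A₂ = A₂ + (ι y * ι y * (L - S) - ι y * (ι w - 1ℚ) + ι 6 * K * (ι y * ι y * i) + ι y * (P + K) + (ι cut * ι cut - E) +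
              ((v - ι y) * (K + 1ℚ) + v))
          tidy : ℚ → ℚ → ℚ → ℚ
          tidy a b e = ι y * ι y * L - b + ι y + ι 6 * K * a + ι y * K + e + ((v - ι y) * (K + 1ℚ) + v)
          l₁ : ∀ V y w K i A L S P E c v → 1ℚ + ((ι 2 * V - y * (w - 1ℚ)) + ι 2 * (ι 2 * K * (y * y * i) - (V - A)) + (y * y) * (L + K *
              (ι 2 * i) - S) + y * (P + K) + (c * c - E) + ((v - y) * (K + 1ℚ) + (v - 1ℚ))) ≡
            ι 2 * A + (y * y * (L - S) - y * (w - 1ℚ) + ι 6 * K * (y * y * i) + y * (P + K) + (c * c - E) + ((v - y) * (K + 1ℚ) + v))
          l₁ = solve-∀ ℚring
          l₂ : ∀ y w K i L S P E c v → ((y * y) * S - y * P + E) + (y * y * (L - S) - y * (w - 1ℚ) + ι 6 * K * (y * y * i) + y * (P + K) +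
              (c * c - E) + ((v - y) * (K + 1ℚ) + v)) ≡
            y * y * L - y * w + y + ι 6 * K * (y * y * i) + y * K + c * c + ((v - y) * (K + 1ℚ) + v)
          l₂ = solve-∀ ℚring
          l₃ : ∀ y K L v → y * y * L - v * (ι 7 * K + ι 3) + y + ι 6 * K * v + y * K + v + ((v - y) * (K + 1ℚ) + v) ≡ y * y * L
          l₃ = solve-∀ ℚring

  -- Dirichlet's theorem

  abstract
    pick : ∀ A N → ∃ λ x → 1 ℕ.≤ x × N ℕ.≤ x × ι A ≤ Hs x
    pick A N with Hs-unbounded A
    ... | x , 1≤x , A≤ = x ℕ.+ N , ℕ.≤-trans 1≤x (ℕ.m≤m+n x N) , ℕ.m≤n+m N x ,
      ≤-trans A≤ (Σ-mono-range {x} {x ℕ.+ N} {inv} (ℕ.m≤m+n x N) λ i _ _ → inv-≥0 i)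

  ι*-small : ∀ {c m A ν} → 1 ℕ.≤ m → 1 ℕ.≤ A → c ℕ.* m ℕ.≤ A → ν ≤ inv A → ι c * ν ≤ inv m
  ι*-small {c} {m} {A} {ν} 1≤m 1≤A le ν≤ = ≤-trans (*-monoʳ (ι-≥0 c) ν≤) (≤-trans (≤-reflexive
      (trans (trans (sym (ℚ.*-identityʳ (ι c * inv A))) (cong (ι c * inv A *_) (sym (ι*inv 1≤m)))) (trans (lem (ι c) (inv A) (ι m) (inv m))
          (cong (λ z → z * inv A * inv m) (sym (ι-* c m))))))
    (≤-trans (*-monoˡ (inv-≥0 m) (ι-cancel′ {1} {A} {c ℕ.* m} 1≤A (ℕ.≤-trans le (ℕ.≤-reflexive (sym (ℕ.*-identityˡ A)))))) (≤-reflexive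
        (ℚ.*-identityˡ (inv m)))))
    where lem : ∀ c a m i → c * a * (m * i) ≡ c * m * a * i
          lem = solve-∀ ℚring

  0<inv : ∀ {n} → 1 ℕ.≤ n → 0ℚ < inv n
  0<inv {n} 1≤n = ℚ.≰⇒> λ le → <⇒≱ 0<1 (≤-trans (≤-reflexive (sym (ι*inv 1≤n))) (≤-trans (*-monoʳ (ι-≥0 n) le) (≤-reflexive (ℚ.*-zeroʳ
      (ι n)))))

  module Dirichlet (q : ℕ) .{{q≢0 : NonZero q}} {a : ℕ} (ca : Coprime a q) (N : ℕ) (1≤N : 1 ℕ.≤ N) where

    private
      1≤q : 1 ℕ.≤ q
      1≤q = 1≤modulus q

      -- With ε = 1/Q, the choice Q = 100 q² gives 100 φ² ε ≤ 1, and m = 2Q leaves ε/2 for each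
      -- summand of `pairError`. There `cL` and `cR` are the coefficients of ν and ν′; `cS` and `cN`
      -- belong to `excess-sum` and `primeMass-bound`, and `cF` to the final comparison with L(1, ψ)
      -- ≥ 1/C.
      Q C m cL : ℕ
      Q = 100 ℕ.* (q ℕ.* q)
      C = L1.y q ℕ.* L1.y q
      m = 2 ℕ.* Q
      cL = q ℕ.* (q ℕ.* (q ℕ.+ 1) ℕ.* 76)
      cR : ℕ → ℕ
      cR x = q ℕ.* (q ℕ.* (q ℕ.+ 1) ℕ.* (80 ℕ.* x) ℕ.+ 19 ℕ.* (18 ℕ.+ 2 ℕ.* q))
      cS cN cF : ℕ
      cS = q ℕ.* (18 ℕ.+ 2 ℕ.* q)
      cN = q ℕ.* (22 ℕ.+ N)
      cF = 40 ℕ.* q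

      1≤Q : 1 ℕ.≤ Q
      1≤Q = *-≥1 {100} z<s (*-≥1 1≤q 1≤q)
      1≤m : 1 ℕ.≤ m
      1≤m = *-≥1 {2} z<s 1≤Q
      1≤C : 1 ℕ.≤ C
      1≤C = *-≥1 (L1.1≤y q) (L1.1≤y q)

      rest : ℕ
      rest = 1 ℕ.+ (cL ℕ.* m ℕ.+ (cS ℕ.* Q ℕ.+ (cN ℕ.* Q ℕ.+ cF ℕ.* (4 ℕ.* C))))
      -- The size required of h at the scale following x.
      size : ℕ → ℕ
      size x = rest ℕ.+ cR x ℕ.* m

      rest≤ : ∀ x → rest ℕ.≤ size x
      rest≤ x = ℕ.m≤m+n rest (cR x ℕ.* m)
      1≤size : ∀ x → 1 ℕ.≤ size x
      1≤size x = z<s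
      L≤size : ∀ x → cL ℕ.* m ℕ.≤ size x
      L≤size x = ℕ.≤-trans (ℕ.≤-trans (ℕ.m≤m+n (cL ℕ.* m) _) (ℕ.n≤1+n _)) (rest≤ x)
      tail₁ : cS ℕ.* Q ℕ.+ (cN ℕ.* Q ℕ.+ cF ℕ.* (4 ℕ.* C)) ℕ.≤ rest
      tail₁ = ℕ.≤-trans (ℕ.m≤n+m _ (cL ℕ.* m)) (ℕ.n≤1+n _)
      S≤size : ∀ x → cS ℕ.* Q ℕ.≤ size x
      S≤size x = ℕ.≤-trans (ℕ.≤-trans (ℕ.m≤m+n (cS ℕ.* Q) _) tail₁) (rest≤ x)
      tail₂ : cN ℕ.* Q ℕ.+ cF ℕ.* (4 ℕ.* C) ℕ.≤ rest
      tail₂ = ℕ.≤-trans (ℕ.m≤n+m _ (cS ℕ.* Q)) tail₁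
      N≤size : ∀ x → cN ℕ.* Q ℕ.≤ size x
      N≤size x = ℕ.≤-trans (ℕ.≤-trans (ℕ.m≤m+n (cN ℕ.* Q) _) tail₂) (rest≤ x)
      F≤size : ∀ x → cF ℕ.* (4 ℕ.* C) ℕ.≤ size x
      F≤size x = ℕ.≤-trans (ℕ.≤-trans (ℕ.m≤n+m _ (cN ℕ.* Q)) tail₂) (rest≤ x)
      R≤size : ∀ {x x′} → x ℕ.≤ x′ → cR x ℕ.* m ℕ.≤ size x′
      R≤size {x} {x′} x≤x′ = ℕ.≤-trans (ℕ.*-monoˡ-≤ m (ℕ.*-monoʳ-≤ q (ℕ.+-monoˡ-≤ (19 ℕ.* (18 ℕ.+ 2 ℕ.* q))
        (ℕ.*-monoʳ-≤ (q ℕ.* (q ℕ.+ 1)) (ℕ.*-monoʳ-≤ 80 x≤x′))))) (ℕ.m≤n+m (cR x′ ℕ.* m) rest)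

      -- At each scale after x₀, `h` must outweigh the coefficient `cR` of the scale before it, so
      -- the scales are chosen in succession; the `suc` makes up for the 1 lost in `Hs-≤-h`.
      P₀ = pick (suc (size 0)) N
      x₀ = proj₁ P₀
      P₁ = pick (suc (size x₀)) x₀
      x₁ = proj₁ P₁
      P₂ = pick (suc (size x₁)) (x₁ ℕ.+ N)

    x₂ : ℕ
    x₂ = proj₁ P₂

    private
      T : ℕ
      -- `pick` speaks of harmonic numbers only, so T can be taken beyond the scales it has produced
      -- and beyond the cut at which L(1, ψ) is estimated.
      T = suc (x₀ ℕ.+ (x₁ ℕ.+ (x₂ ℕ.+ L1.cut q)))
      1≤T : 1 ℕ.≤ T
      1≤T = z<s
      1≤x₀ : 1 ℕ.≤ x₀
      1≤x₀ = P₀ .proj₂ .proj₁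
      1≤x₁ : 1 ℕ.≤ x₁
      1≤x₁ = P₁ .proj₂ .proj₁
      1≤x₂ : 1 ℕ.≤ x₂
      1≤x₂ = P₂ .proj₂ .proj₁
      x₀≤x₁ : x₀ ℕ.≤ x₁
      x₀≤x₁ = P₁ .proj₂ .proj₂ .proj₁
      N≤x₂ : N ℕ.≤ x₂
      N≤x₂ = ℕ.≤-trans (ℕ.m≤n+m N x₁) (P₂ .proj₂ .proj₂ .proj₁)
      x₀<T : suc x₀ ℕ.≤ T
      x₀<T = s≤s (ℕ.m≤m+n x₀ _)
      x₁<T : suc x₁ ℕ.≤ T
      x₁<T = s≤s (ℕ.≤-trans (ℕ.m≤m+n x₁ _) (ℕ.m≤n+m _ x₀))
      x₂<T : suc x₂ ℕ.≤ T
      x₂<T = s≤s (ℕ.≤-trans (ℕ.≤-trans (ℕ.m≤m+n x₂ _) (ℕ.m≤n+m _ x₁)) (ℕ.m≤n+m _ x₀))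
      cut≤T : L1.cut q ℕ.≤ T
      cut≤T = ℕ.≤-trans (ℕ.≤-trans (ℕ.≤-trans (ℕ.m≤n+m _ x₂) (ℕ.m≤n+m _ x₁)) (ℕ.m≤n+m _ x₀)) (ℕ.n≤1+n _)

      h-large : ∀ {A x} → 1 ℕ.≤ x → ι (suc A) ≤ Hs x → ι A ≤ h T x
      h-large {A} {suc x} _ le = ≤-by (h T (suc x) + 1ℚ - ι (suc A)) (0≤-diff (≤-trans le (Hs-≤-h T 1≤T x))) (lem (h T (suc x)) (ι A))
        where lem : ∀ h a → h ≡ a + (h + 1ℚ - (a + 1ℚ))
              lem = solve-∀ ℚring

      R₀ = reciprocal {h T x₀} (size 0) (1≤size 0) (h-large {size 0} {x₀} 1≤x₀ (P₀ .proj₂ .proj₂ .proj₂))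
      R₁ = reciprocal {h T x₁} (size x₀) (1≤size x₀) (h-large {size x₀} {x₁} 1≤x₁ (P₁ .proj₂ .proj₂ .proj₂))
      R₂ = reciprocal {h T x₂} (size x₁) (1≤size x₁) (h-large {size x₁} {x₂} 1≤x₂ (P₂ .proj₂ .proj₂ .proj₂))
      ν₀ ν₁ ν₂ ε : ℚ
      ν₀ = proj₁ R₀
      ν₁ = proj₁ R₁
      ν₂ = proj₁ R₂
      ε = inv Q
      ν₀≥0 : 0ℚ ≤ ν₀
      ν₀≥0 = R₀ .proj₂ .proj₁
      ν₁≥0 : 0ℚ ≤ ν₁
      ν₁≥0 = R₁ .proj₂ .proj₁
      ν₂≥0 : 0ℚ ≤ ν₂
      ν₂≥0 = R₂ .proj₂ .proj₁
      ν₀*h : ν₀ * h T x₀ ≡ 1ℚ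
      ν₀*h = R₀ .proj₂ .proj₂ .proj₁
      ν₁*h : ν₁ * h T x₁ ≡ 1ℚ
      ν₁*h = R₁ .proj₂ .proj₂ .proj₁
      ν₂*h : ν₂ * h T x₂ ≡ 1ℚ
      ν₂*h = R₂ .proj₂ .proj₂ .proj₁
      ν₀≤ : ν₀ ≤ inv (size 0)
      ν₀≤ = R₀ .proj₂ .proj₂ .proj₂
      ν₁≤ : ν₁ ≤ inv (size x₀)
      ν₁≤ = R₁ .proj₂ .proj₂ .proj₂
      ν₂≤ : ν₂ ≤ inv (size x₁)
      ν₂≤ = R₂ .proj₂ .proj₂ .proj₂
      ν₀≤1 : ν₀ ≤ 1ℚ
      ν₀≤1 = ≤-trans ν₀≤ (inv≤1 (size 0))
      ν₁≤1 : ν₁ ≤ 1ℚ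
      ν₁≤1 = ≤-trans ν₁≤ (inv≤1 (size x₀))
      ν₂≤1 : ν₂ ≤ 1ℚ
      ν₂≤1 = ≤-trans ν₂≤ (inv≤1 (size x₁))

      e₀ e₁ e₂ : ℕ → ℚ
      e₀ = excess q T 1≤T x₀ ν₀
      e₁ = excess q T 1≤T x₁ ν₁
      e₂ = excess q T 1≤T x₂ ν₂

      pair-small : ∀ x {A A′ ν ν′} → 1 ℕ.≤ A → 1 ℕ.≤ A′ → cL ℕ.* m ℕ.≤ A → cR x ℕ.* m ℕ.≤ A′ → ν ≤ inv A → ν′ ≤ inv A′
          → pairError q T 1≤T x ν ν′ ≤ ε
      pair-small x {A} {A′} {ν} {ν′} 1≤A 1≤A′ l r ν≤ ν′≤ = ≤-trans (≤-reflexive eq) (≤-trans (+-mono-≤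
          (ι*-small {cL} {m} {A} {ν} 1≤m 1≤A l ν≤) (ι*-small {cR x} {m} {A′} {ν′} 1≤m 1≤A′ r ν′≤))
          (≤-reflexive (trans (cong (λ z → z + z) (inv-* 2 Q)) (half (inv Q)))))
        where
        half : ∀ a → inv 2 * a + inv 2 * a ≡ a
        half = solve-∀ ℚring
        e = massError q T 1≤T
        ιcL : ι cL ≡ ι q * ((ι q * (ι q + 1ℚ)) * ι 76)
        ιcL = trans (ι-* q (q ℕ.* (q ℕ.+ 1) ℕ.* 76)) (cong (ι q *_) (trans (ι-* (q ℕ.* (q ℕ.+ 1)) 76) (cong (_* ι 76) (trans (ι-* q
            (q ℕ.+ 1)) (cong (ι q *_) (ι-+ q 1))))))
        ιcR : ι (cR x) ≡ ι q * ((ι q * (ι q + 1ℚ)) * (ι 80 * ι x) + ι 19 * e)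
        ιcR = trans (ι-* q (q ℕ.* (q ℕ.+ 1) ℕ.* (80 ℕ.* x) ℕ.+ 19 ℕ.* (18 ℕ.+ 2 ℕ.* q))) (cong (ι q *_) (trans (ι-+ (q ℕ.* (q ℕ.+ 1) ℕ.*
            (80 ℕ.* x)) (19 ℕ.* (18 ℕ.+ 2 ℕ.* q)))
          (cong₂ _+_ (trans (ι-* (q ℕ.* (q ℕ.+ 1)) (80 ℕ.* x)) (cong₂ _*_ (trans (ι-* q (q ℕ.+ 1)) (cong (ι q *_) (ι-+ q 1))) (ι-* 80 x)))
              (ι-* 19 (18 ℕ.+ 2 ℕ.* q)))))
        eq : pairError q T 1≤T x ν ν′ ≡ ι cL * ν + ι (cR x) * ν′
        eq = trans (lem (ι q) (ι q * (ι q + 1ℚ)) ν (ι x) ν′ e) (cong₂ (λ u v → u * ν + v * ν′) (sym ιcL) (sym ιcR))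
          where lem : ∀ q K n x n′ e → q * (K * (ι 76 * n + ι 80 * x * n′) + ι 19 * e * n′) ≡ q * (K * ι 76) * n + q * (K * (ι 80 * x)
                    + ι 19 * e) * n′
                lem = solve-∀ ℚring

      sum-small : ∀ {x ν} x′ → ν ≤ inv (size x′) → ∣ Σ q (λ r → unit q r * excess q T 1≤T x ν r) ∣ ≤ (ι q * massError q T 1≤T) * ν →
        ∣ Σ q (λ r → unit q r * excess q T 1≤T x ν r) ∣ ≤ ε
      sum-small {x} {ν} x′ ν≤ le = ≤-trans le (≤-trans (≤-reflexive (cong (_* ν) (sym (ι-* q (18 ℕ.+ 2 ℕ.* q)))))
          (ι*-small {cS} {Q} {size x′} {ν} 1≤Q (1≤size x′) (S≤size x′) ν≤))

      ε≥0 : 0ℚ ≤ ε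
      ε≥0 = inv-≥0 Q
      small : ι 100 * (φ q * φ q * ε) ≤ 1ℚ
      small = ≤-trans (*-monoʳ (ι-≥0 100) (*-monoˡ ε≥0 (*-mono {φ q} {ι q} {φ q} {ι q} (ι-≥0 q) (≤-trans 0≤1 (1≤φ q)) (φ-≤ q) (φ-≤ q))))
        (≤-reflexive (trans (lem (ι q) ε) (trans (cong (_* ε) (sym (trans (ι-* 100 (q ℕ.* q)) (cong (ι 100 *_) (ι-* q q))))) (ι*inv 1≤Q))))
        where lem : ∀ q e → ι 100 * (q * q * e) ≡ ι 100 * (q * q) * e
              lem = solve-∀ ℚring

    module _ (none : ∀ p → N ℕ.< p → p ℕ.≤ x₂ → Prime p → ¬ p % q ≡ a % q) where

      private
        at-a : 1ℚ - ε ≤ e₂ a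
        at-a = ℚ.+-monoʳ-≤ 1ℚ (ℚ.neg-antimono-≤ (≤-trans (*-mono {φ q * ν₂} {ι q * ν₂} {primeMass q T 1≤T x₂ a} {ι (22 ℕ.+ N)} (0≤* (ι-≥0 q)
            ν₂≥0) (primeMass-≥0 q T 1≤T x₂ a)
            (*-monoˡ ν₂≥0 (φ-≤ q)) (primeMass-bound q T 1≤T {N} {x₂} {a} 1≤N N≤x₂ x₂<T none))
          (≤-trans (≤-reflexive (trans (lem (ι q) ν₂ (ι (22 ℕ.+ N))) (cong (_* ν₂) (sym (ι-* q (22 ℕ.+ N))))))
              (ι*-small {cN} {Q} {size x₁} {ν₂} 1≤Q (1≤size x₁) (N≤size x₁) ν₂≤))))
          where lem : ∀ q n c → q * n * c ≡ q * c * n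
                lem = solve-∀ ℚring

        A₀₁ : ∀ {g} → Coprime g q → ∣ bilinear q g e₁ e₀ - φ q * e₁ g ∣ ≤ ε
        A₀₁ {g} cg = ≤-trans (bilinear-excess q T 1≤T {x₀} {x₁} {ν₀} {ν₁} 1≤x₀ x₀<T 1≤x₁ x₁<T ν₀≥0 ν₀*h ν₀≤1 ν₁≥0 ν₁*h ν₁≤1 {g} cg)
          (pair-small x₀ {size 0} {size x₀} {ν₀} {ν₁} (1≤size 0) (1≤size x₀) (L≤size 0) (R≤size {x₀} {x₀} ℕ.≤-refl) ν₀≤ ν₁≤)
        A₀₂ : ∀ {g} → Coprime g q → ∣ bilinear q g e₂ e₀ - φ q * e₂ g ∣ ≤ ε
        A₀₂ {g} cg = ≤-trans (bilinear-excess q T 1≤T {x₀} {x₂} {ν₀} {ν₂} 1≤x₀ x₀<T 1≤x₂ x₂<T ν₀≥0 ν₀*h ν₀≤1 ν₂≥0 ν₂*h ν₂≤1 {g} cg)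
          (pair-small x₀ {size 0} {size x₁} {ν₀} {ν₂} (1≤size 0) (1≤size x₁) (L≤size 0) (R≤size {x₀} {x₁} x₀≤x₁) ν₀≤ ν₂≤)
        A₁₂ : ∀ {g} → Coprime g q → ∣ bilinear q g e₂ e₁ - φ q * e₂ g ∣ ≤ ε
        A₁₂ {g} cg = ≤-trans (bilinear-excess q T 1≤T {x₁} {x₂} {ν₁} {ν₂} 1≤x₁ x₁<T 1≤x₂ x₂<T ν₁≥0 ν₁*h ν₁≤1 ν₂≥0 ν₂*h ν₂≤1 {g} cg)
          (pair-small x₁ {size x₀} {size x₁} {ν₁} {ν₂} (1≤size x₀) (1≤size x₁) (L≤size x₀) (R≤size {x₁} {x₁} ℕ.≤-refl) ν₁≤ ν₂≤)

        p₁ : Periodic q e₁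
        p₁ = excess-periodic q T 1≤T x₁ ν₁
        p₂ : Periodic q e₂
        p₂ = excess-periodic q T 1≤T x₂ ν₂
        e₀≤1 : ∀ n → e₀ n ≤ 1ℚ
        e₀≤1 = excess-≤1 q T 1≤T {x₀} {ν₀} ν₀≥0
        e₁≤1 : ∀ n → e₁ n ≤ 1ℚ
        e₁≤1 = excess-≤1 q T 1≤T {x₁} {ν₁} ν₁≥0
        e₂≤1 : ∀ n → e₂ n ≤ 1ℚ
        e₂≤1 = excess-≤1 q T 1≤T {x₂} {ν₂} ν₂≥0
        S₀ : ∣ Σ q (λ r → unit q r * e₀ r) ∣ ≤ ε
        S₀ = sum-small {x₀} {ν₀} 0 ν₀≤ (excess-sum q T 1≤T {x₀} {ν₀} 1≤x₀ x₀<T ν₀≥0 ν₀*h)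
        S₁ : ∣ Σ q (λ r → unit q r * e₁ r) ∣ ≤ ε
        S₁ = sum-small {x₁} {ν₁} x₀ ν₁≤ (excess-sum q T 1≤T {x₁} {ν₁} 1≤x₁ x₁<T ν₁≥0 ν₁*h)
        S₂ : ∣ Σ q (λ r → unit q r * e₂ r) ∣ ≤ ε
        S₂ = sum-small {x₂} {ν₂} x₁ ν₂≤ (excess-sum q T 1≤T {x₂} {ν₂} 1≤x₂ x₂<T ν₂≥0 ν₂*h)

        module R = Rounding q {ε} {e₀} {e₁} {e₂} {a} ca ε≥0 small p₁ p₂ e₀≤1 e₁≤1 e₂≤1 S₀ S₁ S₂ A₀₁ A₀₂ A₁₂ at-a

        ψ : ℕ → ℚ
        ψ = R.ψ
        module ψ-char = RealCharacter R.ψ-character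

        P L : ℚ
        P = Σ x₁ (λ n → (Λ T n * inv n) * ψ n)
        L = Lser T 1≤T T ψ

        -- Since ψ sums to zero, the constant 1 in e₁ drops out of its correlation with ψ, and what
        -- remains is -φ ν₁ P.
        P-upper : ν₁ * P ≤ - ½
        P-upper = *-cancelˡ {φ q} (ℚ.<-≤-trans 0<1 (1≤φ q)) (≤-by (Σ q (λ r → ψ r * e₁ r) - ½ * φ q) (0≤-diff R.ψ-correlation)
            (trans (l₀ (φ q) (Σ q (λ r → ψ r * e₁ r))) (cong (λ z → z + (Σ q (λ r → ψ r * e₁ r) - ½ * φ q)) eq)))
          where
          l₀ : ∀ f s → f * (- ½) ≡ (0ℚ - s) + (s - ½ * f)
          l₀ = solve-∀ ℚring
          l₂ : ∀ p c m → p * (1ℚ - c * m) ≡ p - c * (m * p)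
          l₂ = solve-∀ ℚring
          l₃ : ∀ f n p → 0ℚ - (0ℚ - f * n * p) ≡ f * (n * p)
          l₃ = solve-∀ ℚring
          corr : Σ q (λ r → ψ r * e₁ r) ≡ 0ℚ - φ q * ν₁ * P
          corr = trans (Σ-ext q λ r → l₂ (ψ r) (φ q * ν₁) (primeMass q T 1≤T x₁ r)) (trans (Σ-diff q ψ (λ r → φ q * ν₁ *
              (primeMass q T 1≤T x₁ r * ψ r)))
            (cong₂ _-_ ψ-char.zero-sum (trans (Σ-*ˡ q (φ q * ν₁) (λ r → primeMass q T 1≤T x₁ r * ψ r)) (cong (φ q * ν₁ *_) (sym
                (Σ-by-class q {ψ} ψ-char.periodic x₁ (λ n → Λ T n * inv n)))))))
          eq : 0ℚ - Σ q (λ r → ψ r * e₁ r) ≡ φ q * (ν₁ * P)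
          eq = trans (cong (λ z → 0ℚ - z) corr) (l₃ (φ q) ν₁ P)
        -- Complete multiplicativity takes ψ(d) out of the shifted series in `Lser-Λ`, which leaves
        -- the product of P and L.
        PL : ∣ P * L ∣ ≤ ι q * 1ℚ * ι 40
        PL = subst (λ z → ∣ z ∣ ≤ ι q * 1ℚ * ι 40) (trans (Σ-ext x₁ λ d → trans (cong (Λ T d * inv d *_) (shift d)) (sym (ℚ.*-assoc
            (Λ T d * inv d) (ψ d) L))) (Σ-*ʳ x₁ L (λ d → Λ T d * inv d * ψ d)))
          (Lser-Λ T 1≤T T {ι q * 1ℚ} {ψ} {x₁} ψ-char.bounded 1≤x₁ x₁<T (ℕ.<⇒≤ x₁<T))
          where
          shift : ∀ d → Lser T 1≤T T (λ n → ψ (d ℕ.* n)) ≡ ψ d * L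
          shift d = trans (Σ-ext T λ n → trans (cong (_* inv n) (ψ-char.mult d n)) (ℚ.*-assoc (ψ d) (ψ n) (inv n))) (Σ-*ˡ T (ψ d) (λ n
              → ψ n * inv n))
        L-lower : inv C ≤ L
        L-lower = L1.L1-lower q R.ψ-character cut≤T
        upper : ν₁ * (ι q * 1ℚ * ι 40) ≤ inv 4 * inv C
        upper = ≤-trans (≤-reflexive (trans (lem ν₁ (ι q)) (cong (_* ν₁) (sym (ι-* 40 q))))) (≤-trans
            (ι*-small {cF} {4 ℕ.* C} {size x₀} {ν₁} (*-≥1 {4} z<s 1≤C) (1≤size x₀) (F≤size x₀) ν₁≤) (≤-reflexive (inv-* 4 C)))
          where lem : ∀ n q → n * (q * 1ℚ * ι 40) ≡ ι 40 * q * n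
                lem = solve-∀ ℚring
        -- As ν₁ P ≤ -1/2, half of L is at most -ν₁ P L ≤ 40 q ν₁. The choice of x₁ makes this at
        -- most 1/(4C), while L ≥ 1/C.
        too-small : ½ * inv C ≤ inv 4 * inv C
        too-small = ≤-trans (*-monoʳ (<⇒≤ (ℚ.positive⁻¹ ½)) L-lower)
          (≤-trans (≤-by ((- ½ - ν₁ * P) * L) (0≤* (0≤-diff P-upper) (≤-trans (inv-≥0 C) L-lower)) (lem ν₁ P L))
          (≤-trans (*-monoʳ ν₁≥0 (∣∣-upper { - (P * L)} (∣∣-neg {P * L} PL))) upper))
          where lem : ∀ n P L → n * (- (P * L)) ≡ ½ * L + (- ½ - n * P) * L
                lem = solve-∀ ℚring

      impossible : ⊥
      impossible = <⇒≱ (0<inv 1≤C) (*-cancelˡ {inv 4} (ℚ.positive⁻¹ (inv 4)) (≤-by (inv 4 * inv C - ½ * inv C) (0≤-diff too-small) (lem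
          (inv C))))
        where lem : ∀ a → inv 4 * 0ℚ ≡ inv 4 * a + (inv 4 * a - ½ * a)
              lem = solve-∀ ℚring

    bound : ∃ λ x → ¬ (∀ p → N ℕ.< p → p ℕ.≤ x → Prime p → ¬ p % q ≡ a % q)
    bound = x₂ , impossible

  -- The contradiction only refutes absence; below a given bound a decidable search turns this into
  -- a prime.
  prime-search : ∀ q .{{_ : NonZero q}} a N x → ¬ (∀ p → N ℕ.< p → p ℕ.≤ x → Prime p → ¬ p % q ≡ a % q) →
    ∃ λ p → N ℕ.< p × Prime p × p % q ≡ a % q
  prime-search q a N x ¬none = go (ℕ.anyUpTo? (λ p → (N ℕ.<? p) ×-dec (prime? p ×-dec (p % q ℕ.≟ a % q))) (suc x))
    where
    go : Dec (∃ λ p → p ℕ.< suc x × N ℕ.< p × Prime p × p % q ≡ a % q) → ∃ λ p → N ℕ.< p × Prime p × p % q ≡ a % q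
    go (yes (p , _ , found)) = p , found
    go (no ¬any) = ⊥-elim (¬none λ p lo hi pp e → ¬any (p , s≤s hi , lo , pp , e))

  -- Abstract, because the search bound must never be evaluated.
  abstract
    dirichlet : ∀ q .{{_ : NonZero q}} a → Coprime a q → ∀ N → 1 ℕ.≤ N → ∃ λ p → N ℕ.< p × Prime p × p % q ≡ a % q
    dirichlet q a ca N 1≤N = let x , ¬none = Dirichlet.bound q {a} ca N 1≤N in prime-search q a N x ¬none

open PrimesInProgressions using (prime-coprime; prime-≥2; prime-≥1; coprime-*; dirichlet)
open import Defs
open import Data.Nat using (ℕ; zero; suc; _+_; _*_; _^_; _∸_; _/_; _%_; _≤_; _<_; _<?_; _≤?_; z<s; NonZero; NonTrivial; nonTrivial⇒n>1)
open import Data.Nat.Properties using (_≟_; n<1+n; ≤-trans; <⇒≤; <-trans; <-≤-trans; ≤-<-trans; ≤-refl; *-comm; +-comm; +-assoc;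
    +-identityʳ; *-identityʳ; m^n>0; ^-distribˡ-+-*; m≤m+n; m≤n+m; m≤n*m; m+[n∸m]≡n; ≰⇒>; *-mono-≤; >⇒≢; <⇒≢; <-irrefl; allUpTo?; m^n≢0)
open import Data.Nat.Divisibility using (_∣_; _∣?_; hasNonTrivialDivisor; divides; ∣-trans; 0∣⇒≡0; ∣m⇒∣m*n; ∣n⇒∣m*n; ∣m∣n⇒∣m+n; ∣m+n∣m⇒∣n;
    m∣m*n; n∣m*n; *-cancelʳ-∣; ∣1⇒≡1)
open import Data.Nat.DivMod using (m≡m%n+[m/n]*n)
open import Data.Nat.Tactic.RingSolver using (solve-∀)

-- Values of Schemmel totients

divisors-2^ : ∀ α {c} → c ∣ 2 ^ α → ∃ λ β → c ≡ 2 ^ β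
divisors-2^ zero    c∣1 = 0 , ∣1⇒≡1 c∣1
divisors-2^ (suc α) {c} c∣ with 2 ∣? c
... | no ¬2∣c = divisors-2^ α (coprime-divisor (prime-coprime prime[2] ¬2∣c) c∣)
... | yes (divides k c≡k*2) with divisors-2^ α {k} (*-cancelʳ-∣ 2 (subst (_∣ 2 ^ α * 2) c≡k*2 (subst (c ∣_) (*-comm 2 (2 ^ α)) c∣)))
...   | β , k≡2^β = suc β , trans c≡k*2 (trans (cong (_* 2) k≡2^β) (*-comm (2 ^ β) 2))

prime∣prime : ∀ {p q} → Prime p → Prime q → p ∣ q → p ≡ q
prime∣prime pp pq p∣q with prime⇒irreducible pq p∣q
... | inj₂ p≡q = p≡q
... | inj₁ p≡1 = contradiction p≡1 (>⇒≢ (prime-≥2 pp))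

prime∣^ : ∀ {p m} → Prime p → ∀ k → p ∣ m ^ k → p ∣ m
prime∣^ pp zero    p∣1 = contradiction (∣1⇒≡1 p∣1) (>⇒≢ (prime-≥2 pp))
prime∣^ {m = m} pp (suc k) p∣ with euclidsLemma m (m ^ k) pp p∣
... | inj₁ p∣m = p∣m
... | inj₂ p∣m^k = prime∣^ pp k p∣m^k

prime∣product : ∀ {p} → Prime p → (f : ℕ → ℕ) → ∀ xs → p ∣ product (map f xs) → ∃ λ x → x ∈ xs × p ∣ f x
prime∣product pp f []       p∣1 = contradiction (∣1⇒≡1 p∣1) (>⇒≢ (prime-≥2 pp))
prime∣product pp f (x ∷ xs) p∣ with euclidsLemma (f x) (product (map f xs)) pp p∣
... | inj₁ p∣fx = x , here refl , p∣fx
... | inj₂ p∣rest with prime∣product pp f xs p∣rest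
...   | y , y∈xs , p∣fy = y , there y∈xs , p∣fy

S-local-big : ∀ {r q} k → r < q → S-local r q k ≡ q ^ (k ∸ 1) * (q ∸ r)
S-local-big {r} {q} k r<q with q ≤? r
... | yes q≤r = contradiction r<q (λ lt → <-irrefl refl (<-≤-trans lt q≤r))
... | no _    = refl

S-local-small : ∀ {r q} k → q ≤ r → S-local r q k ≡ 0
S-local-small {r} {q} k q≤r with q ≤? r
... | yes _   = refl
... | no q≰r  = contradiction q≤r q≰r

-- A value of S_r divisible by p comes from a prime q with p ∣ q - r or from q = p.
S-divisor : ∀ {r m n p} → Prime p → p ∣ n → n ≢ 0 → S r m ≡ n →
  ∃ λ q → Prime q × r < q × (q ∸ r ∣ n) × (p ≢ q → p ∣ q ∸ r)
S-divisor {r} {m} {n} {p} pp p∣n n≢0 refl with prime∣product pp (λ q → S-local r q (val q m)) (primeDivisors m) p∣n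
... | q , q∈ , p∣Sq = go (q ≤? r)
  where
  f : ℕ → ℕ
  f q = S-local r q (val q m)
  pq : Prime q
  pq = ∈-filter⁻ (λ p → prime? p ×-dec (p ∣? m)) {xs = upTo (suc m)} q∈ .proj₂ .proj₁
  Sq∣ : S-local r q (val q m) ∣ S r m
  Sq∣ = ∈⇒∣product (∈-map⁺ f q∈)
  go : Dec (q ≤ r) → ∃ λ q → Prime q × r < q × (q ∸ r ∣ S r m) × (p ≢ q → p ∣ q ∸ r)
  -- A prime q ≤ r would contribute the factor 0, but n is nonzero.
  go (yes q≤r) = contradiction (0∣⇒≡0 (subst (_∣ S r m) (S-local-small (val q m) q≤r) Sq∣)) n≢0
  go (no q≰r) = q , pq , ≰⇒> q≰r , ∣-trans (n∣m*n (q ^ k)) full , other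
    where
    k = val q m ∸ 1
    full : q ^ k * (q ∸ r) ∣ S r m
    full = subst (_∣ S r m) (S-local-big (val q m) (≰⇒> q≰r)) Sq∣
    p∣full : p ∣ q ^ k * (q ∸ r)
    p∣full = subst (p ∣_) (S-local-big (val q m) (≰⇒> q≰r)) p∣Sq
    other : p ≢ q → p ∣ q ∸ r
    other p≢q with euclidsLemma (q ^ k) (q ∸ r) pp p∣full
    ... | inj₂ p∣q-r = p∣q-r
    ... | inj₁ p∣q^k = contradiction (prime∣prime pp pq (prime∣^ pp k p∣q^k)) p≢q

-- Trial division and coprimality to a product

prime-by-trial : ∀ {n} m .{{_ : NonTrivial n}} → (∀ {d} → d < m → ¬ (1 < d × d ∣ n)) → n < m * m → Prime n
prime-by-trial {n} m none n<m*m = rough∧square>⇒prime {m = m} rough n<m*m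
  where
  rough : m Rough n
  rough (hasNonTrivialDivisor {divisor = d} d<m d∣n) = none d<m (nonTrivial⇒n>1 d , d∣n)

trial-division : ∀ n m → Dec (∀ {d} → d < m → ¬ (1 < d × d ∣ n))
trial-division n m = allUpTo? (λ d → ¬? ((1 <? d) ×-dec (d ∣? n))) m

coprime-product : ∀ {r} qs → All (λ q → Prime q × ¬ (q ∣ r)) qs → Coprime r (product qs)
coprime-product [] [] (_ , k∣1) = ∣1⇒≡1 k∣1
coprime-product {r} (q ∷ qs) ((pq , ¬q∣r) ∷ rest) {k} =
  Coprimality.sym (λ {j} → coprime-* {q} {product qs} {r}
    (λ {i} → Coprimality.sym (λ {h} → prime-coprime {q} {r} pq ¬q∣r {h}) {i})
    (λ {i} → Coprimality.sym (λ {h} → coprime-product qs rest {h}) {i}) {j}) {k}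

-- A covering system for the exponents

fermatDivisors : List ℕ
fermatDivisors = 3 ∷ 5 ∷ 17 ∷ 257 ∷ 641 ∷ 65537 ∷ 6700417 ∷ []

-- Abstract, because these numbers must never be unfolded into unary form.
abstract

  -- The product 2^64 - 1 of these primes.
  modulus : ℕ
  modulus = 18446744073709551615

  -- The residue 1 modulo 3, 5, 17, 257, 641, 65537 and -1 modulo 6700417.
  twist : ℕ
  twist = 15511380746462593381

  largest : ℕ
  largest = 6700417

  instance
    modulus≢0 : NonZero modulus
    modulus≢0 = _

  product≡modulus : product fermatDivisors ≡ modulus
  product≡modulus = refl

  -- A residue that is 1 or -1 modulo each prime squares to 1, so `twist` is its own inverse modulo
  -- `modulus`, which gives `coprime-twist`.
  twist² : twist * twist ≡ 13043111114911583784 * modulus + 1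
  twist² = refl

-- With p ≡ r·twist the number 2^β p + r is congruent to r(2^β twist + 1), so the condition involves
-- neither r nor p. The field `small` makes d a proper divisor once p exceeds `largest`.
record Covers (d β : ℕ) : Set where
  field
    1<d    : 1 < d
    small  : d ≤ largest
    ∣mod   : d ∣ modulus
    ∣value : d ∣ 2 ^ β * twist + 1

-- Multiplication by 2^e is trivial modulo d, so the condition depends on β modulo e only.
covers-shift : ∀ {d c} e → d ∣ 2 ^ e ∸ 1 → Covers d c → ∀ {β} k → β ≡ k * e + c → Covers d β
covers-shift {d} {c} e d∣2^e-1 cov k refl = record { Covers cov ; ∣value = go k }
  where
  lem : ∀ M x w → (1 + M) * x * w + 1 ≡ (x * w + 1) + M * (x * w)
  lem = solve-∀
  go : ∀ k → d ∣ 2 ^ (k * e + c) * twist + 1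
  go zero    = Covers.∣value cov
  go (suc k) = subst (d ∣_) (sym (trans (cong (λ x → x * twist + 1) (trans (cong (2 ^_) (+-assoc e (k * e) c)) (trans (^-distribˡ-+-* 2 e
      (k * e + c))
      (cong (_* 2 ^ (k * e + c)) (sym (m+[n∸m]≡n (m^n>0 2 e))))))) (lem (2 ^ e ∸ 1) (2 ^ (k * e + c)) twist)))
    (∣m∣n⇒∣m+n (go k) (∣m⇒∣m*n (2 ^ (k * e + c) * twist) d∣2^e-1))

halve : ∀ e k → (∃ λ k′ → k * e ≡ k′ * (2 * e) + e) ⊎ (∃ λ k′ → k * e ≡ k′ * (2 * e) + 0)
halve e zero = inj₂ (0 , refl)
halve e (suc k) with halve e k
... | inj₁ (k′ , eq) = inj₂ (suc k′ , trans (cong (e +_) eq) (lem k′ e))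
  where lem : ∀ k e → e + (k * (2 * e) + e) ≡ suc k * (2 * e) + 0
        lem = solve-∀
... | inj₂ (k′ , eq) = inj₁ (k′ , trans (cong (e +_) eq) (lem k′ e))
  where lem : ∀ k e → e + (k * (2 * e) + 0) ≡ k * (2 * e) + e
        lem = solve-∀

abstract
  covers₃ : Covers 3 1
  covers₃ = record { 1<d = from-yes (1 <? 3) ; small = from-yes (3 ≤? largest) ; ∣mod = from-yes (3 ∣? modulus)
      ; ∣value = from-yes (3 ∣? 2 ^ 1 * twist + 1) }
  covers₅ : Covers 5 2
  covers₅ = record { 1<d = from-yes (1 <? 5) ; small = from-yes (5 ≤? largest) ; ∣mod = from-yes (5 ∣? modulus)
      ; ∣value = from-yes (5 ∣? 2 ^ 2 * twist + 1) }
  covers₁₇ : Covers 17 4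
  covers₁₇ = record { 1<d = from-yes (1 <? 17) ; small = from-yes (17 ≤? largest) ; ∣mod = from-yes (17 ∣? modulus)
      ; ∣value = from-yes (17 ∣? 2 ^ 4 * twist + 1) }
  covers₂₅₇ : Covers 257 8
  covers₂₅₇ = record { 1<d = from-yes (1 <? 257) ; small = from-yes (257 ≤? largest) ; ∣mod = from-yes (257 ∣? modulus)
      ; ∣value = from-yes (257 ∣? 2 ^ 8 * twist + 1) }
  covers₆₅₅₃₇ : Covers 65537 16
  covers₆₅₅₃₇ = record { 1<d = from-yes (1 <? 65537) ; small = from-yes (65537 ≤? largest) ; ∣mod = from-yes (65537 ∣? modulus)
      ; ∣value = from-yes (65537 ∣? 2 ^ 16 * twist + 1) }
  covers₆₄₁ : Covers 641 32
  covers₆₄₁ = record { 1<d = from-yes (1 <? 641) ; small = from-yes (641 ≤? largest) ; ∣mod = from-yes (641 ∣? modulus)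
      ; ∣value = from-yes (641 ∣? 2 ^ 32 * twist + 1) }
  covers₆₇₀₀₄₁₇ : Covers 6700417 0
  covers₆₇₀₀₄₁₇ = record { 1<d = from-yes (1 <? 6700417) ; small = ≤-refl ; ∣mod = from-yes (6700417 ∣? modulus)
      ; ∣value = from-yes (6700417 ∣? 2 ^ 0 * twist + 1) }

abstract
  order₃ : 3 ∣ 2 ^ 2 ∸ 1
  order₃ = from-yes (3 ∣? 2 ^ 2 ∸ 1)
  order₅ : 5 ∣ 2 ^ 4 ∸ 1
  order₅ = from-yes (5 ∣? 2 ^ 4 ∸ 1)
  order₁₇ : 17 ∣ 2 ^ 8 ∸ 1
  order₁₇ = from-yes (17 ∣? 2 ^ 8 ∸ 1)
  order₂₅₇ : 257 ∣ 2 ^ 16 ∸ 1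
  order₂₅₇ = from-yes (257 ∣? 2 ^ 16 ∸ 1)
  order₆₅₅₃₇ : 65537 ∣ 2 ^ 32 ∸ 1
  order₆₅₅₃₇ = from-yes (65537 ∣? 2 ^ 32 ∸ 1)
  order₆₄₁ : 641 ∣ 2 ^ 64 ∸ 1
  order₆₄₁ = from-yes (641 ∣? 2 ^ 64 ∸ 1)
  order₆₇₀₀₄₁₇ : 6700417 ∣ 2 ^ 64 ∸ 1
  order₆₇₀₀₄₁₇ = from-yes (6700417 ∣? 2 ^ 64 ∸ 1)

-- The classes 2^i modulo 2^(i+1) for i < 6, together with 0 modulo 64, exhaust the exponents.
cover : ∀ β → ∃ λ d → Covers d β
cover β = from-1 (β , sym (*-identityʳ β))
  where
  Multiple : ℕ → Set
  Multiple e = ∃ λ k → β ≡ k * e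
  split : ∀ e → Multiple e → (∃ λ k → β ≡ k * (2 * e) + e) ⊎ Multiple (2 * e)
  split e (k , eq) with halve e k
  ... | inj₁ (k′ , eq′) = inj₁ (k′ , trans eq eq′)
  ... | inj₂ (k′ , eq′) = inj₂ (k′ , trans eq (trans eq′ (+-identityʳ (k′ * (2 * e)))))
  from-64 : Multiple 64 → ∃ λ d → Covers d β
  from-64 (k , eq) = 6700417 , covers-shift 64 order₆₇₀₀₄₁₇ covers₆₇₀₀₄₁₇ k (trans eq (sym (+-identityʳ (k * 64))))
  from-32 : Multiple 32 → ∃ λ d → Covers d β
  from-32 m = [ (λ (k , eq) → 641 , covers-shift 64 order₆₄₁ covers₆₄₁ k eq) , from-64 ]′ (split 32 m)
  from-16 : Multiple 16 → ∃ λ d → Covers d β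
  from-16 m = [ (λ (k , eq) → 65537 , covers-shift 32 order₆₅₅₃₇ covers₆₅₅₃₇ k eq) , from-32 ]′ (split 16 m)
  from-8 : Multiple 8 → ∃ λ d → Covers d β
  from-8 m = [ (λ (k , eq) → 257 , covers-shift 16 order₂₅₇ covers₂₅₇ k eq) , from-16 ]′ (split 8 m)
  from-4 : Multiple 4 → ∃ λ d → Covers d β
  from-4 m = [ (λ (k , eq) → 17 , covers-shift 8 order₁₇ covers₁₇ k eq) , from-8 ]′ (split 4 m)
  from-2 : Multiple 2 → ∃ λ d → Covers d β
  from-2 m = [ (λ (k , eq) → 5 , covers-shift 4 order₅ covers₅ k eq) , from-4 ]′ (split 2 m)
  from-1 : Multiple 1 → ∃ λ d → Covers d β
  from-1 m = [ (λ (k , eq) → 3 , covers-shift 2 order₃ covers₃ k eq) , from-2 ]′ (split 1 m)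

-- The congruence between 2^β p + r and r(2^β twist + 1) is written as an equality with multiples of
-- `modulus` added on both sides, which avoids subtraction.
covers-divides : ∀ {d r p β} → Covers d β → p % modulus ≡ (r * twist) % modulus → d ∣ 2 ^ β * p + r
covers-divides {d} {r} {p} {β} cov p≡rw =
  ∣m+n∣m⇒∣n (subst (d ∣_) eq (∣m∣n⇒∣m+n (∣n⇒∣m*n r (Covers.∣value cov)) (∣n⇒∣m*n (2 ^ β * k) (Covers.∣mod cov)))) (∣n⇒∣m*n (2 ^ β * k′)
      (Covers.∣mod cov))
  where
  s = p % modulus
  k = p / modulus
  k′ = r * twist / modulus
  lem : ∀ M r w x s k k′ → r * w ≡ s + k′ * M → r * (x * w + 1) + x * k * M ≡ x * k′ * M + (x * (s + k * M) + r)
  lem M r w x s k k′ e = trans (l₁ M r w x k) (trans (cong (λ z → x * z + r + x * k * M) e) (l₂ M r x s k k′))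
    where l₁ : ∀ M r w x k → r * (x * w + 1) + x * k * M ≡ x * (r * w) + r + x * k * M
          l₁ = solve-∀
          l₂ : ∀ M r x s k k′ → x * (s + k′ * M) + r + x * k * M ≡ x * k′ * M + (x * (s + k * M) + r)
          l₂ = solve-∀
  eq : r * (2 ^ β * twist + 1) + 2 ^ β * k * modulus ≡ 2 ^ β * k′ * modulus + (2 ^ β * p + r)
  eq = trans (lem modulus r twist (2 ^ β) s k k′ (trans (m≡m%n+[m/n]*n (r * twist) modulus) (cong (_+ k′ * modulus) (sym p≡rw))))
    (cong (λ z → 2 ^ β * k′ * modulus + (2 ^ β * z + r)) (sym (m≡m%n+[m/n]*n p modulus)))

abstract
  prime-3 : Prime 3
  prime-3 = from-yes (prime? 3)
  prime-5 : Prime 5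
  prime-5 = from-yes (prime? 5)
  prime-17 : Prime 17
  prime-17 = from-yes (prime? 17)
  prime-257 : Prime 257
  prime-257 = prime-by-trial 17 (from-yes (trial-division 257 17)) (from-yes (257 <? 17 * 17))
  prime-641 : Prime 641
  prime-641 = prime-by-trial 26 (from-yes (trial-division 641 26)) (from-yes (641 <? 26 * 26))
  prime-65537 : Prime 65537
  prime-65537 = prime-by-trial 257 (from-yes (trial-division 65537 257)) (from-yes (65537 <? 257 * 257))
  -- 2589 is the least integer whose square exceeds 6700417.
  prime-6700417 : Prime 6700417
  prime-6700417 = prime-by-trial 2589 (from-yes (trial-division 6700417 2589)) (from-yes (6700417 <? 2589 * 2589))

coprime-twist : Coprime twist modulus
coprime-twist {k} (k∣w , k∣M) = ∣1⇒≡1 (∣m+n∣m⇒∣n (subst (k ∣_) twist² (∣m⇒∣m*n twist k∣w)) (∣n⇒∣m*n 13043111114911583784 k∣M))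

-- Exclusion of the values 2^α p

module _ {r p : ℕ} (pp : Prime p) (large : largest + r < p) (p≡rw : p % modulus ≡ (r * twist) % modulus) where

  private
    r<p : r < p
    r<p = ≤-<-trans (m≤n+m r largest) large
    largest<p : largest < p
    largest<p = ≤-<-trans (m≤m+n largest r) large

    2∤3 : ¬ 3 ∣ 2
    2∤3 = from-no (3 ∣? 2)

    3∤2^ : ∀ α → ¬ 3 ∣ 2 ^ α
    3∤2^ α d = 2∤3 (prime∣^ prime-3 α d)

    p≢3 : 3 ≢ p
    p≢3 = <⇒≢ (≤-<-trans (Covers.small covers₃) largest<p)

    composite : ∀ β {q} → Prime q → q ≡ 2 ^ β * p + r → ⊥
    composite β {q} pq refl with cover β
    ... | d , cov with prime⇒irreducible pq (covers-divides {d} {r} {p} {β} cov p≡rw)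
    ... | inj₁ d≡1 = >⇒≢ (Covers.1<d cov) d≡1
    ... | inj₂ d≡q = <⇒≢ (≤-<-trans (Covers.small cov) (<-≤-trans largest<p (≤-trans (m≤n*m p (2 ^ β) {{m^n≢0 2 β}}) (m≤m+n (2 ^ β * p)
        r)))) d≡q

    -- The exponent 1 is covered by 3, and 2p + r = 3r + 2(p - r).
    3∣p∸r : 3 ∣ p ∸ r
    3∣p∸r with euclidsLemma 2 (p ∸ r) prime-3 (∣m+n∣m⇒∣n (subst (3 ∣_) eq (covers-divides {3} {r} {p} {1} covers₃ p≡rw)) (m∣m*n r))
      where
      lem : ∀ r t → 2 * (r + t) + r ≡ 3 * r + 2 * t
      lem = solve-∀
      eq : 2 ^ 1 * p + r ≡ 3 * r + 2 * (p ∸ r)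
      eq = trans (cong (λ z → 2 ^ 1 * z + r) (sym (m+[n∸m]≡n (<⇒≤ r<p)))) (lem r (p ∸ r))
    ... | inj₁ 3∣2 = contradiction 3∣2 2∤3
    ... | inj₂ 3∣t = 3∣t

    2^p≢0 : ∀ α → 2 ^ α * p ≢ 0
    2^p≢0 α = >⇒≢ (*-mono-≤ (m^n>0 2 α) (prime-≥1 pp))

  nontotient : ∀ α → SchemmelNontotient r (2 ^ α * p)
  nontotient α = *-mono-≤ (m^n>0 2 α) (prime-≥1 pp) , λ (m , _ , Sm≡) → not-value m Sm≡
    where
    not-value : ∀ m → S r m ≢ 2 ^ α * p
    not-value m Sm≡ with S-divisor {r} {m} pp (n∣m*n (2 ^ α)) (2^p≢0 α) Sm≡
    ... | q , pq , r<q , q∸r∣ , p∣q∸r with p ≟ q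
    ... | yes refl with euclidsLemma (2 ^ α) p prime-3 (∣-trans 3∣p∸r q∸r∣)
    ...   | inj₁ 3∣2^α = 3∤2^ α 3∣2^α
    ...   | inj₂ 3∣p = p≢3 (prime∣prime prime-3 pp 3∣p)
    not-value m Sm≡ | q , pq , r<q , q∸r∣ , p∣q∸r | no p≢q with p∣q∸r p≢q
    ... | divides c q∸r≡c*p with divisors-2^ α {c} (*-cancelʳ-∣ p {{prime⇒nonZero pp}} (subst (_∣ 2 ^ α * p) q∸r≡c*p q∸r∣))
    ... | β , c≡2^β = composite β pq (trans (sym (m+[n∸m]≡n (<⇒≤ r<q))) (trans (+-comm r (q ∸ r)) (cong (_+ r) (trans q∸r≡c*p (cong (_* p)
        c≡2^β)))))

theorem3p3 : (r : ℕ) → 1 ≤ r → ¬ (2 ∣ r) →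
    ¬ (3 ∣ r) → ¬ (5 ∣ r) → ¬ (17 ∣ r) → ¬ (257 ∣ r) → ¬ (641 ∣ r) →
    ¬ (65537 ∣ r) → ¬ (6700417 ∣ r) →
    (N : ℕ) → ∃ λ p → (N < p) × Prime p ×
    ((α : ℕ) → SchemmelNontotient r (2 ^ α * p))
theorem3p3 r _ _ ¬3 ¬5 ¬17 ¬257 ¬641 ¬65537 ¬6700417 N =
  -- The prime must exceed r, every covering divisor and N at once; the successor makes the bound
  -- positive, as `dirichlet` demands.
  let p , bound<p , pp , p≡rw = dirichlet modulus (r * twist) (λ {k} → coprime-* {r} {twist} coprime-r coprime-twist {k}) (suc (largest + r + N)) z<s
      bound = <-trans (n<1+n (largest + r + N)) bound<p
  in p , ≤-<-trans (m≤n+m N (largest + r)) bound , pp , nontotient pp (≤-<-trans (m≤m+n (largest + r) N) bound) p≡rw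
  where
  coprime-r : Coprime r modulus
  coprime-r = subst (Coprime r) product≡modulus (λ {k} → coprime-product fermatDivisors ((prime-3 , ¬3) ∷ (prime-5 , ¬5) ∷ (prime-17 , ¬17) ∷
    (prime-257 , ¬257) ∷ (prime-641 , ¬641) ∷ (prime-65537 , ¬65537) ∷ (prime-6700417 , ¬6700417) ∷ []) {k})
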